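{- All of the following tuples are universal: $(16,8,6,4,4,0)$, $(16,8,6,4,6,2)$, $(18,6,6,4,6,2)$, $(20,10,5,1,4,2)$, $(20,10,5,3,4,2)$, $(24,12,6,2,2,0)$.
   Context: For $a_1,b_1,c_1$ positive integers and $a_2,b_2,c_2$ integers with $a_1-a_2$, $b_1-b_2$, $c_1-c_2$ all even, the tuple $(a_1,a_2,b_1,b_2,c_1,c_2)$ is called universal if every nonnegative integer $n$ can be written as $\frac{x(a_1x+a_2)}2+\frac{y(b_1y+b_2)}2+\frac{z(c_1z+c_2)}2$ with $x,y,z\in\mathbb{Z}$. -}

module Defs where

open import Data.Nat using (ℕ)
open import Data.Integer using (ℤ; +_; _+_; _*_; _-_; _<_)
open import Data.Integer.Divisibility using (_∣_)
open import Data.Product using (_×_; ∃-syntax)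
open import Relation.Binary.PropositionalEquality using (_≡_)

Admissible : ℤ → ℤ → ℤ → ℤ → ℤ → ℤ → Set
Admissible a₁ a₂ b₁ b₂ c₁ c₂ =
  (+ 0 < a₁) × (+ 0 < b₁) × (+ 0 < c₁) ×
  (+ 2 ∣ (a₁ - a₂)) × (+ 2 ∣ (b₁ - b₂)) × (+ 2 ∣ (c₁ - c₂))

-- n = x(a₁x+a₂)/2 + y(b₁y+b₂)/2 + z(c₁z+c₂)/2, stated after multiplying by 2
-- (each x(a₁x+a₂) is even under the parity assumption, so this is exact).
Represents : ℤ → ℤ → ℤ → ℤ → ℤ → ℤ → ℕ → Set
Represents a₁ a₂ b₁ b₂ c₁ c₂ n =
  ∃[ x ] ∃[ y ] ∃[ z ]
    (+ 2 * + n ≡ x * (a₁ * x + a₂) + y * (b₁ * y + b₂) + z * (c₁ * z + c₂))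

Universal : ℤ → ℤ → ℤ → ℤ → ℤ → ℤ → Set
Universal a₁ a₂ b₁ b₂ c₁ c₂ =
  Admissible a₁ a₂ b₁ b₂ c₁ c₂ × ((n : ℕ) → Represents a₁ a₂ b₁ b₂ c₁ c₂ n)

{-# OPTIONS --safe #-}
module Submission where

-- Completing squares turns each tuple into the assertion that a ternary form represents an arithmetic progression, and
-- all of these follow from x² + y² + z² (for 200n + 155 and 200n + 195) and x² + xy + y² + z². These two forms are alone
-- in their discriminants (4 and 3, for 4ABC + RST - AR² - BS² - CT²), so they represent n as soon as n is the leading
-- coefficient of some positive form of that discriminant. Such a form exists once there is an a > 0 such that -N is a
-- square modulo a and t a is a square modulo 8M, for suitable N, M and t. Instead of a prime a from Dirichlet's theorem,
-- a possibly composite one is found by counting: with χ(d) = (-N/d) and r(a) = Σ_{d ∣ a} χ(d), in the sum over a < Y² of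
-- r(a) Π (1 ± ψ(a)), where ψ runs over the characters to be prescribed, the nontrivial products of the ψ contribute O(Y)
-- by the hyperbola method, whereas the norms x² + N y² make the trivial one exceed any multiple of Y.
open import Defs
open import Data.Nat as ℕ using (ℕ; zero; suc; z≤n; s≤s; NonZero; ⌊_/2⌋)
import Data.Nat.Properties as ℕₚ
import Data.Nat.Divisibility as ℕ∣
import Data.Nat.DivMod as ℕ/
open import Data.Nat.Primality as Primality using (Prime)
open import Data.Nat.Primality.Factorisation using (factorise; PrimeFactorisation)
open import Data.Nat.ListAction using (product)
open import Data.Nat.Coprimality as Coprimality using (Coprime)
open import Data.Nat.GCD using (module Bézout)
open import Data.Nat.Induction using (<-wellFounded)
import Data.Nat.Tactic.RingSolver as ℕSolver
open import Data.Integer as ℤ using (ℤ; +_; -[1+_]; _+_; _*_; -_; _-_; ∣_∣; +≤+; +<+; 0ℤ; 1ℤ; -1ℤ)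
import Data.Integer.Properties as ℤₚ
import Data.Integer.DivMod as ℤ/
open import Data.Integer.Divisibility.Signed as ℤ∣ using (_∣_; divides)
open import Data.Integer.Tactic.RingSolver using (solve-∀)
open import Data.Sign using (Sign) renaming (_*_ to _·_; + to ⊕; - to ⊖)
import Data.Sign.Properties as Signₚ
open import Data.Fin as Fin using (Fin; toℕ; fromℕ<)
import Data.Fin.Properties as Finₚ
open import Data.Fin.Permutation using (Permutation; permutation; _⟨$⟩ʳ_)
open import Data.Vec as Vec using (Vec; []; _∷_)
open import Data.List as List using (List; []; _∷_)
open import Data.List.Relation.Unary.All using (All; []; _∷_)
open import Data.List.Relation.Unary.Any using (here; there)
open import Data.List.Membership.Propositional using (_∈_)
open import Data.Product using (Σ-syntax; _×_; _,_; proj₁; proj₂)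
open import Data.Sum using (_⊎_; inj₁; inj₂)
open import Data.Empty using (⊥; ⊥-elim)
open import Function using (_∘_; case_of_)
open import Induction.WellFounded using (Acc; acc)
open import Relation.Nullary using (¬_; Dec; yes; no)
open import Relation.Nullary.Decidable using (from-no; from-yes)
open import Relation.Binary.PropositionalEquality hiding (J)
open import Algebra.Properties.CommutativeMonoid.Sum Signₚ.*-commutativeMonoid
  using () renaming (sum to ∏; sum-cong-≗ to ∏-cong; ∑-distrib-+ to ∏-distrib; ∑-comm to ∏-comm; sum-permute to ∏-permute)
import Algebra.Properties.CommutativeMonoid.Sum ℤₚ.*-1-commutativeMonoid as Product
import Algebra.Properties.CommutativeMonoid.Sum ℤₚ.+-0-commutativeMonoid as Sum

-- Congruences and units

-- The obstacle is that the hyperbola bound for a product F of the ψ needs both F and χF to be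
-- nontrivial. If χ were itself such a product, the prescribed signs could contradict -N being a
-- square modulo a. So one prime ℓ dividing N gets no prescribed sign: 3 when the factor 3 of N
-- comes from the discriminant, 5 for the two progressions of multiples of 5, and otherwise a prime
-- factor of the number to be represented. In the last two cases the square needed at ℓ is recovered
-- from quadratic reciprocity.
--
-- No lower bound for an L-series enters: r is nonnegative and at least 1 on the norms in use, and
-- the powers y = P^j alone place K distinct norms between consecutive large squares (Pi + 1)², for
-- any K.
--
-- A composite a costs little: r(a) ≠ 0 makes a the product of a square and of distinct primes q
-- with χ(q) = 1, and sign-valued characters do not see the square.
--
-- The tuples also impose congruences on the variables. Most follow from the few squares modulo 3, 4
-- and 5; one parity has to be arranged by reflections of the lattice.

infix 4 _≈_[_]
-- The equation is solved for `a`, so that matching on `refl` eliminates `a` and leaves each law of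
-- congruences to the ring solver.
record _≈_[_] (a b n : ℤ) : Set where
  constructor by
  field
    quotient : ℤ
    equality : a ≡ b + quotient * n

≈-reflexive : ∀ {a b n} → a ≡ b → a ≈ b [ n ]
≈-reflexive {a} {n = n} refl = by 0ℤ (lemma a n)
  where
  lemma : ∀ a n → a ≡ a + 0ℤ * n
  lemma = solve-∀

≈-refl : ∀ {a n} → a ≈ a [ n ]
≈-refl = ≈-reflexive refl

≈-sym : ∀ {a b n} → a ≈ b [ n ] → b ≈ a [ n ]
≈-sym {b = b} {n} (by q refl) = by (- q) (lemma b q n)
  where
  lemma : ∀ b q n → b ≡ b + q * n + - q * n
  lemma = solve-∀

≈-trans : ∀ {a b c n} → a ≈ b [ n ] → b ≈ c [ n ] → a ≈ c [ n ]
≈-trans {c = c} {n} (by q refl) (by r refl) = by (r + q) (lemma c q r n)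
  where
  lemma : ∀ c q r n → c + r * n + q * n ≡ c + (r + q) * n
  lemma = solve-∀

+-cong : ∀ {a b c d n} → a ≈ b [ n ] → c ≈ d [ n ] → a + c ≈ b + d [ n ]
+-cong {b = b} {d = d} {n} (by q refl) (by r refl) = by (q + r) (lemma b d q r n)
  where
  lemma : ∀ b d q r n → b + q * n + (d + r * n) ≡ b + d + (q + r) * n
  lemma = solve-∀

*-cong : ∀ {a b c d n} → a ≈ b [ n ] → c ≈ d [ n ] → a * c ≈ b * d [ n ]
*-cong {b = b} {d = d} {n} (by q refl) (by r refl) = by (b * r + q * d + q * r * n) (lemma b d q r n)
  where
  lemma : ∀ b d q r n → (b + q * n) * (d + r * n) ≡ b * d + (b * r + q * d + q * r * n) * n
  lemma = solve-∀

*-congˡ : ∀ {a b n} c → a ≈ b [ n ] → c * a ≈ c * b [ n ]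
*-congˡ c = *-cong (≈-refl {c})

*-congʳ : ∀ {a b n} c → a ≈ b [ n ] → a * c ≈ b * c [ n ]
*-congʳ c e = *-cong e (≈-refl {c})

neg-cong : ∀ {a b n} → a ≈ b [ n ] → - a ≈ - b [ n ]
neg-cong {b = b} {n} (by q refl) = by (- q) (lemma b q n)
  where
  lemma : ∀ b q n → - (b + q * n) ≡ - b + - q * n
  lemma = solve-∀

≈⇒∣ : ∀ {a b n} → a ≈ b [ n ] → n ∣ a - b
≈⇒∣ {b = b} {n} (by q refl) = divides q (lemma b q n)
  where
  lemma : ∀ b q n → b + q * n - b ≡ q * n
  lemma = solve-∀

∣⇒≈ : ∀ {a b n} → n ∣ a - b → a ≈ b [ n ]
∣⇒≈ {a} {b} (divides q eq) = by q (trans (lemma a b) (cong (_+_ b) eq))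
  where
  lemma : ∀ a b → a ≡ b + (a - b)
  lemma = solve-∀

≈0⇒∣ : ∀ {a n} → a ≈ 0ℤ [ n ] → n ∣ a
≈0⇒∣ (by q refl) = divides q (ℤₚ.+-identityˡ _)

∣⇒≈0 : ∀ {a n} → n ∣ a → a ≈ 0ℤ [ n ]
∣⇒≈0 (divides q refl) = by q (sym (ℤₚ.+-identityˡ _))

≈-weaken : ∀ {a b m n} → m ∣ n → a ≈ b [ n ] → a ≈ b [ m ]
≈-weaken {b = b} {m} (divides k refl) (by q refl) = by (q * k) (cong (_+_ b) (sym (ℤₚ.*-assoc q k m)))

record Unit (a n : ℤ) : Set where
  constructor unit
  field
    inverse   : ℤ
    isInverse : a * inverse ≈ 1ℤ [ n ]

unit-1 : ∀ {n} → Unit 1ℤ n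
unit-1 = unit 1ℤ ≈-refl

unit-* : ∀ {a b n} → Unit a n → Unit b n → Unit (a * b) n
unit-* {a} {b} (unit a' p) (unit b' q) = unit (a' * b') (≈-trans (≈-reflexive (lemma a b a' b')) (*-cong p q))
  where
  lemma : ∀ a b a' b' → a * b * (a' * b') ≡ a * a' * (b * b')
  lemma = solve-∀

unit-*ˡ : ∀ {a b n} → Unit (a * b) n → Unit a n
unit-*ˡ {a} {b} (unit c p) = unit (b * c) (≈-trans (≈-reflexive (sym (ℤₚ.*-assoc a b c))) p)

unit-*ʳ : ∀ {a b n} → Unit (a * b) n → Unit b n
unit-*ʳ {a} {b} u = unit-*ˡ {b} {a} (subst (λ z → Unit z _) (ℤₚ.*-comm a b) u)

unit-neg : ∀ {a n} → Unit a n → Unit (- a) n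
unit-neg {a} (unit b p) = unit (- b) (≈-trans (≈-reflexive (lemma a b)) p)
  where
  lemma : ∀ a b → - a * - b ≡ a * b
  lemma = solve-∀

unit-≈ : ∀ {a b n} → a ≈ b [ n ] → Unit a n → Unit b n
unit-≈ e (unit c p) = unit c (≈-trans (*-congʳ c (≈-sym e)) p)

-- Bézout's identity a b = 1 + q n read modulo a: there -q inverts n. Thus `Unit` is a symmetric
-- coprimality relation, and its closure under products carries over to the modulus.
unit-sym : ∀ {a n} → Unit a n → Unit n a
unit-sym {a} {n} (unit b (by q e)) = unit (- q) (by (- b) (trans (lemma₁ n q) (trans (cong (λ z → 1ℤ - z) (sym e)) (lemma₂ a b))))
  where
  lemma₁ : ∀ n q → n * - q ≡ 1ℤ - (1ℤ + q * n)
  lemma₁ = solve-∀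
  lemma₂ : ∀ a b → 1ℤ - a * b ≡ 1ℤ + - b * a
  lemma₂ = solve-∀

unit-∣ : ∀ {a m n} → m ∣ n → Unit a n → Unit a m
unit-∣ d (unit b p) = unit b (≈-weaken d p)

unit-*-modulus : ∀ {a m n} → Unit a m → Unit a n → Unit a (m * n)
unit-*-modulus um un = unit-sym (unit-* (unit-sym um) (unit-sym un))

unit-cancel : ∀ {a x y n} → Unit a n → a * x ≈ a * y [ n ] → x ≈ y [ n ]
unit-cancel {a} {x} {y} {n} (unit b p) e = ≈-trans (≈-sym (inv x)) (≈-trans (*-congˡ b e) (inv y))
  where
  lemma : ∀ a b x → b * (a * x) ≡ a * b * x
  lemma = solve-∀
  inv : ∀ x → b * (a * x) ≈ x [ n ]
  inv x = ≈-trans (≈-reflexive (lemma a b x)) (≈-trans (*-congʳ x p) (≈-reflexive (ℤₚ.*-identityˡ x)))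

unit-∣-cancel : ∀ {a x n} → Unit a n → n ∣ a * x → n ∣ x
unit-∣-cancel {a} u d = ≈0⇒∣ (unit-cancel u (≈-trans (∣⇒≈0 d) (≈-reflexive (sym (ℤₚ.*-zeroʳ a)))))

crt : ∀ {m n} → Unit m n → ∀ a b → Σ[ x ∈ ℤ ] (x ≈ a [ m ]) × (x ≈ b [ n ])
crt {m} {n} (unit m' p) a b = a + (b - a) * (m * m') , by ((b - a) * m') (lemma₁ a b m m') ,
  ≈-trans (+-cong (≈-refl {a}) (*-congˡ (b - a) p)) (≈-reflexive (lemma₂ a b))
  where
  lemma₁ : ∀ a b m m' → a + (b - a) * (m * m') ≡ a + (b - a) * m' * m
  lemma₁ = solve-∀
  lemma₂ : ∀ a b → a + (b - a) * 1ℤ ≡ b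
  lemma₂ = solve-∀

∣-coprime-* : ∀ {m n x} → Unit m n → m ∣ x → n ∣ x → m * n ∣ x
∣-coprime-* {m} {n} u (divides q refl) d with unit-∣-cancel {m} {q} u (subst (n ∣_) (ℤₚ.*-comm q m) d)
... | divides r refl = divides r (lemma r m n)
  where
  lemma : ∀ r m n → r * n * m ≡ r * (m * n)
  lemma = solve-∀

crt-unique : ∀ {m n x y} → Unit m n → x ≈ y [ m ] → x ≈ y [ n ] → x ≈ y [ m * n ]
crt-unique u p q = ∣⇒≈ (∣-coprime-* u (≈⇒∣ p) (≈⇒∣ q))

coprime⇒unit : ∀ {m n} → Coprime m n → Unit (+ m) (+ n)
coprime⇒unit {m} {n} c with Coprimality.coprime-Bézout c
... | Bézout.+- x y eq = unit (+ x) (by (+ y) (trans (trans (sym (ℤₚ.pos-* m x)) (cong +_ (trans (ℕₚ.*-comm m x) (sym eq))))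
                                     (cong (_+_ 1ℤ) (ℤₚ.pos-* y n))))
... | Bézout.-+ x y eq = unit (- (+ x)) (by (- (+ y)) (trans (lemma₁ (+ m) (+ x)) (trans (cong (λ z → 1ℤ - z) eq') (lemma₂ (+ y) (+ n)))))
  where
  eq' : 1ℤ + + x * + m ≡ + y * + n
  eq' = trans (cong (_+_ 1ℤ) (sym (ℤₚ.pos-* x m))) (trans (cong +_ eq) (ℤₚ.pos-* y n))
  lemma₁ : ∀ m x → m * - x ≡ 1ℤ - (1ℤ + x * m)
  lemma₁ = solve-∀
  lemma₂ : ∀ y n → 1ℤ - y * n ≡ 1ℤ + - y * n
  lemma₂ = solve-∀

unit⇒coprime : ∀ {m n} → Unit (+ m) (+ n) → Coprime m n
unit⇒coprime {m} {n} (unit b (by q e)) {i} (i∣m , i∣n) = ℕ∣.∣1⇒≡1 (ℤ∣.∣⇒∣ᵤ {+ i} {1ℤ} (ℤ∣.∣m+n∣n⇒∣m {+ i} {1ℤ} {q * + n}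
  (subst (+ i ∣_) e (ℤ∣.∣m⇒∣m*n {+ i} {+ m} b (ℤ∣.∣ᵤ⇒∣ i∣m))) (ℤ∣.∣n⇒∣m*n q (ℤ∣.∣ᵤ⇒∣ i∣n))))

unit-abs : ∀ {a n} → Unit (+ ∣ a ∣) n → Unit a n
unit-abs {+ a} u = u
unit-abs { -[1+ a ]} u = unit-neg u

unit-abs⁻¹ : ∀ {a n} → Unit a n → Unit (+ ∣ a ∣) n
unit-abs⁻¹ {+ a} u = u
unit-abs⁻¹ { -[1+ a ]} u = unit-neg u

unit? : ∀ a n → Dec (Unit (+ a) (+ n))
unit? a n with Coprimality.coprime? a n
... | yes c = yes (coprime⇒unit c)
... | no ¬c = no (¬c ∘ unit⇒coprime)

prime⇒unit : ∀ {p a} → Prime p → ¬ (+ p ∣ a) → Unit a (+ p)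
prime⇒unit {p} {a} pp ¬d = unit-abs (coprime⇒unit c)
  where
  c : Coprime ∣ a ∣ p
  c (i∣a , i∣p) with Primality.prime⇒irreducible pp i∣p
  ... | inj₁ i≡1 = i≡1
  ... | inj₂ refl = ⊥-elim (¬d (ℤ∣.∣ᵤ⇒∣ i∣a))

∤⇒unit : ∀ {p m} → Prime p → ¬ (p ℕ∣.∣ m) → Unit (+ p) (+ m)
∤⇒unit pp p∤m = unit-sym (prime⇒unit pp (p∤m ∘ ℤ∣.∣⇒∣ᵤ))

prime>1 : ∀ {p} → Prime p → 1 ℕ.< p
prime>1 {suc (suc p)} pp = s≤s (s≤s z≤n)
prime>1 {0} pp = ⊥-elim (Primality.¬prime[0] pp)
prime>1 {1} pp = ⊥-elim (Primality.¬prime[1] pp)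

small-∣⇒0 : ∀ {n x} → + n ∣ x → ∣ x ∣ ℕ.< n → x ≡ 0ℤ
small-∣⇒0 {n} {x} d lt with ∣ x ∣ in eq | ℤ∣.∣⇒∣ᵤ d
... | zero  | _ = ℤₚ.∣i∣≡0⇒i≡0 eq
... | suc k | d' = ⊥-elim (ℕₚ.<⇒≱ lt (ℕ∣.∣⇒≤ d'))

-- Gauss's lemma and quadratic reciprocity

od : ℕ → ℕ
od h = suc (h ℕ.+ h)

σ : Sign → ℤ
σ ⊕ = 1ℤ
σ ⊖ = -1ℤ

σ-* : ∀ s t → σ (s · t) ≡ σ s * σ t
σ-* ⊕ ⊕ = refl
σ-* ⊕ ⊖ = refl
σ-* ⊖ ⊕ = refl
σ-* ⊖ ⊖ = refl

leastSign : ℕ → ℕ → Sign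
leastSign h r with r ℕ.≤? h
... | yes _ = ⊕
... | no  _ = ⊖

leastAbs : ℕ → ℕ → ℕ
leastAbs h r with r ℕ.≤? h
... | yes _ = r
... | no  _ = od h ℕ.∸ r

-- The residue of x modulo 2h+1 of least absolute value is σ (rsign h x) * + rabs h x.
rsign : ℕ → ℤ → Sign
rsign h x = leastSign h (x ℤ/.%ℕ od h)

rabs : ℕ → ℤ → ℕ
rabs h x = leastAbs h (x ℤ/.%ℕ od h)

least-≈ : ∀ h r → r ℕ.< od h → + r ≈ σ (leastSign h r) * + leastAbs h r [ + od h ]
least-≈ h r r<n with r ℕ.≤? h
... | yes _ = ≈-reflexive (sym (ℤₚ.*-identityˡ (+ r)))
... | no  _ = by 1ℤ (trans (lemma (+ r) (+ od h)) (cong (λ z → -1ℤ * z + 1ℤ * + od h) (trans (ℤₚ.m-n≡m⊖n (od h) r) (ℤₚ.⊖-≥ (ℕₚ.<⇒≤ r<n)))))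
  where
  lemma : ∀ r n → r ≡ -1ℤ * (n - r) + 1ℤ * n
  lemma = solve-∀

least-≤ : ∀ h r → leastAbs h r ℕ.≤ h
least-≤ h r with r ℕ.≤? h
... | yes r≤h = r≤h
... | no  r≰h = ℕₚ.≤-trans (ℕₚ.∸-monoʳ-≤ (od h) (ℕₚ.≰⇒> r≰h)) (ℕₚ.≤-reflexive (ℕₚ.m+n∸m≡n h h))

rem-≈ : ∀ x n .{{_ : NonZero n}} → x ≈ + (x ℤ/.%ℕ n) [ + n ]
rem-≈ x n = by (x ℤ/./ℕ n) (ℤ/.a≡a%ℕn+[a/ℕn]*n x n)

residue-≈ : ∀ h x → x ≈ σ (rsign h x) * + rabs h x [ + od h ]
residue-≈ h x = ≈-trans (rem-≈ x (od h)) (least-≈ h (x ℤ/.%ℕ od h) (ℤ/.n%ℕd<d x (od h)))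

rabs-≤ : ∀ h x → rabs h x ℕ.≤ h
rabs-≤ h x = least-≤ h (x ℤ/.%ℕ od h)

private
  m-n<od : ∀ {h a b} → a ℕ.≤ h → b ℕ.≤ h → ∣ + a - + b ∣ ℕ.< od h
  m-n<od {h} {a} {b} a≤h b≤h = s≤s (ℕₚ.≤-trans (ℤₚ.∣i-j∣≤∣i∣+∣j∣ (+ a) (+ b)) (ℕₚ.+-mono-≤ a≤h b≤h))

  m+n<od : ∀ {h a b} → a ℕ.≤ h → b ℕ.≤ h → ∣ + a + + b ∣ ℕ.< od h
  m+n<od a≤h b≤h = s≤s (ℕₚ.+-mono-≤ a≤h b≤h)

  same : ∀ {h a b} → a ℕ.≤ h → b ℕ.≤ h → + a ≈ + b [ + od h ] → a ≡ b
  same {a = a} {b} a≤h b≤h e = ℤₚ.+-injective (ℤₚ.i-j≡0⇒i≡j (+ a) (+ b) (small-∣⇒0 (≈⇒∣ e) (m-n<od a≤h b≤h)))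

  opp : ∀ {h a b} → a ℕ.≤ h → 0 ℕ.< b → b ℕ.≤ h → + a ≈ -1ℤ * + b [ + od h ] → ⊥
  opp {h} {a} {suc b} a≤h 0<b b≤h e with small-∣⇒0 {od h} {+ a + + suc b} (≈0⇒∣ e') (m+n<od a≤h b≤h)
    where
    lemma : ∀ b → -1ℤ * b + b ≡ 0ℤ
    lemma = solve-∀
    e' : + a + + suc b ≈ 0ℤ [ + od h ]
    e' = ≈-trans (+-cong e (≈-refl {+ suc b})) (≈-reflexive (lemma (+ suc b)))
  ... | eq with trans (sym (ℕₚ.+-suc a b)) (ℤₚ.+-injective eq)
  ... | ()

  -1*-1 : ∀ z → -1ℤ * (-1ℤ * z) ≡ z
  -1*-1 = solve-∀

  1*1 : ∀ z → 1ℤ * z ≡ z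
  1*1 = ℤₚ.*-identityˡ

-- Numbers up to h have difference and sum below 2h + 1 in absolute value, so a congruence between
-- them up to sign is an equality. Positivity of `b` excludes 0, whose sign would be ambiguous.
residue-unique : ∀ {h} s t {a b} → a ℕ.≤ h → 0 ℕ.< b → b ℕ.≤ h →
                 σ s * + a ≈ σ t * + b [ + od h ] → (s ≡ t) × (a ≡ b)
residue-unique ⊕ ⊕ a≤h 0<b b≤h e = refl , same a≤h b≤h (subst₂ (_≈_[ _ ]) (1*1 _) (1*1 _) e)
residue-unique ⊖ ⊖ a≤h 0<b b≤h e = refl , same a≤h b≤h (subst₂ (_≈_[ _ ]) (-1*-1 _) (-1*-1 _) (*-congˡ -1ℤ e))
residue-unique ⊕ ⊖ a≤h 0<b b≤h e = ⊥-elim (opp a≤h 0<b b≤h (subst (_≈ _ [ _ ]) (1*1 _) e))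
residue-unique ⊖ ⊕ a≤h 0<b b≤h e = ⊥-elim (opp a≤h 0<b b≤h (subst₂ (_≈_[ _ ]) (-1*-1 _) (cong (_*_ -1ℤ) (1*1 _)) (*-congˡ -1ℤ e)))

residue-determined : ∀ {h x} s {b} → 0 ℕ.< b → b ℕ.≤ h → x ≈ σ s * + b [ + od h ] → (rsign h x ≡ s) × (rabs h x ≡ b)
residue-determined {h} {x} s 0<b b≤h e =
  residue-unique (rsign h x) s (rabs-≤ h x) 0<b b≤h (≈-trans (≈-sym (residue-≈ h x)) e)

pos : ∀ {h} → Fin h → ℤ
pos i = + suc (toℕ i)

pos-∤ : ∀ {h} (i : Fin h) → ¬ (+ od h ∣ pos i)
pos-∤ {h} i d with small-∣⇒0 d (s≤s (ℕₚ.≤-trans (Finₚ.toℕ<n i) (ℕₚ.m≤m+n h h)))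
... | ()

-- Gauss's lemma taken as the definition for every odd modulus 2h + 1, prime or not; for `a` prime
-- to the modulus this is the Jacobi symbol. For other `a` it is still a sign instead of 0, whence
-- the `Unit` hypotheses of the laws below.
jacobi : ℤ → ℕ → Sign
jacobi a h = ∏ {h} (λ i → rsign h (a * pos i))

rem-cong : ∀ {x y} n .{{_ : NonZero n}} → x ≈ y [ + n ] → x ℤ/.%ℕ n ≡ y ℤ/.%ℕ n
rem-cong {x} {y} n e = ℤₚ.+-injective (ℤₚ.i-j≡0⇒i≡j _ _ (small-∣⇒0 (≈⇒∣ (≈-trans (≈-sym (rem-≈ x n)) (≈-trans e (rem-≈ y n))))
  (ℕₚ.≤-<-trans (ℕₚ.≤-reflexive (cong ∣_∣ (ℤₚ.m-n≡m⊖n (x ℤ/.%ℕ n) (y ℤ/.%ℕ n))))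
    (ℕₚ.≤-<-trans (ℤₚ.∣m⊝n∣≤m⊔n (x ℤ/.%ℕ n) (y ℤ/.%ℕ n)) (ℕₚ.⊔-lub (ℤ/.n%ℕd<d x n) (ℤ/.n%ℕd<d y n))))))

jacobi-≈ : ∀ {a b} h → a ≈ b [ + od h ] → jacobi a h ≡ jacobi b h
jacobi-≈ h e = ∏-cong {h} λ i → cong (leastSign h) (rem-cong (od h) (*-congʳ (pos i) e))

-- A unit permutes the pairs ±1, ..., ±h. `to` is this permutation, and its inverse `from` comes
-- from the inverse of `b`.
module Multiplication (h : ℕ) {b : ℤ} (u : Unit b (+ od h)) where
  image : ∀ {b} (u : Unit b (+ od h)) (i : Fin h) →
          Σ[ j ∈ Fin h ] (b * pos i ≈ σ (rsign h (b * pos i)) * pos j [ + od h ]) × (rabs h (b * pos i) ≡ suc (toℕ j))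
  image {b} u i with rabs h (b * pos i) in eq
  ... | zero = ⊥-elim (pos-∤ i (unit-∣-cancel u (≈0⇒∣ (≈-trans (residue-≈ h (b * pos i))
                 (≈-reflexive (trans (cong (λ k → σ (rsign h (b * pos i)) * + k) eq) (ℤₚ.*-zeroʳ (σ (rsign h (b * pos i))))))))))
  ... | suc k = fromℕ< k<h , ≈-trans (residue-≈ h (b * pos i)) (≈-reflexive (cong (λ j → σ (rsign h (b * pos i)) * + j) (trans eq eq'))) , eq'
    where
    k<h : k ℕ.< h
    k<h = subst (ℕ._≤ h) eq (rabs-≤ h (b * pos i))
    eq' : suc k ≡ suc (toℕ (fromℕ< k<h))
    eq' = cong suc (sym (Finₚ.toℕ-fromℕ< k<h))

  to : Fin h → Fin h
  to i = proj₁ (image u i)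

  to-≈ : ∀ i → b * pos i ≈ σ (rsign h (b * pos i)) * pos (to i) [ + od h ]
  to-≈ i = proj₁ (proj₂ (image u i))

  to-rabs : ∀ i → rabs h (b * pos i) ≡ suc (toℕ (to i))
  to-rabs i = proj₂ (proj₂ (image u i))

  inv : ℤ
  inv = Unit.inverse u

  u⁻¹ : Unit inv (+ od h)
  u⁻¹ = unit b (≈-trans (≈-reflexive (ℤₚ.*-comm inv b)) (Unit.isInverse u))

  from : Fin h → Fin h
  from i = proj₁ (image u⁻¹ i)

  from-≈ : ∀ i → inv * pos i ≈ σ (rsign h (inv * pos i)) * pos (from i) [ + od h ]
  from-≈ i = proj₁ (proj₂ (image u⁻¹ i))

  sq : ∀ s x → σ s * (σ s * x) ≡ x
  sq ⊕ x = trans (1*1 _) (1*1 _)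
  sq ⊖ x = -1*-1 x

  undo : ∀ {c d} → c * d ≈ 1ℤ [ + od h ] → ∀ s t {i j k : Fin h} → d * pos i ≈ σ s * pos j [ + od h ] →
         c * pos j ≈ σ t * pos k [ + od h ] → k ≡ i
  undo {c} {d} cd s t {i} {j} {k} p q = sym (Finₚ.toℕ-injective (ℕₚ.suc-injective (proj₂
    (residue-unique {h} ⊕ (s · t) {suc (toℕ i)} {suc (toℕ k)} (Finₚ.toℕ<n i) (s≤s z≤n) (Finₚ.toℕ<n k)
      (≈-trans (≈-reflexive (trans (1*1 (pos i)) (sym (sq s (pos i))))) (≈-trans (*-congˡ (σ s) (≈-trans step q)) (≈-reflexive collect)))))))
    where
    lemma : ∀ c s x → c * (s * x) ≡ s * (c * x)
    lemma = solve-∀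
    collect : σ s * (σ t * pos k) ≡ σ (s · t) * pos k
    collect = trans (sym (ℤₚ.*-assoc (σ s) (σ t) (pos k))) (cong (_* pos k) (sym (σ-* s t)))
    d-step : pos i ≈ σ s * (c * pos j) [ + od h ]
    d-step = ≈-trans (≈-sym (≈-trans (*-congʳ (pos i) cd) (≈-reflexive (1*1 (pos i)))))
      (≈-trans (≈-reflexive (ℤₚ.*-assoc c d (pos i))) (≈-trans (*-congˡ c p) (≈-reflexive (lemma c (σ s) (pos j)))))
    step : σ s * pos i ≈ c * pos j [ + od h ]
    step = ≈-trans (*-congˡ (σ s) d-step) (≈-reflexive (sq s (c * pos j)))

  perm : Permutation h h
  perm = permutation to from
    (λ i → undo {b} {inv} (Unit.isInverse u) (rsign h (inv * pos i)) (rsign h (b * pos (from i))) (from-≈ i) (to-≈ (from i)))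
    (λ i → undo {inv} {b} (Unit.isInverse u⁻¹) (rsign h (b * pos i)) (rsign h (inv * pos (to i))) (to-≈ i) (from-≈ (to i)))

jacobi-* : ∀ {a b} h → Unit a (+ od h) → Unit b (+ od h) → jacobi (a * b) h ≡ jacobi a h · jacobi b h
jacobi-* {a} {b} h ua ub = trans (∏-cong {h} term)
  (trans (∏-distrib (λ i → rsign h (a * pos (to i))) (λ i → rsign h (b * pos i)))
         (cong (_· jacobi b h) (sym (∏-permute (λ i → rsign h (a * pos i)) perm))))
  where
  open Multiplication h ub
  module A = Multiplication h ua
  lemma₁ : ∀ a b x → a * b * x ≡ a * (b * x)
  lemma₁ = ℤₚ.*-assoc
  lemma₂ : ∀ a s x → a * (s * x) ≡ s * (a * x)
  lemma₂ = solve-∀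
  term : ∀ i → rsign h (a * b * pos i) ≡ rsign h (a * pos (to i)) · rsign h (b * pos i)
  term i = proj₁ (residue-determined {h} (s · t) {suc (toℕ (A.to (to i)))} (s≤s z≤n) (Finₚ.toℕ<n (A.to (to i)))
    (≈-trans (≈-reflexive (lemma₁ a b (pos i))) (≈-trans (*-congˡ a (to-≈ i)) (≈-trans (≈-reflexive (lemma₂ a (σ t) (pos (to i))))
      (≈-trans (*-congˡ (σ t) (A.to-≈ (to i))) (≈-reflexive (trans (sym (ℤₚ.*-assoc (σ t) (σ s) _)) (cong (_* pos (A.to (to i))) (trans (sym (σ-* t s)) (cong σ (Signₚ.*-comm t s)))))))))))
    where
    s = rsign h (a * pos (to i))
    t = rsign h (b * pos i)

par : ℕ → Sign
par zero    = ⊕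
par (suc n) = ⊖ · par n

par-+ : ∀ m n → par (m ℕ.+ n) ≡ par m · par n
par-+ zero n = refl
par-+ (suc m) n = trans (cong (⊖ ·_) (par-+ m n)) (sym (Signₚ.*-assoc ⊖ (par m) (par n)))

par-od : ∀ h → par (od h) ≡ ⊖
par-od h = cong (⊖ ·_) (trans (par-+ h h) (Signₚ.s*s≡+ (par h)))

par-od* : ∀ h n → par (od h ℕ.* n) ≡ par n
par-od* h n = trans (par-+ n ((h ℕ.+ h) ℕ.* n)) (trans (cong (par n ·_) (trans (cong par (ℕₚ.*-distribʳ-+ n h h)) (trans (par-+ (h ℕ.* n) (h ℕ.* n)) (Signₚ.s*s≡+ (par (h ℕ.* n)))))) (Signₚ.*-identityʳ (par n)))

-- Passing from r to the difference of the odd number 2h + 1 and r changes the parity and the sign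
-- at the same time.
par-least : ∀ h r → r ℕ.< od h → par r ≡ par (leastAbs h r) · leastSign h r
par-least h r r<n with r ℕ.≤? h
... | yes _ = sym (Signₚ.*-identityʳ (par r))
... | no  _ = lemma (par (od h ℕ.∸ r)) (par r) (trans (sym (par-+ (od h ℕ.∸ r) r)) (trans (cong par (ℕₚ.m∸n+n≡m (ℕₚ.<⇒≤ r<n))) (par-od h)))
  where
  lemma : ∀ s t → s · t ≡ ⊖ → t ≡ s · ⊖
  lemma ⊕ ⊖ _ = refl
  lemma ⊖ ⊕ _ = refl

-- A factor -1 for each point that is counted, so that products of `below` are parities of numbers
-- of lattice points.
below : ℕ → ℕ → Sign
below x y with x ℕ.≤? y
... | yes _ = ⊖
... | no  _ = ⊕

below-cong : ∀ {x y x' y'} → (x ℕ.≤ y → x' ℕ.≤ y') → (x' ℕ.≤ y' → x ℕ.≤ y) → below x y ≡ below x' y'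
below-cong {x} {y} {x'} {y'} f g with x ℕ.≤? y | x' ℕ.≤? y'
... | yes _ | yes _ = refl
... | no  _ | no  _ = refl
... | yes p | no  q = ⊥-elim (q (f p))
... | no  p | yes q = ⊥-elim (p (g q))

below-flip : ∀ x y → x ≢ y → below x y · below y x ≡ ⊖
below-flip x y x≢y with x ℕ.≤? y | y ℕ.≤? x
... | yes p | yes q = ⊥-elim (x≢y (ℕₚ.≤-antisym p q))
... | yes _ | no  _ = refl
... | no  _ | yes _ = refl
... | no  p | no  q = ⊥-elim (p (ℕₚ.<⇒≤ (ℕₚ.≰⇒> q)))

∏-below : ∀ g f → f ℕ.≤ g → ∏ {g} (λ j → below (suc (toℕ j)) f) ≡ par f
∏-below zero zero _ = refl
∏-below (suc g) zero z≤n = ∏-below g zero z≤n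
∏-below (suc g) (suc f) (s≤s f≤g) = cong (⊖ ·_) (trans (∏-cong {g} λ j → below-cong ℕₚ.≤-pred s≤s) (∏-below g f f≤g))

∏-⊖ : ∀ g → ∏ {g} (λ _ → ⊖) ≡ par g
∏-⊖ zero = refl
∏-⊖ (suc g) = cong (⊖ ·_) (∏-⊖ g)

∏-par : ∀ h g → ∏ {h} (λ _ → par g) ≡ par (h ℕ.* g)
∏-par zero g = refl
∏-par (suc h) g = trans (cong (par g ·_) (∏-par h g)) (sym (par-+ g (h ℕ.* g)))

-- Eisenstein's form of Gauss's lemma: the sign counts the lattice points below the line through the origin of slope (2g+1)/(2h+1).
jacobi-lattice : ∀ g h → Unit (+ od g) (+ od h) →
  jacobi (+ od g) h ≡ ∏ {h} (λ i → ∏ {g} (λ j → below (suc (toℕ j) ℕ.* od h) (od g ℕ.* suc (toℕ i))))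
jacobi-lattice g h u = trans (sym (cancel (∏ {h} (λ i → par (suc (toℕ i)))) {∏ fl} {jacobi (+ od g) h} (trans
    (∏-cong {h} row)
    (trans (∏-distrib (λ i → fl i · rsign h (+ od g * pos i)) (λ i → par (suc (toℕ (to i)))))
    (cong₂ _·_ (∏-distrib fl (λ i → rsign h (+ od g * pos i))) (sym (∏-permute (λ i → par (suc (toℕ i))) perm)))))))
    (∏-cong {h} λ i → sym (col i))
  where
  open Multiplication h u
  x : Fin h → ℕ
  x i = od g ℕ.* suc (toℕ i)
  quo : Fin h → ℕ
  quo i = x i ℕ/./ od h
  fl : Fin h → Sign
  fl i = par (quo i)
  cancel : ∀ P {F J} → P ≡ F · J · P → F ≡ J
  cancel ⊕ {⊕} {⊕} _ = refl
  cancel ⊕ {⊖} {⊖} _ = refl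
  cancel ⊖ {⊕} {⊕} _ = refl
  cancel ⊖ {⊖} {⊖} _ = refl
  posx : ∀ i → + od g * pos i ≡ + x i
  posx i = sym (ℤₚ.pos-* (od g) (suc (toℕ i)))
  split : ∀ i → x i ≡ x i ℕ/.% od h ℕ.+ quo i ℕ.* od h
  split i = ℕ/.m≡m%n+[m/n]*n (x i) (od h)
  -- As `od g` and `od h` are odd, i has the parity of its multiple `x i`, hence of quotient plus
  -- remainder. In the product over i, the parities of the i cancel against those of the least
  -- absolute residues, which are the same numbers permuted.
  row : ∀ i → par (suc (toℕ i)) ≡ fl i · rsign h (+ od g * pos i) · par (suc (toℕ (to i)))
  row i = trans (sym (par-od* g (suc (toℕ i)))) (trans (cong par (split i)) (trans (par-+ (x i ℕ/.% od h) (quo i ℕ.* od h))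
    (trans (cong₂ _·_ (par-least h (x i ℕ/.% od h) (ℕ/.m%n<n (x i) (od h))) (trans (cong par (ℕₚ.*-comm (quo i) (od h))) (par-od* h (quo i))))
    (trans (cong (λ z → par (leastAbs h (z ℤ/.%ℕ od h)) · leastSign h (z ℤ/.%ℕ od h) · fl i) (sym (posx i)))
    (trans (cong (λ z → par z · rsign h (+ od g * pos i) · fl i) (to-rabs i)) (rot (par (suc (toℕ (to i)))) (rsign h (+ od g * pos i)) (fl i)))))))
    where
    rot : ∀ a b c → a · b · c ≡ c · b · a
    rot a b c = trans (Signₚ.*-comm (a · b) c) (trans (cong (c ·_) (Signₚ.*-comm a b)) (sym (Signₚ.*-assoc c b a)))
  quo≤g : ∀ i → quo i ℕ.≤ g
  quo≤g i = ℕₚ.≤-pred (ℕ/.m<n*o⇒m/o<n {x i} {suc g} {od h} (ℕₚ.<-≤-trans (s≤s (ℕₚ.*-monoʳ-≤ (od g) (Finₚ.toℕ<n i)))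
     (ℕₚ.≤-trans (ℕₚ.m≤m+n (suc (od g ℕ.* h)) (h ℕ.+ g)) (ℕₚ.≤-reflexive (lemma g h)))))
    where
    lemma : ∀ g h → 1 ℕ.+ (1 ℕ.+ (g ℕ.+ g)) ℕ.* h ℕ.+ (h ℕ.+ g) ≡ (1 ℕ.+ g) ℕ.* (1 ℕ.+ (h ℕ.+ h))
    lemma = ℕSolver.solve-∀
  col : ∀ i → ∏ {g} (λ j → below (suc (toℕ j) ℕ.* od h) (x i)) ≡ fl i
  col i = trans (∏-cong {g} λ j → below-cong
      (λ le → subst (ℕ._≤ quo i) (ℕ/.m*n/n≡m (suc (toℕ j)) (od h)) (ℕ/./-monoˡ-≤ (od h) le))
      (λ le → ℕₚ.≤-trans (ℕₚ.*-monoˡ-≤ (od h) le) (ℕ/.m/n*n≤m (x i) (od h))))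
    (∏-below g (quo i) (quo≤g i))

-- Each of the h times g lattice points in Eisenstein's rectangle lies on exactly one side of the
-- diagonal. None lies on it, because 2h + 1 is prime to 2g + 1 and divides no i with 1 ≤ i ≤ h.
jacobi-reciprocity : ∀ g h → Unit (+ od g) (+ od h) → jacobi (+ od g) h · jacobi (+ od h) g ≡ par (h ℕ.* g)
jacobi-reciprocity g h u = trans (cong₂ _·_ (jacobi-lattice g h u) (trans (jacobi-lattice h g (unit-sym u)) (∏-comm {g} {h} B)))
  (trans (sym (∏-distrib {h} (λ i → ∏ {g} (A i)) (λ i → ∏ {g} (λ j → B j i))))
  (trans (∏-cong {h} λ i → trans (sym (∏-distrib {g} (A i) (λ j → B j i))) (trans (∏-cong {g} (cell i)) (∏-⊖ g))) (∏-par h g)))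
  where
  A : Fin h → Fin g → Sign
  A i j = below (suc (toℕ j) ℕ.* od h) (od g ℕ.* suc (toℕ i))
  B : Fin g → Fin h → Sign
  B j i = below (suc (toℕ i) ℕ.* od g) (od h ℕ.* suc (toℕ j))
  cell : ∀ i j → A i j · B j i ≡ ⊖
  cell i j = trans (cong (A i j ·_) (cong₂ below (ℕₚ.*-comm (suc (toℕ i)) (od g)) (ℕₚ.*-comm (od h) (suc (toℕ j)))))
    (below-flip (suc (toℕ j) ℕ.* od h) (od g ℕ.* suc (toℕ i)) λ e →
      pos-∤ i (unit-∣-cancel u (divides (pos j) (trans (sym (ℤₚ.pos-* (od g) (suc (toℕ i)))) (trans (cong +_ (sym e)) (ℤₚ.pos-* (suc (toℕ j)) (od h)))))))

-- An equation, so that a proof transports statements between a modulus n and the half h by which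
-- `jacobi` is indexed.
Odd : ℕ → Set
Odd n = n ≡ od ⌊ n /2⌋

opaque
  J : ℤ → ℕ → Sign
  J a n = jacobi a ⌊ n /2⌋

half-od : ∀ h → ⌊ od h /2⌋ ≡ h
half-od zero = refl
half-od (suc h) = trans (cong ⌊_/2⌋ (cong (λ k → suc (suc k)) (ℕₚ.+-suc h h))) (cong suc (half-od h))

odd-od : ∀ {n} h → n ≡ od h → Odd n
odd-od h refl = cong od (sym (half-od h))

odd-* : ∀ {m n} → Odd m → Odd n → Odd (m ℕ.* n)
odd-* {m} {n} om on = odd-od (⌊ m /2⌋ ℕ.+ ⌊ n /2⌋ ℕ.+ 2 ℕ.* ⌊ m /2⌋ ℕ.* ⌊ n /2⌋) (trans (cong₂ ℕ._*_ om on) (lemma ⌊ m /2⌋ ⌊ n /2⌋))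
  where
  lemma : ∀ g h → (1 ℕ.+ (g ℕ.+ g)) ℕ.* (1 ℕ.+ (h ℕ.+ h)) ≡ 1 ℕ.+ (g ℕ.+ h ℕ.+ 2 ℕ.* g ℕ.* h ℕ.+ (g ℕ.+ h ℕ.+ 2 ℕ.* g ℕ.* h))
  lemma = ℕSolver.solve-∀

odd⇒unit-2 : ∀ {n} → Odd n → Unit (+ 2) (+ n)
odd⇒unit-2 {n} o = unit (+ suc ⌊ n /2⌋) (by 1ℤ (trans (cong +_ (trans (lemma ⌊ n /2⌋) (cong suc (sym o)))) (cong (_+_ 1ℤ) (sym (ℤₚ.*-identityˡ (+ n))))))
  where
  lemma : ∀ h → 2 ℕ.* (1 ℕ.+ h) ≡ 1 ℕ.+ (1 ℕ.+ (h ℕ.+ h))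
  lemma = ℕSolver.solve-∀

opaque
  unfolding J

  J-≈ : ∀ {a b n} → Odd n → a ≈ b [ + n ] → J a n ≡ J b n
  J-≈ {n = n} o e = jacobi-≈ ⌊ n /2⌋ (subst (λ k → _ ≈ _ [ + k ]) o e)

  J-* : ∀ {a b n} → Odd n → Unit a (+ n) → Unit b (+ n) → J (a * b) n ≡ J a n · J b n
  J-* {n = n} o ua ub = jacobi-* ⌊ n /2⌋ (subst (λ k → Unit _ (+ k)) o ua) (subst (λ k → Unit _ (+ k)) o ub)

J-square : ∀ {a b n} → Odd n → Unit b (+ n) → a ≈ b * b [ + n ] → J a n ≡ ⊕
J-square {b = b} {n} o u e = trans (J-≈ o e) (trans (J-* o u u) (Signₚ.s*s≡+ (J b n)))

opaque
  unfolding J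

  J-reciprocity : ∀ {m n} → Odd m → Odd n → Unit (+ m) (+ n) → J (+ m) n · J (+ n) m ≡ par (⌊ n /2⌋ ℕ.* ⌊ m /2⌋)
  J-reciprocity {m} {n} om on u = trans
    (cong₂ _·_ (cong (λ k → jacobi (+ k) ⌊ n /2⌋) om) (cong (λ k → jacobi (+ k) ⌊ m /2⌋) on))
    (jacobi-reciprocity ⌊ m /2⌋ ⌊ n /2⌋ (subst₂ (λ a b → Unit (+ a) (+ b)) om on u))

par-*-⊕ : ∀ m n → par m ≡ ⊕ → par (n ℕ.* m) ≡ ⊕
par-*-⊕ m zero e = refl
par-*-⊕ m (suc n) e = trans (par-+ m (n ℕ.* m)) (cong₂ _·_ e (par-*-⊕ m n e))

par-*-⊖ : ∀ m n → par m ≡ ⊖ → par (n ℕ.* m) ≡ par n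
par-*-⊖ m zero e = refl
par-*-⊖ m (suc n) e = trans (par-+ m (n ℕ.* m)) (cong₂ _·_ e (par-*-⊖ m n e))

·-≡ : ∀ {s t} → s · t ≡ ⊕ → s ≡ t
·-≡ {⊕} {⊕} _ = refl
·-≡ {⊖} {⊖} _ = refl

-- The condition on `par` says that m ≡ 1 modulo 4, which makes the exponent in the reciprocity law
-- even.
J-reciprocity-⊕ : ∀ {m n} → Odd m → Odd n → Unit (+ m) (+ n) → par ⌊ m /2⌋ ≡ ⊕ → J (+ m) n ≡ J (+ n) m
J-reciprocity-⊕ {m} {n} om on u e = ·-≡ (trans (J-reciprocity om on u) (par-*-⊕ ⌊ m /2⌋ ⌊ n /2⌋ e))

opaque
  unfolding J

  J-minus-one : ∀ n → J -1ℤ n ≡ par ⌊ n /2⌋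
  J-minus-one n = trans (∏-cong {⌊ n /2⌋} λ i → proj₁ (residue-determined {⌊ n /2⌋} ⊖ {suc (toℕ i)} (s≤s z≤n) (Finₚ.toℕ<n i) ≈-refl)) (∏-⊖ ⌊ n /2⌋)

-- Replacing a by a residue r ≡ 1 (mod 4) of its class modulo mn, reciprocity turns the claim into multiplicativity of J (+ m) r in m.
J-lower-* : ∀ {a m n} → Odd m → Odd n → Unit a (+ m) → Unit a (+ n) → J a (m ℕ.* n) ≡ J a m · J a n
J-lower-* {a} {m@(suc _)} {n@(suc _)} om on um un =
  trans (J-≈ (odd-* om on) (≈-sym r≈a)) (trans (J-reciprocity-⊕ or (odd-* om on) ur par-r) (trans (cong (λ z → J z r) (ℤₚ.pos-* m n))
   (trans (J-* or umr unr) (sym (cong₂ _·_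
     (trans (J-≈ om (≈-sym r≈am)) (J-reciprocity-⊕ or om (unit-sym umr) par-r))
     (trans (J-≈ on (≈-sym r≈an)) (J-reciprocity-⊕ or on (unit-sym unr) par-r)))))))
  where
  u4 : Unit (+ 4) (+ (m ℕ.* n))
  u4 = unit-* {+ 2} {+ 2} (odd⇒unit-2 (odd-* om on)) (odd⇒unit-2 (odd-* om on))
  x = proj₁ (crt u4 1ℤ a)
  r = x ℤ/.%ℕ (4 ℕ.* (m ℕ.* n))
  r≈x : + r ≈ x [ + (4 ℕ.* (m ℕ.* n)) ]
  r≈x = ≈-sym (rem-≈ x (4 ℕ.* (m ℕ.* n)))
  r≈1 : + r ≈ 1ℤ [ + 4 ]
  r≈1 = ≈-trans (≈-weaken (ℤ∣.∣ᵤ⇒∣ (ℕ∣.m∣m*n (m ℕ.* n))) r≈x) (proj₁ (proj₂ (crt u4 1ℤ a)))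
  r≈a : + r ≈ a [ + (m ℕ.* n) ]
  r≈a = ≈-trans (≈-weaken (ℤ∣.∣ᵤ⇒∣ (ℕ∣.n∣m*n 4)) r≈x) (proj₂ (proj₂ (crt u4 1ℤ a)))
  r≈am : + r ≈ a [ + m ]
  r≈am = ≈-weaken (ℤ∣.∣ᵤ⇒∣ (ℕ∣.m∣m*n n)) r≈a
  r≈an : + r ≈ a [ + n ]
  r≈an = ≈-weaken (ℤ∣.∣ᵤ⇒∣ (ℕ∣.n∣m*n m)) r≈a
  r-od : r ≡ od (r ℕ/./ 4 ℕ.+ r ℕ/./ 4)
  r-od = trans (ℕ/.m≡m%n+[m/n]*n r 4) (trans (cong (ℕ._+ r ℕ/./ 4 ℕ.* 4) (rem-cong {+ r} {1ℤ} 4 r≈1)) (lemma (r ℕ/./ 4)))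
    where
    lemma : ∀ q → 1 ℕ.+ q ℕ.* 4 ≡ 1 ℕ.+ (q ℕ.+ q ℕ.+ (q ℕ.+ q))
    lemma = ℕSolver.solve-∀
  or : Odd r
  or = odd-od (r ℕ/./ 4 ℕ.+ r ℕ/./ 4) r-od
  par-r : par ⌊ r /2⌋ ≡ ⊕
  par-r = trans (cong (λ z → par ⌊ z /2⌋) r-od) (trans (cong par (half-od (r ℕ/./ 4 ℕ.+ r ℕ/./ 4))) (trans (par-+ (r ℕ/./ 4) (r ℕ/./ 4)) (Signₚ.s*s≡+ (par (r ℕ/./ 4)))))
  umr : Unit (+ m) (+ r)
  umr = unit-sym (unit-≈ (≈-sym r≈am) um)
  unr : Unit (+ n) (+ r)
  unr = unit-sym (unit-≈ (≈-sym r≈an) un)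
  ur : Unit (+ r) (+ (m ℕ.* n))
  ur = unit-sym (subst (λ z → Unit z (+ r)) (sym (ℤₚ.pos-* m n)) (unit-* umr unr))

-- Reciprocity between d and d′ = d + 4N, as 4N ≡ d′ (mod d) and 4N ≡ - d (mod d′).
J-period : ∀ {N d} → Odd d → Unit (+ N) (+ d) → J (+ N) (d ℕ.+ 4 ℕ.* N) ≡ J (+ N) d
J-period {N} {d} o u = ·-≡ (trans (cong₂ _·_ Jd' Jd) (trans (Signₚ.*-assoc (J -1ℤ d') (J (+ d) d') (J (+ d') d))
    (trans (cong₂ _·_ (J-minus-one d') (J-reciprocity o o' udd'))  (finish (par h') refl))))
  where
  h = ⌊ d /2⌋
  d' = d ℕ.+ 4 ℕ.* N
  h' = ⌊ d' /2⌋
  d'-od : d' ≡ od (h ℕ.+ 2 ℕ.* N)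
  d'-od = trans (cong (ℕ._+ 4 ℕ.* N) o) (lemma h N)
    where
    lemma : ∀ h N → 1 ℕ.+ (h ℕ.+ h) ℕ.+ 4 ℕ.* N ≡ 1 ℕ.+ (h ℕ.+ 2 ℕ.* N ℕ.+ (h ℕ.+ 2 ℕ.* N))
    lemma = ℕSolver.solve-∀
  o' : Odd d'
  o' = odd-od (h ℕ.+ 2 ℕ.* N) d'-od
  par-h' : par h' ≡ par h
  par-h' = trans (cong (λ z → par ⌊ z /2⌋) d'-od) (trans (cong par (half-od (h ℕ.+ 2 ℕ.* N))) (trans (par-+ h (2 ℕ.* N))
    (trans (cong (par h ·_) (trans (cong par (cong (N ℕ.+_) (ℕₚ.+-identityʳ N))) (trans (par-+ N N) (Signₚ.s*s≡+ (par N))))) (Signₚ.*-identityʳ (par h)))))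
  d'≡ : + d' ≡ + d + + 4 * + N
  d'≡ = cong (_+_ (+ d)) (ℤₚ.pos-* 4 N)
  4N≈d' : + 4 * + N ≈ + d' [ + d ]
  4N≈d' = ≈-sym (by 1ℤ (trans d'≡ (lemma (+ d) (+ N))))
    where
    lemma : ∀ d N → d + + 4 * N ≡ + 4 * N + 1ℤ * d
    lemma = solve-∀
  4N≈-d : + 4 * + N ≈ - + d [ + d' ]
  4N≈-d = by 1ℤ (trans (lemma (+ d) (+ N)) (cong (λ z → - + d + 1ℤ * z) (sym d'≡)))
    where
    lemma : ∀ d N → + 4 * N ≡ - d + 1ℤ * (d + + 4 * N)
    lemma = solve-∀
  u4 : ∀ {n} → Odd n → Unit (+ 4) (+ n)
  u4 o = unit-* {+ 2} {+ 2} (odd⇒unit-2 o) (odd⇒unit-2 o)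
  u4N : Unit (+ 4 * + N) (+ d)
  u4N = unit-* (u4 o) u
  udd' : Unit (+ d) (+ d')
  udd' = unit-sym (unit-≈ 4N≈d' u4N)
  u' : Unit (+ N) (+ d')
  u' = unit-*ʳ {+ 4} (unit-≈ (≈-sym 4N≈-d) (unit-neg udd'))
  J4 : ∀ {n} → Odd n → Unit (+ N) (+ n) → J (+ N) n ≡ J (+ 4 * + N) n
  J4 {n} o u = sym (trans (J-* o (u4 o) u) (cong (_· J (+ N) n) (J-square o (odd⇒unit-2 o) (≈-refl {+ 4}))))
  Jd : J (+ N) d ≡ J (+ d') d
  Jd = trans (J4 o u) (J-≈ o 4N≈d')
  Jd' : J (+ N) d' ≡ J -1ℤ d' · J (+ d) d'
  Jd' = trans (J4 o' u') (trans (J-≈ o' (≈-trans 4N≈-d (≈-reflexive (sym (ℤₚ.-1*i≡-i (+ d)))))) (J-* o' (unit-neg unit-1) udd'))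
  -- `d` and `d'` agree modulo 4. If they are 1 there, both factors are trivial; if they are 3, both
  -- factors are -1.
  finish : ∀ s → par h' ≡ s → par h' · par (h' ℕ.* h) ≡ ⊕
  finish ⊕ e = cong₂ _·_ e (par-*-⊕ h h' (trans (sym par-h') e))
  finish ⊖ e = cong₂ _·_ e (trans (par-*-⊖ h h' (trans (sym par-h') e)) e)

-- Euler's criterion, Lagrange's bound on roots, residues and nonresidues modulo a prime

product-≈ : ∀ {n m} {f g : Fin n → ℤ} → (∀ i → f i ≈ g i [ m ]) → Product.sum {n} f ≈ Product.sum {n} g [ m ]
product-≈ {zero} e = ≈-refl
product-≈ {suc n} e = *-cong (e Fin.zero) (product-≈ {n} (e ∘ Fin.suc))

product-unit : ∀ {n m} {f : Fin n → ℤ} → (∀ i → Unit (f i) m) → Unit (Product.sum {n} f) m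
product-unit {zero} u = unit-1
product-unit {suc n} u = unit-* (u Fin.zero) (product-unit {n} (u ∘ Fin.suc))

product-scale : ∀ n a (f : Fin n → ℤ) → Product.sum {n} (λ i → a * f i) ≡ (a ℤ.^ n) * Product.sum {n} f
product-scale zero a f = refl
product-scale (suc n) a f = trans (cong (a * f Fin.zero *_) (product-scale n a (f ∘ Fin.suc))) (lemma a (f Fin.zero) (a ℤ.^ n) (Product.sum {n} (f ∘ Fin.suc)))
  where
  lemma : ∀ a x p q → a * x * (p * q) ≡ a * p * (x * q)
  lemma = solve-∀

product-σ : ∀ n (f : Fin n → Sign) → Product.sum {n} (σ ∘ f) ≡ σ (∏ {n} f)
product-σ zero f = refl
product-σ (suc n) f = trans (cong (σ (f Fin.zero) *_) (product-σ n (f ∘ Fin.suc))) (sym (σ-* (f Fin.zero) (∏ {n} (f ∘ Fin.suc))))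

-- The product of the a i for 1 ≤ i ≤ h is a^h times h!, and also the product of the signs times h!,
-- as the residues are permuted. Primality makes h! a unit.
euler-criterion : ∀ {h a} → Prime (od h) → Unit a (+ od h) → a ℤ.^ h ≈ σ (jacobi a h) [ + od h ]
euler-criterion {h} {a} pp u = unit-cancel {Product.sum {h} pos} (product-unit {h} λ i → prime⇒unit pp (pos-∤ i))
  (≈-trans (≈-reflexive (trans (ℤₚ.*-comm (Product.sum {h} pos) (a ℤ.^ h)) (sym (product-scale h a pos))))
  (≈-trans (product-≈ {h} to-≈) (≈-reflexive (trans (Product.∑-distrib-+ {h} (λ i → σ (rsign h (a * pos i))) (λ i → pos (to i)))
    (trans (cong₂ _*_ (product-σ h (λ i → rsign h (a * pos i))) (sym (Product.sum-permute pos perm))) (ℤₚ.*-comm (σ (jacobi a h)) (Product.sum {h} pos)))))))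
  where open Multiplication h u

-- The vector lists the lower coefficients of a monic polynomial, constant term first.
evalMonic : ∀ {n} → Vec ℤ n → ℤ → ℤ
evalMonic [] x = 1ℤ
evalMonic (c ∷ cs) x = c + x * evalMonic cs x

divMonic : ∀ {n} → Vec ℤ (suc n) → ℤ → Vec ℤ n
divMonic (c ∷ []) r = []
divMonic (c ∷ cs@(_ ∷ _)) r = evalMonic cs r ∷ divMonic cs r

divMonic-correct : ∀ {n} (cs : Vec ℤ (suc n)) r x → evalMonic cs x ≡ (x - r) * evalMonic (divMonic cs r) x + evalMonic cs r
divMonic-correct (c ∷ []) r x = lemma c r x
  where
  lemma : ∀ c r x → c + x * 1ℤ ≡ (x - r) * 1ℤ + (c + r * 1ℤ)
  lemma = solve-∀
divMonic-correct (c ∷ cs@(_ ∷ _)) r x = trans (cong (λ z → c + x * z) (divMonic-correct cs r x)) (lemma c r x (evalMonic (divMonic cs r) x) (evalMonic cs r))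
  where
  lemma : ∀ c r x q p → c + x * ((x - r) * q + p) ≡ (x - r) * (p + x * q) + (c + r * p)
  lemma = solve-∀

-- Divide by x - r₀ and induct: the remaining roots are roots of the quotient because their
-- differences from r₀ can be cancelled. In degree 0 the polynomial is 1, which does not vanish
-- modulo p > 1.
lagrange : ∀ {n p} → 1 ℕ.< p → (cs : Vec ℤ n) (root : Fin (suc n) → ℤ) → (∀ i → evalMonic cs (root i) ≈ 0ℤ [ + p ]) →
           (∀ i j → i ≢ j → Unit (root i - root j) (+ p)) → ⊥
lagrange {p = p} 1<p [] root r _ with small-∣⇒0 {p} (≈0⇒∣ (r Fin.zero)) 1<p
... | ()
lagrange {p = p} 1<p cs@(_ ∷ _) root r distinct = lagrange 1<p (divMonic cs r₀) (root ∘ Fin.suc)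
  (λ i → unit-cancel (distinct (Fin.suc i) Fin.zero λ ()) (≈-trans (quotient-root (root (Fin.suc i)) (r (Fin.suc i))) (≈-reflexive (sym (ℤₚ.*-zeroʳ (root (Fin.suc i) - r₀))))))
  (λ i j i≢j → distinct (Fin.suc i) (Fin.suc j) (i≢j ∘ Finₚ.suc-injective))
  where
  r₀ = root Fin.zero
  lemma : ∀ a b → a ≡ a + b - b
  lemma = solve-∀
  quotient-root : ∀ x → evalMonic cs x ≈ 0ℤ [ + p ] → (x - r₀) * evalMonic (divMonic cs r₀) x ≈ 0ℤ [ + p ]
  quotient-root x e = ≈-trans (≈-reflexive (trans (lemma _ (evalMonic cs r₀)) (cong (_- evalMonic cs r₀) (sym (divMonic-correct cs r₀ x)))))
    (+-cong e (neg-cong (r Fin.zero)))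

x^n-1 : ∀ n → Vec ℤ (suc n)
x^n-1 n = -1ℤ ∷ Vec.replicate n 0ℤ

evalMonic-replicate : ∀ n x → evalMonic (Vec.replicate n 0ℤ) x ≡ x ℤ.^ n
evalMonic-replicate zero x = refl
evalMonic-replicate (suc n) x = trans (ℤₚ.+-identityˡ _) (cong (x *_) (evalMonic-replicate n x))

^-root : ∀ {n x m} → x ℤ.^ suc n ≈ 1ℤ [ m ] → evalMonic (x^n-1 n) x ≈ 0ℤ [ m ]
^-root {n} {x} e = ≈-trans (≈-reflexive (cong (λ z → -1ℤ + x * z) (evalMonic-replicate n x))) (+-cong (≈-refl { -1ℤ}) e)

small-unit : ∀ {p x} → Prime p → x ≢ 0ℤ → ∣ x ∣ ℕ.< p → Unit x (+ p)
small-unit pp x≢0 lt = prime⇒unit pp (λ d → x≢0 (small-∣⇒0 d lt))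

private
  pos-injective : ∀ {h} {i j : Fin h} → pos i ≡ pos j → i ≡ j
  pos-injective e = Finₚ.toℕ-injective (ℕₚ.suc-injective (ℤₚ.+-injective e))

-- Otherwise a together with the squares of 1, ..., h would be h + 1 distinct roots of x^h - 1, by
-- Euler's criterion.
jacobi-⊕⇒square : ∀ {h a} → Prime (od h) → Unit a (+ od h) → jacobi a h ≡ ⊕ → Σ[ x ∈ ℤ ] a ≈ x * x [ + od h ]
jacobi-⊕⇒square {h} {a} pp u J≡⊕ with h | Finₚ.any? (λ i → od h ℕ∣.∣? ∣ a - pos {h} i * pos i ∣)
... | _ | yes (i , d) = pos i , ∣⇒≈ (ℤ∣.∣ᵤ⇒∣ d)
... | zero | no _ = ⊥-elim (Primality.¬prime[1] pp)
... | h@(suc k) | no none = ⊥-elim (lagrange (prime>1 pp) (x^n-1 k) root (λ i → ^-root {k} {root i} (isRoot i)) distinct)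
  where
  root : Fin (suc h) → ℤ
  root Fin.zero = a
  root (Fin.suc i) = pos i * pos i
  posUnit : ∀ i → Unit (pos {h} i) (+ od h)
  posUnit i = prime⇒unit pp (pos-∤ i)
  isRoot : ∀ i → root i ℤ.^ h ≈ 1ℤ [ + od h ]
  isRoot Fin.zero = ≈-trans (euler-criterion {h} pp u) (≈-reflexive (cong σ J≡⊕))
  isRoot (Fin.suc i) = ≈-trans (euler-criterion {h} pp (unit-* (posUnit i) (posUnit i)))
    (≈-reflexive (cong σ (trans (jacobi-* h (posUnit i) (posUnit i)) (Signₚ.s*s≡+ (jacobi (pos i) h)))))
  factor : ∀ x y → x * x - y * y ≡ (x - y) * (x + y)
  factor = solve-∀
  flip : ∀ x y → x - y ≡ - (y - x)
  flip = solve-∀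
  distinct : ∀ i j → i ≢ j → Unit (root i - root j) (+ od h)
  distinct Fin.zero Fin.zero i≢j = ⊥-elim (i≢j refl)
  distinct Fin.zero (Fin.suc j) _ = prime⇒unit pp (λ d → none (j , ℤ∣.∣⇒∣ᵤ d))
  distinct (Fin.suc i) Fin.zero _ = subst (λ z → Unit z (+ od h)) (sym (flip (pos i * pos i) a)) (unit-neg (distinct Fin.zero (Fin.suc i) λ ()))
  distinct (Fin.suc i) (Fin.suc j) i≢j = subst (λ z → Unit z (+ od h)) (sym (factor (pos i) (pos j)))
    (unit-* (small-unit pp (λ e → i≢j (cong Fin.suc (pos-injective (ℤₚ.i-j≡0⇒i≡j (pos i) (pos j) e))))
               (s≤s (ℕₚ.≤-trans (ℤₚ.∣i-j∣≤∣i∣+∣j∣ (pos i) (pos j)) (ℕₚ.+-mono-≤ (Finₚ.toℕ<n i) (Finₚ.toℕ<n j)))))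
            (small-unit pp (λ ()) (s≤s (ℕₚ.+-mono-≤ (Finₚ.toℕ<n i) (Finₚ.toℕ<n j)))))

-- If all of 1, ..., h + 1 had sign +1, they would be too many roots of x^h - 1.
jacobi-nonresidue : ∀ {h} → Prime (od h) → Σ[ a ∈ ℤ ] Unit a (+ od h) × jacobi a h ≡ ⊖
jacobi-nonresidue {zero} pp = ⊥-elim (Primality.¬prime[1] pp)
jacobi-nonresidue {h@(suc k)} pp with Finₚ.any? (λ i → jacobi (pos {suc h} i) h Signₚ.≟ ⊖)
... | yes (i , e) = pos i , u , e
  where
  u : Unit (pos {suc h} i) (+ od h)
  u = small-unit pp (λ ()) (ℕₚ.≤-<-trans (Finₚ.toℕ<n i) (s≤s (s≤s (ℕₚ.m≤n+m (suc k) k))))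
... | no none = ⊥-elim (lagrange (prime>1 pp) (x^n-1 k) pos (λ i → ^-root {k} {pos i} (≈-trans (euler-criterion {h} pp (u i)) (≈-reflexive (cong σ (plus _ (λ e → none (i , e))))))) distinct)
  where
  plus : ∀ s → s ≢ ⊖ → s ≡ ⊕
  plus ⊕ _ = refl
  plus ⊖ e = ⊥-elim (e refl)
  u : ∀ i → Unit (pos {suc h} i) (+ od h)
  u i = small-unit pp (λ ()) (ℕₚ.≤-<-trans (Finₚ.toℕ<n i) (s≤s (s≤s (ℕₚ.m≤n+m (suc k) k))))
  distinct : ∀ i j → i ≢ j → Unit (pos {suc h} i - pos j) (+ od h)
  distinct i j i≢j = small-unit pp (λ e → i≢j (pos-injective (ℤₚ.i-j≡0⇒i≡j (pos i) (pos j) e)))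
    (ℕₚ.≤-<-trans (ℕₚ.≤-reflexive (cong ∣_∣ (ℤₚ.m-n≡m⊖n (suc (toℕ i)) (suc (toℕ j)))))
      (ℕₚ.≤-<-trans (ℤₚ.∣m⊝n∣≤m⊔n (suc (toℕ i)) (suc (toℕ j))) (ℕₚ.≤-<-trans (ℕₚ.⊔-lub (Finₚ.toℕ<n i) (Finₚ.toℕ<n j)) (s≤s (s≤s (ℕₚ.m≤n+m (suc k) k))))))

opaque
  unfolding J

  J-⊕⇒square : ∀ {p a} → Prime p → Odd p → Unit a (+ p) → J a p ≡ ⊕ → Σ[ x ∈ ℤ ] a ≈ x * x [ + p ]
  J-⊕⇒square {p} {a} pp o u e = subst (λ q → Σ[ x ∈ ℤ ] a ≈ x * x [ + q ]) (sym o)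
    (jacobi-⊕⇒square {⌊ p /2⌋} (subst Prime o pp) (subst (λ q → Unit a (+ q)) o u) e)

  J-nonresidue : ∀ {p} → Prime p → Odd p → Σ[ a ∈ ℤ ] Unit a (+ p) × J a p ≡ ⊖
  J-nonresidue {p} pp o with jacobi-nonresidue {⌊ p /2⌋} (subst Prime o pp)
  ... | a , u , e = a , subst (λ q → Unit a (+ q)) (sym o) u , e

-- Finite sums and the hyperbola method

S : ℕ → (ℕ → ℤ) → ℤ
S zero f = 0ℤ
S (suc n) f = S n f + f n

ι : ∀ {A : Set} → Dec A → ℤ
ι (yes _) = 1ℤ
ι (no _)  = 0ℤ

ι-true : ∀ {A : Set} (d : Dec A) → A → ι d ≡ 1ℤ
ι-true (yes _) _ = refl
ι-true (no ¬a) a = ⊥-elim (¬a a)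

ι-false : ∀ {A : Set} (d : Dec A) → ¬ A → ι d ≡ 0ℤ
ι-false (yes a) ¬a = ⊥-elim (¬a a)
ι-false (no _) _ = refl

ι-cong : ∀ {A B : Set} (d : Dec A) (e : Dec B) → (A → B) → (B → A) → ι d ≡ ι e
ι-cong d (yes b) f g = ι-true d (g b)
ι-cong d (no ¬b) f g = ι-false d (¬b ∘ f)

S-cong : ∀ n {f g : ℕ → ℤ} → (∀ i → i ℕ.< n → f i ≡ g i) → S n f ≡ S n g
S-cong zero e = refl
S-cong (suc n) e = cong₂ _+_ (S-cong n λ i i<n → e i (ℕₚ.m<n⇒m<1+n i<n)) (e n ℕₚ.≤-refl)

S-≗ : ∀ n {f g : ℕ → ℤ} → (∀ i → f i ≡ g i) → S n f ≡ S n g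
S-≗ n e = S-cong n λ i _ → e i

S-zero : ∀ n {f : ℕ → ℤ} → (∀ i → i ℕ.< n → f i ≡ 0ℤ) → S n f ≡ 0ℤ
S-zero zero e = refl
S-zero (suc n) e = cong₂ _+_ (S-zero n λ i i<n → e i (ℕₚ.m<n⇒m<1+n i<n)) (e n ℕₚ.≤-refl)

S-distrib-+ : ∀ n (f g : ℕ → ℤ) → S n (λ i → f i + g i) ≡ S n f + S n g
S-distrib-+ zero f g = refl
S-distrib-+ (suc n) f g = trans (cong (_+ (f n + g n)) (S-distrib-+ n f g)) (lemma (S n f) (S n g) (f n) (g n))
  where
  lemma : ∀ a b c d → a + b + (c + d) ≡ a + c + (b + d)
  lemma = solve-∀

S-*ˡ : ∀ n c (f : ℕ → ℤ) → S n (λ i → c * f i) ≡ c * S n f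
S-*ˡ zero c f = sym (ℤₚ.*-zeroʳ c)
S-*ˡ (suc n) c f = trans (cong (_+ c * f n) (S-*ˡ n c f)) (sym (ℤₚ.*-distribˡ-+ c (S n f) (f n)))

S-comm : ∀ m n (f : ℕ → ℕ → ℤ) → S m (λ i → S n (f i)) ≡ S n (λ j → S m (λ i → f i j))
S-comm zero n f = sym (S-zero n λ _ _ → refl)
S-comm (suc m) n f = trans (cong (_+ S n (f m)) (S-comm m n f)) (sym (S-distrib-+ n (λ j → S m (λ i → f i j)) (f m)))

S-split : ∀ m n (f : ℕ → ℤ) → S (m ℕ.+ n) f ≡ S m f + S n (λ i → f (m ℕ.+ i))
S-split m zero f = trans (cong (λ k → S k f) (ℕₚ.+-identityʳ m)) (sym (ℤₚ.+-identityʳ (S m f)))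
S-split m (suc n) f = trans (cong (λ k → S k f) (ℕₚ.+-suc m n)) (trans (cong (_+ f (m ℕ.+ n)) (S-split m n f)) (ℤₚ.+-assoc (S m f) (S n (λ i → f (m ℕ.+ i))) (f (m ℕ.+ n))))

S-extend : ∀ {m n} (f : ℕ → ℤ) → m ℕ.≤ n → (∀ i → m ℕ.≤ i → f i ≡ 0ℤ) → S n f ≡ S m f
S-extend {m} {n} f m≤n z = trans (cong (λ k → S k f) (sym (ℕₚ.m+[n∸m]≡n m≤n))) (trans (S-split m (n ℕ.∸ m) f)
  (trans (cong (_+_ (S m f)) (S-zero (n ℕ.∸ m) λ i _ → z (m ℕ.+ i) (ℕₚ.m≤m+n m i))) (ℤₚ.+-identityʳ (S m f))))

S-point : ∀ {n c} (f : ℕ → ℤ) → c ℕ.< n → (∀ i → i ≢ c → f i ≡ 0ℤ) → S n f ≡ f c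
S-point {suc n} {c} f c<n z with c ℕ.≟ n
... | yes refl = trans (cong (_+ f n) (S-zero n λ i i<n → z i (ℕₚ.<⇒≢ i<n))) (ℤₚ.+-identityˡ (f n))
... | no c≢n = trans (cong₂ _+_ (S-point f (ℕₚ.≤∧≢⇒< (ℕₚ.≤-pred c<n) c≢n) z) (z n (c≢n ∘ sym))) (ℤₚ.+-identityʳ (f c))

S-bound : ∀ n B (f : ℕ → ℤ) → (∀ i → ∣ f i ∣ ℕ.≤ B) → ∣ S n f ∣ ℕ.≤ n ℕ.* B
S-bound zero B f b = z≤n
S-bound (suc n) B f b = ℕₚ.≤-trans (ℤₚ.∣i+j∣≤∣i∣+∣j∣ (S n f) (f n)) (ℕₚ.≤-trans (ℕₚ.+-mono-≤ (S-bound n B f b) (b n)) (ℕₚ.≤-reflexive (ℕₚ.+-comm (n ℕ.* B) B)))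

S-nonneg : ∀ n {f : ℕ → ℤ} → (∀ i → 0ℤ ℤ.≤ f i) → 0ℤ ℤ.≤ S n f
S-nonneg zero z = ℤₚ.≤-refl
S-nonneg (suc n) z = ℤₚ.+-mono-≤ (S-nonneg n z) (z n)

S-mono : ∀ {m n} {f : ℕ → ℤ} → (∀ i → 0ℤ ℤ.≤ f i) → m ℕ.≤ n → S m f ℤ.≤ S n f
S-mono {m} {n} {f} z m≤n = subst (λ k → S m f ℤ.≤ S k f) (ℕₚ.m+[n∸m]≡n m≤n) (subst₂ ℤ._≤_ (ℤₚ.+-identityʳ (S m f)) (sym (S-split m (n ℕ.∸ m) f))
  (ℤₚ.+-monoʳ-≤ (S m f) (S-nonneg (n ℕ.∸ m) λ i → z (m ℕ.+ i))))

S-nonzero : ∀ n (f : ℕ → ℤ) → S n f ≢ 0ℤ → Σ[ i ∈ ℕ ] f i ≢ 0ℤ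
S-nonzero zero f ne = ⊥-elim (ne refl)
S-nonzero (suc n) f ne with f n ℤ.≟ 0ℤ
... | no fn≢0 = n , fn≢0
... | yes fn≡0 = S-nonzero n f λ e → ne (cong₂ _+_ e fn≡0)

-- The substitution a = d e. The range of e is a fixed `m` cut off by an indicator, so that the sums
-- over d and e can later be exchanged.
S-multiples : ∀ {d n m} (f : ℕ → ℤ) → 0 ℕ.< d → n ℕ.≤ m → S n (λ a → ι (d ℕ∣.∣? a) * f a) ≡ S m (λ e → ι (d ℕ.* e ℕ.<? n) * f (d ℕ.* e))
S-multiples {d} {zero} {m} f 0<d n≤m = sym (S-zero m λ e _ → cong (_* f (d ℕ.* e)) (ι-false (d ℕ.* e ℕ.<? 0) λ ()))
S-multiples {d} {suc n} {m} f 0<d n≤m = trans (cong₂ _+_ (S-multiples {d} {n} {m} f 0<d (ℕₚ.<⇒≤ n≤m)) last)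
  (trans (sym (S-distrib-+ m (λ e → ι (d ℕ.* e ℕ.<? n) * f (d ℕ.* e)) (λ e → ι (d ℕ.* e ℕ.≟ n) * f (d ℕ.* e))))
    (S-≗ m λ e → trans (sym (ℤₚ.*-distribʳ-+ (f (d ℕ.* e)) (ι (d ℕ.* e ℕ.<? n)) (ι (d ℕ.* e ℕ.≟ n)))) (cong (_* f (d ℕ.* e)) (step (d ℕ.* e)))))
  where
  step : ∀ x → ι (x ℕ.<? n) + ι (x ℕ.≟ n) ≡ ι (x ℕ.<? suc n)
  step x with x ℕ.≟ n
  ... | yes refl = trans (cong (_+ 1ℤ) (ι-false (x ℕ.<? x) (ℕₚ.<-irrefl refl))) (sym (ι-true (x ℕ.<? suc x) ℕₚ.≤-refl))
  ... | no x≢n = trans (ℤₚ.+-identityʳ _) (ι-cong (x ℕ.<? n) (x ℕ.<? suc n) ℕₚ.m<n⇒m<1+n (λ x<1+n → ℕₚ.≤∧≢⇒< (ℕₚ.≤-pred x<1+n) x≢n))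
  last : ι (d ℕ∣.∣? n) * f n ≡ S m (λ e → ι (d ℕ.* e ℕ.≟ n) * f (d ℕ.* e))
  last with d ℕ∣.∣? n
  ... | no d∤n = sym (S-zero m λ e _ → cong (_* f (d ℕ.* e)) (ι-false (d ℕ.* e ℕ.≟ n) λ eq → d∤n (ℕ∣.divides e (trans (sym eq) (ℕₚ.*-comm d e)))))
  ... | yes (ℕ∣.divides c eq) = sym (trans (S-point {m} {c} _ c<m λ i i≢c → cong (_* f (d ℕ.* i)) (ι-false (d ℕ.* i ℕ.≟ n) λ eq' →
            i≢c (ℕₚ.*-cancelˡ-≡ i c d {{ℕ.>-nonZero 0<d}} (trans eq' (trans eq (ℕₚ.*-comm c d))))))
      (cong₂ _*_ (ι-true (d ℕ.* c ℕ.≟ n) (trans (ℕₚ.*-comm d c) (sym eq))) (cong f (trans (ℕₚ.*-comm d c) (sym eq)))))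
    where
    c<m : c ℕ.< m
    c<m = ℕₚ.<-≤-trans (s≤s (subst (c ℕ.≤_) (sym eq) (ℕₚ.m≤m*n c d {{ℕ.>-nonZero 0<d}}))) n≤m

-- Lets bounds on partial sums act on sums constrained by d e < X with one of the variables fixed:
-- the constraint is downward closed, so it cuts out an initial segment.
S-prefix : ∀ {A : ℕ → Set} (A? : ∀ e → Dec (A e)) → (∀ e → A (suc e) → A e) → (v : ℕ → ℤ) → ∀ n →
           Σ[ c ∈ ℕ ] S n (λ e → ι (A? e) * v e) ≡ S c v
S-prefix A? down v zero = 0 , refl
S-prefix {A} A? down v (suc n) with A? n
... | yes a = suc n , cong₂ _+_ (S-cong n λ i i<n → trans (cong (_* v i) (ι-true (A? i) (downs i (n ℕ.∸ i) (subst A (sym (ℕₚ.m+[n∸m]≡n (ℕₚ.<⇒≤ i<n))) a)))) (ℤₚ.*-identityˡ (v i))) (ℤₚ.*-identityˡ (v n))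
  where
  downs : ∀ i k → A (i ℕ.+ k) → A i
  downs i zero a = subst A (ℕₚ.+-identityʳ i) a
  downs i (suc k) a = downs i k (down (i ℕ.+ k) (subst A (ℕₚ.+-suc i k) a))
... | no _ with S-prefix A? down v n
... | c , e = c , trans (cong (_+ 0ℤ * v n) e) (ℤₚ.+-identityʳ (S c v))

abs-*-≤ : ∀ {a b A B} → ∣ a ∣ ℕ.≤ A → ∣ b ∣ ℕ.≤ B → ∣ a * b ∣ ℕ.≤ A ℕ.* B
abs-*-≤ {a} {b} p q = ℕₚ.≤-trans (ℕₚ.≤-reflexive (ℤₚ.abs-* a b)) (ℕₚ.*-mono-≤ p q)

-- Dirichlet's hyperbola method: d e < Y² forces d < Y or e < Y.
hyperbola : ∀ {P} Y (u v : ℕ → ℤ) → (∀ i → ∣ u i ∣ ℕ.≤ 1) → (∀ i → ∣ v i ∣ ℕ.≤ 1) → (∀ n → ∣ S n u ∣ ℕ.≤ P) → (∀ n → ∣ S n v ∣ ℕ.≤ P) →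
  ∣ S (Y ℕ.* Y) (λ d → S (Y ℕ.* Y) (λ e → ι (d ℕ.* e ℕ.<? Y ℕ.* Y) * (u d * v e))) ∣ ℕ.≤ Y ℕ.* (3 ℕ.* P)
hyperbola zero u v bu bv su sv = z≤n
hyperbola {P} Y@(suc Y-1) u v bu bv su sv = ℕₚ.≤-trans (ℕₚ.≤-reflexive (cong ∣_∣ (trans (trans (cong (λ k → S k row) X≡) (S-split Y Z row)) (cong₂ _+_ low high))))
  (ℕₚ.≤-trans (ℤₚ.∣i+j∣≤∣i∣+∣j∣ (S Y lowTerm) (S Y highTerm)) (ℕₚ.≤-trans (ℕₚ.+-mono-≤ (S-bound Y P lowTerm low-≤) (S-bound Y (2 ℕ.* P) highTerm high-≤)) (ℕₚ.≤-reflexive (lemma Y P))))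
  where
  X = Y ℕ.* Y
  Z = Y-1 ℕ.* Y
  X≡ : X ≡ Y ℕ.+ Z
  X≡ = refl
  lemma : ∀ Y P → Y ℕ.* P ℕ.+ Y ℕ.* (2 ℕ.* P) ≡ Y ℕ.* (3 ℕ.* P)
  lemma = ℕSolver.solve-∀
  rearrange₁ : ∀ i a b → i * (a * b) ≡ a * (i * b)
  rearrange₁ = solve-∀
  rearrange₂ : ∀ i a b → i * (a * b) ≡ b * (i * a)
  rearrange₂ = solve-∀
  row : ℕ → ℤ
  row d = S X (λ e → ι (d ℕ.* e ℕ.<? X) * (u d * v e))
  lowTerm : ℕ → ℤ
  lowTerm d = u d * S X (λ e → ι (d ℕ.* e ℕ.<? X) * v e)
  low : S Y row ≡ S Y lowTerm
  low = S-≗ Y λ d → trans (S-≗ X λ e → rearrange₁ (ι (d ℕ.* e ℕ.<? X)) (u d) (v e)) (S-*ˡ X (u d) (λ e → ι (d ℕ.* e ℕ.<? X) * v e))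
  low-≤ : ∀ d → ∣ lowTerm d ∣ ℕ.≤ P
  low-≤ d with S-prefix (λ e → d ℕ.* e ℕ.<? X) (λ e lt → ℕₚ.≤-<-trans (ℕₚ.*-monoʳ-≤ d (ℕₚ.n≤1+n e)) lt) v X
  ... | c , eq = ℕₚ.≤-trans (abs-*-≤ {u d} (bu d) (subst (λ z → ∣ z ∣ ℕ.≤ P) (sym eq) (sv c))) (ℕₚ.≤-reflexive (ℕₚ.*-identityˡ P))
  shifted : ℕ → ℤ
  shifted d = u (Y ℕ.+ d)
  highTerm : ℕ → ℤ
  highTerm e = v e * S Z (λ d → ι ((Y ℕ.+ d) ℕ.* e ℕ.<? X) * shifted d)
  -- For d ≥ Y only e < Y meets the constraint. After the exchange the inner sum runs over an
  -- interval that starts at `Y`, so it is a difference of two partial sums; this is the factor 2 in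
  -- `high-≤`.
  high : S Z (λ d → row (Y ℕ.+ d)) ≡ S Y highTerm
  high = trans (S-comm Z X _) (trans (S-≗ X λ e → trans (S-≗ Z λ d → rearrange₂ (ι ((Y ℕ.+ d) ℕ.* e ℕ.<? X)) (shifted d) (v e)) (S-*ˡ Z (v e) (λ d → ι ((Y ℕ.+ d) ℕ.* e ℕ.<? X) * shifted d)))
    (S-extend {Y} {X} highTerm (ℕₚ.m≤m+n Y Z) λ e Y≤e → trans (cong (_*_ (v e)) (S-zero Z λ d _ → cong (_* shifted d) (ι-false ((Y ℕ.+ d) ℕ.* e ℕ.<? X)
      (ℕₚ.≤⇒≯ (ℕₚ.*-mono-≤ (ℕₚ.m≤m+n Y d) Y≤e))))) (ℤₚ.*-zeroʳ (v e))))
  high-≤ : ∀ e → ∣ highTerm e ∣ ℕ.≤ 2 ℕ.* P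
  high-≤ e with S-prefix (λ d → (Y ℕ.+ d) ℕ.* e ℕ.<? X) (λ d lt → ℕₚ.≤-<-trans (ℕₚ.*-monoˡ-≤ e (ℕₚ.+-monoʳ-≤ Y (ℕₚ.n≤1+n d))) lt) shifted Z
  ... | c , eq = ℕₚ.≤-trans (abs-*-≤ {v e} (bv e) (ℕₚ.≤-trans (ℕₚ.≤-reflexive (cong ∣_∣ (trans eq difference)))
        (ℕₚ.≤-trans (ℤₚ.∣i-j∣≤∣i∣+∣j∣ (S (Y ℕ.+ c) u) (S Y u)) (ℕₚ.+-mono-≤ (su (Y ℕ.+ c)) (su Y))))) (ℕₚ.≤-reflexive (double P))
    where
    double : ∀ P → 1 ℕ.* (P ℕ.+ P) ≡ 2 ℕ.* P
    double = ℕSolver.solve-∀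
    cancel : ∀ a b → b ≡ a + b - a
    cancel = solve-∀
    difference : S c shifted ≡ S (Y ℕ.+ c) u - S Y u
    difference = trans (cancel (S Y u) (S c shifted)) (cong (_- S Y u) (sym (S-split Y c u)))

-- Quadratic characters and the divisor sum r = 1 * χ

-- Real characters only. The values at arguments not prime to P are left open, as suits Jacobi
-- symbols; `ext` replaces them by 0.
record Character (P : ℕ) : Set where
  field
    val : ℕ → Sign
    mul : ∀ {a b} → Unit (+ a) (+ P) → Unit (+ b) (+ P) → val (a ℕ.* b) ≡ val a · val b
    per : ∀ {a} → Unit (+ a) (+ P) → val (a ℕ.+ P) ≡ val a

open Character public

unit-ℕ* : ∀ {a b n} → Unit (+ a) n → Unit (+ b) n → Unit (+ (a ℕ.* b)) n
unit-ℕ* {a} {b} ua ub = subst (λ z → Unit z _) (sym (ℤₚ.pos-* a b)) (unit-* ua ub)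

unit-ℕ*ˡ : ∀ {a b n} → Unit (+ (a ℕ.* b)) n → Unit (+ a) n
unit-ℕ*ˡ {a} {b} u = unit-*ˡ {+ a} {+ b} (subst (λ z → Unit z _) (ℤₚ.pos-* a b) u)

unit-ℕ*ʳ : ∀ {a b n} → Unit (+ (a ℕ.* b)) n → Unit (+ b) n
unit-ℕ*ʳ {a} {b} u = unit-*ʳ {+ a} {+ b} (subst (λ z → Unit z _) (ℤₚ.pos-* a b) u)

shift-≈ : ∀ a n → + (a ℕ.+ n) ≈ + a [ + n ]
shift-≈ a n = by 1ℤ (cong (_+_ (+ a)) (sym (ℤₚ.*-identityˡ (+ n))))

_⊗_ : ∀ {P} → Character P → Character P → Character P
ψ ⊗ φ = record
  { val = λ a → val ψ a · val φ a
  ; mul = λ {a} {b} ua ub → trans (cong₂ _·_ (mul ψ ua ub) (mul φ ua ub)) (lemma (val ψ a) (val ψ b) (val φ a) (val φ b))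
  ; per = λ u → cong₂ _·_ (per ψ u) (per φ u)
  }
  where
  lemma : ∀ a b c d → (a · b) · (c · d) ≡ (a · c) · (b · d)
  lemma a b c d = trans (Signₚ.*-assoc a b (c · d)) (trans (cong (a ·_) (trans (sym (Signₚ.*-assoc b c d))
    (trans (cong (_· d) (Signₚ.*-comm b c)) (Signₚ.*-assoc c b d)))) (sym (Signₚ.*-assoc a c (b · d))))

𝟙 : ∀ {P} → Character P
𝟙 = record { val = λ _ → ⊕ ; mul = λ _ _ → refl ; per = λ _ → refl }

abs-σ : ∀ s → ∣ σ s ∣ ℕ.≤ 1
abs-σ ⊕ = ℕₚ.≤-refl
abs-σ ⊖ = ℕₚ.≤-refl

module _ {P : ℕ} where

  ext : Character P → ℕ → ℤ
  ext ψ a with unit? a P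
  ... | yes _ = σ (val ψ a)
  ... | no  _ = 0ℤ

  ext-unit : ∀ ψ {a} → Unit (+ a) (+ P) → ext ψ a ≡ σ (val ψ a)
  ext-unit ψ {a} u with unit? a P
  ... | yes _ = refl
  ... | no ¬u = ⊥-elim (¬u u)

  ext-nonunit : ∀ ψ {a} → ¬ Unit (+ a) (+ P) → ext ψ a ≡ 0ℤ
  ext-nonunit ψ {a} ¬u with unit? a P
  ... | yes u = ⊥-elim (¬u u)
  ... | no _ = refl

  ext-* : ∀ ψ a b → ext ψ (a ℕ.* b) ≡ ext ψ a * ext ψ b
  ext-* ψ a b with unit? a P | unit? b P
  ... | yes ua | yes ub = trans (ext-unit ψ (unit-ℕ* ua ub)) (trans (cong σ (mul ψ ua ub)) (σ-* (val ψ a) (val ψ b)))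
  ... | no ¬ua | _ = trans (ext-nonunit ψ (¬ua ∘ unit-ℕ*ˡ {a} {b})) refl
  ... | yes _ | no ¬ub = trans (ext-nonunit ψ (¬ub ∘ unit-ℕ*ʳ {a} {b})) (sym (ℤₚ.*-zeroʳ (σ (val ψ a))))

  ext-⊗ : ∀ ψ φ a → ext (ψ ⊗ φ) a ≡ ext ψ a * ext φ a
  ext-⊗ ψ φ a with unit? a P
  ... | yes _ = σ-* (val ψ a) (val φ a)
  ... | no _ = refl

  ext-per : ∀ ψ a → ext ψ (a ℕ.+ P) ≡ ext ψ a
  ext-per ψ a with unit? a P
  ... | yes u = trans (ext-unit ψ (unit-≈ (≈-sym (shift-≈ a P)) u)) (cong σ (per ψ u))
  ... | no ¬u = ext-nonunit ψ (¬u ∘ unit-≈ (shift-≈ a P))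

  ext-≤1 : ∀ ψ a → ∣ ext ψ a ∣ ℕ.≤ 1
  ext-≤1 ψ a with unit? a P
  ... | yes _ = abs-σ (val ψ a)
  ... | no _ = z≤n

  ext-0 : ∀ ψ → 1 ℕ.< P → ext ψ 0 ≡ 0ℤ
  ext-0 ψ 1<P = ext-nonunit ψ λ u → ℕₚ.<-irrefl (sym (unit⇒coprime u {P} ((P ℕ∣.∣0) , ℕ∣.∣-refl))) 1<P

  ext-mod : ∀ ψ a .{{_ : NonZero P}} → ext ψ (a ℕ/.% P) ≡ ext ψ a
  ext-mod ψ a = sym (trans (cong (ext ψ) (ℕ/.m≡m%n+[m/n]*n a P)) (go (a ℕ/./ P)))
    where
    go : ∀ q → ext ψ (a ℕ/.% P ℕ.+ q ℕ.* P) ≡ ext ψ (a ℕ/.% P)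
    go zero = cong (ext ψ) (ℕₚ.+-identityʳ (a ℕ/.% P))
    go (suc q) = trans (cong (ext ψ) (lemma (a ℕ/.% P) q P)) (trans (ext-per ψ (a ℕ/.% P ℕ.+ q ℕ.* P)) (go q))
      where
      lemma : ∀ r q P → r ℕ.+ (1 ℕ.+ q) ℕ.* P ≡ r ℕ.+ q ℕ.* P ℕ.+ P
      lemma = ℕSolver.solve-∀

S-sum : ∀ n (f : ℕ → ℤ) → S n f ≡ Sum.sum {n} (f ∘ toℕ)
S-sum zero f = refl
S-sum (suc n) f = sym (trans (Sum.sum-init-last {n} (f ∘ toℕ)) (cong₂ _+_ (trans (Sum.sum-cong-≗ {n} λ i → cong f (Finₚ.toℕ-inject₁ i)) (sym (S-sum n f))) (cong f (Finₚ.toℕ-fromℕ n))))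

module _ {P : ℕ} .{{_ : NonZero P}} where

  mulMod : ℕ → Fin P → Fin P
  mulMod u i = fromℕ< (ℕ/.m%n<n (u ℕ.* toℕ i) P)

  toℕ-mulMod : ∀ u i → toℕ (mulMod u i) ≡ (u ℕ.* toℕ i) ℕ/.% P
  toℕ-mulMod u i = Finₚ.toℕ-fromℕ< (ℕ/.m%n<n (u ℕ.* toℕ i) P)

  mulMod-inverse : ∀ u v → + u * + v ≈ 1ℤ [ + P ] → ∀ i → mulMod u (mulMod v i) ≡ i
  mulMod-inverse u v e i = Finₚ.toℕ-injective (trans (toℕ-mulMod u (mulMod v i)) (trans (cong (λ k → (u ℕ.* k) ℕ/.% P) (toℕ-mulMod v i))
    (trans (rem-cong {+ (u ℕ.* ((v ℕ.* toℕ i) ℕ/.% P))} {+ toℕ i} P step) (ℕ/.m<n⇒m%n≡m (Finₚ.toℕ<n i)))))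
    where
    w = (v ℕ.* toℕ i) ℕ/.% P
    step : + (u ℕ.* w) ≈ + toℕ i [ + P ]
    step = ≈-trans (≈-reflexive (ℤₚ.pos-* u w)) (≈-trans (*-congˡ (+ u) (≈-sym (rem-≈ (+ (v ℕ.* toℕ i)) P)))
      (≈-trans (≈-reflexive (trans (cong (_*_ (+ u)) (ℤₚ.pos-* v (toℕ i))) (sym (ℤₚ.*-assoc (+ u) (+ v) (+ toℕ i)))))
      (≈-trans (*-congʳ (+ toℕ i) e) (≈-reflexive (ℤₚ.*-identityˡ (+ toℕ i))))))

  mulPerm : ∀ {u} → Unit (+ u) (+ P) → Permutation P P
  mulPerm {u} (unit v e) = permutation (mulMod u) (mulMod v') (mulMod-inverse u v' e') (mulMod-inverse v' u (≈-trans (≈-reflexive (ℤₚ.*-comm (+ v') (+ u))) e'))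
    where
    v' = v ℤ/.%ℕ P
    e' : + u * + v' ≈ 1ℤ [ + P ]
    e' = ≈-trans (*-congˡ (+ u) (≈-sym (rem-≈ v P))) e

  -- Multiplication by `u` permutes the residues modulo P and reverses the sign of every term.
  zero-mean : ∀ (ψ : Character P) {u} → Unit (+ u) (+ P) → val ψ u ≡ ⊖ → S P (ext ψ) ≡ 0ℤ
  zero-mean ψ {u} un e = self-opposite (trans (S-sum P (ext ψ)) (trans (Sum.sum-permute (ext ψ ∘ toℕ) (mulPerm un)) (trans (Sum.sum-cong-≗ {P} pointwise)
    (trans (sym (S-sum P (λ a → -1ℤ * ext ψ a))) (S-*ˡ P -1ℤ (ext ψ))))))
    where
    self-opposite : ∀ {x} → x ≡ -1ℤ * x → x ≡ 0ℤ
    self-opposite {+ zero} _ = refl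
    self-opposite {+ suc n} ()
    self-opposite { -[1+ n ]} ()
    pointwise : ∀ i → ext ψ (toℕ (mulPerm un ⟨$⟩ʳ i)) ≡ -1ℤ * ext ψ (toℕ i)
    pointwise i = trans (cong (ext ψ) (toℕ-mulMod u i)) (trans (ext-mod ψ (u ℕ.* toℕ i)) (trans (ext-* ψ u (toℕ i)) (cong (_* ext ψ (toℕ i)) (trans (ext-unit ψ un) (cong σ e)))))

  partial-sum-≤ : ∀ (ψ : Character P) {u} → Unit (+ u) (+ P) → val ψ u ≡ ⊖ → ∀ n → ∣ S n (ext ψ) ∣ ℕ.≤ P
  partial-sum-≤ ψ un e n = subst (λ k → ∣ S k (ext ψ) ∣ ℕ.≤ P) (sym (trans (ℕ/.m≡m%n+[m/n]*n n P) (ℕₚ.+-comm (n ℕ/.% P) (n ℕ/./ P ℕ.* P))))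
    (subst (λ z → ∣ z ∣ ℕ.≤ P) (sym (go (n ℕ/./ P))) (ℕₚ.≤-trans (S-bound (n ℕ/.% P) 1 (ext ψ) (ext-≤1 ψ)) (ℕₚ.≤-trans (ℕₚ.≤-reflexive (ℕₚ.*-identityʳ (n ℕ/.% P))) (ℕ/.m%n≤n n P))))
    where
    go : ∀ q → S (q ℕ.* P ℕ.+ n ℕ/.% P) (ext ψ) ≡ S (n ℕ/.% P) (ext ψ)
    go zero = refl
    go (suc q) = trans (cong (λ k → S k (ext ψ)) (ℕₚ.+-assoc P (q ℕ.* P) (n ℕ/.% P))) (trans (S-split P (q ℕ.* P ℕ.+ n ℕ/.% P) (ext ψ))
      (trans (cong₂ _+_ (zero-mean ψ un e) (S-≗ (q ℕ.* P ℕ.+ n ℕ/.% P) λ i → trans (cong (ext ψ) (ℕₚ.+-comm P i)) (ext-per ψ i))) (trans (ℤₚ.+-identityˡ _) (go q))))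

prime-factor : ∀ {a} → 1 ℕ.< a → Σ[ q ∈ ℕ ] Prime q × q ℕ∣.∣ a
prime-factor {a@(suc _)} 1<a with factorise a
... | record { factors = [] ; isFactorisation = refl } = ⊥-elim (ℕₚ.<-irrefl refl 1<a)
... | record { factors = q ∷ qs ; isFactorisation = eq ; factorsPrime = pq ∷ _ } = q , pq , subst (q ℕ∣.∣_) (sym eq) (ℕ∣.m∣m*n (product qs))

extract-power : ∀ {q a} → 1 ℕ.< q → 0 ℕ.< a → Σ[ k ∈ ℕ ] Σ[ m ∈ ℕ ] a ≡ q ℕ.^ k ℕ.* m × ¬ (q ℕ∣.∣ m)
extract-power {q} {a} 1<q 0<a = go a (<-wellFounded a) 0<a
  where
  go : ∀ a → Acc ℕ._<_ a → 0 ℕ.< a → Σ[ k ∈ ℕ ] Σ[ m ∈ ℕ ] a ≡ q ℕ.^ k ℕ.* m × ¬ (q ℕ∣.∣ m)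
  go a (acc rec) 0<a with q ℕ∣.∣? a
  ... | no q∤a = 0 , a , sym (ℕₚ.*-identityˡ a) , q∤a
  ... | yes (ℕ∣.divides (suc b) refl) with go (suc b) (rec (ℕₚ.m<m*n (suc b) q 1<q)) (s≤s z≤n)
  ... | k , m , eq , q∤m = suc k , m , trans (ℕₚ.*-comm (suc b) q) (trans (cong (q ℕ.*_) eq) (sym (ℕₚ.*-assoc q (q ℕ.^ k) m))) , q∤m

prime-coprime : ∀ {q d} → Prime q → ¬ (q ℕ∣.∣ d) → Coprime d q
prime-coprime pq q∤d (i∣d , i∣q) with Primality.prime⇒irreducible pq i∣q
... | inj₁ i≡1 = i≡1
... | inj₂ refl = ⊥-elim (q∤d i∣d)

halves : ∀ n → Σ[ j ∈ ℕ ] (n ≡ j ℕ.+ j ⊎ n ≡ suc (j ℕ.+ j))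
halves zero = 0 , inj₁ refl
halves (suc n) with halves n
... | j , inj₁ refl = j , inj₂ refl
... | j , inj₂ refl = suc j , inj₁ (cong suc (sym (ℕₚ.+-suc j j)))

SquareRoot : ℤ → ℕ → Set
SquareRoot N a = Σ[ b ∈ ℤ ] (+ a ∣ b * b + N)

-- What r(a) ≠ 0 yields for a composite a: the primes q with χ(q) = -1 occur to even powers and
-- disappear in `g`.
SquareTimes : ℤ → ℕ → Set
SquareTimes N a = Σ[ a₀ ∈ ℕ ] Σ[ g ∈ ℕ ] a ≡ a₀ ℕ.* (g ℕ.* g) × SquareRoot N a₀

squareRoot-* : ∀ {N a b} → Unit (+ a) (+ b) → SquareRoot N a → SquareRoot N b → SquareRoot N (a ℕ.* b)
squareRoot-* {N} {a} {b} u (x , dx) (y , dy) with crt u x y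
... | z , z≈x , z≈y = z , subst (_∣ z * z + N) (sym (ℤₚ.pos-* a b)) (∣-coprime-* u (lift z≈x dx) (lift z≈y dy))
  where
  lift : ∀ {x z n} → z ≈ x [ n ] → n ∣ x * x + N → n ∣ z * z + N
  lift e d = ≈0⇒∣ (≈-trans (+-cong (*-cong e e) (≈-refl {N})) (∣⇒≈0 d))

record Factored (a : ℕ) : Set where
  constructor factored
  field
    {q m}   : ℕ
    k       : ℕ
    q-prime : Prime q
    q∤m     : ¬ (q ℕ∣.∣ m)
    0<m     : 0 ℕ.< m
    m<a     : m ℕ.< a
    a≡      : a ≡ q ℕ.^ suc k ℕ.* m

factor-out : ∀ {a} → 1 ℕ.< a → Factored a
factor-out {a} 1<a with prime-factor 1<a
... | q , pq , q∣a with extract-power {q} {a} (prime>1 pq) (ℕₚ.<⇒≤ 1<a)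
... | zero , m , eq , q∤m = ⊥-elim (q∤m (subst (q ℕ∣.∣_) (trans eq (ℕₚ.*-identityˡ m)) q∣a))
... | suc k , zero , eq , q∤m = ⊥-elim (q∤m (q ℕ∣.∣0))
... | suc k , m@(suc _) , eq , q∤m = factored k pq q∤m (s≤s z≤n) (subst (m ℕ.<_) (sym eq) (ℕₚ.<-≤-trans (ℕₚ.m<m*n m q (prime>1 pq))
    (ℕₚ.≤-trans (ℕₚ.≤-reflexive (ℕₚ.*-comm m q)) (ℕₚ.*-monoˡ-≤ m (ℕₚ.m≤m*n q (q ℕ.^ k) {{ℕₚ.m^n≢0 q k {{ℕ.>-nonZero (ℕₚ.<⇒≤ (prime>1 pq))}}}}))))) eq

module Divisors {P : ℕ} (1<P : 1 ℕ.< P) (χ : Character P) where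

  r : ℕ → ℤ
  r a = S (suc a) (λ d → ι (d ℕ∣.∣? a) * ext χ d)

  r-upTo : ∀ {a B} → 0 ℕ.< a → a ℕ.< B → S B (λ d → ι (d ℕ∣.∣? a) * ext χ d) ≡ r a
  r-upTo {a} 0<a a<B = S-extend _ a<B λ d a<d → cong (_* ext χ d) (ι-false (d ℕ∣.∣? a) λ d∣a → ℕₚ.<⇒≱ a<d (ℕ∣.∣⇒≤ {{ℕ.>-nonZero 0<a}} d∣a))

  -- F is completely multiplicative, so F times r is the Dirichlet convolution of χF and F. The
  -- indices 0 do no harm because `ext` vanishes at 0 for P > 1.
  r-convolution : ∀ F X → S X (λ a → ext F a * r a) ≡ S X (λ d → S X (λ e → ι (d ℕ.* e ℕ.<? X) * (ext (χ ⊗ F) d * ext F e)))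
  r-convolution F X = trans (S-cong X expand) (trans (S-comm X X (λ a d → ext χ d * (ι (d ℕ∣.∣? a) * ext F a))) (S-≗ X column))
    where
    rearrange : ∀ f i x → f * (i * x) ≡ x * (i * f)
    rearrange = solve-∀
    zeroTerm : ∀ x i → 0ℤ ≡ x * (i * 0ℤ)
    zeroTerm = solve-∀
    expand : ∀ a → a ℕ.< X → ext F a * r a ≡ S X (λ d → ext χ d * (ι (d ℕ∣.∣? a) * ext F a))
    expand zero a<X = trans (cong (_* r 0) (ext-0 F 1<P)) (sym (S-zero X λ d _ → trans (cong (λ z → ext χ d * (ι (d ℕ∣.∣? 0) * z)) (ext-0 F 1<P)) (sym (zeroTerm (ext χ d) (ι (d ℕ∣.∣? 0))))))
    expand a@(suc _) a<X = trans (cong (ext F a *_) (sym (r-upTo (s≤s z≤n) a<X))) (trans (sym (S-*ˡ X (ext F a) (λ d → ι (d ℕ∣.∣? a) * ext χ d))) (S-≗ X λ d → rearrange (ext F a) (ι (d ℕ∣.∣? a)) (ext χ d)))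
    collect : ∀ x i a b → x * (i * (a * b)) ≡ i * (x * a * b)
    collect = solve-∀
    column : ∀ d → S X (λ a → ext χ d * (ι (d ℕ∣.∣? a) * ext F a)) ≡ S X (λ e → ι (d ℕ.* e ℕ.<? X) * (ext (χ ⊗ F) d * ext F e))
    column zero = trans (S-zero X λ a _ → cong (_* (ι (0 ℕ∣.∣? a) * ext F a)) (ext-0 χ 1<P))
      (sym (S-zero X λ e _ → trans (cong (λ z → ι (0 ℕ.<? X) * (z * ext F e)) (ext-0 (χ ⊗ F) 1<P)) (ℤₚ.*-zeroʳ (ι (0 ℕ.<? X)))))
    column d@(suc _) = trans (S-*ˡ X (ext χ d) (λ a → ι (d ℕ∣.∣? a) * ext F a)) (trans (cong (ext χ d *_) (S-multiples {d} {X} {X} (ext F) (s≤s z≤n) ℕₚ.≤-refl))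
      (trans (sym (S-*ˡ X (ext χ d) (λ e → ι (d ℕ.* e ℕ.<? X) * ext F (d ℕ.* e)))) (S-≗ X λ e → trans (cong (λ z → ext χ d * (ι (d ℕ.* e ℕ.<? X) * z)) (ext-* F d e))
        (trans (collect (ext χ d) (ι (d ℕ.* e ℕ.<? X)) (ext F d) (ext F e)) (cong (λ z → ι (d ℕ.* e ℕ.<? X) * (z * ext F e)) (sym (ext-⊗ χ F d)))))))

  module PrimePower {q m} (pq : Prime q) (q∤m : ¬ (q ℕ∣.∣ m)) (0<m : 0 ℕ.< m) where

    0<q : 0 ℕ.< q
    0<q = ℕₚ.<-trans (s≤s z≤n) (prime>1 pq)

    private instance
      q≢0 : NonZero q
      q≢0 = ℕ.>-nonZero 0<q

    ρ : ℕ → ℤ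
    ρ k = r (q ℕ.^ k ℕ.* m)

    0<qᵏm : ∀ k → 0 ℕ.< q ℕ.^ k ℕ.* m
    0<qᵏm k = ℕₚ.*-mono-≤ (ℕₚ.m^n>0 q k) 0<m

    strip : ∀ k {d} → ¬ (q ℕ∣.∣ d) → d ℕ∣.∣ q ℕ.^ k ℕ.* m → d ℕ∣.∣ m
    strip zero {d} q∤d d∣ = subst (d ℕ∣.∣_) (ℕₚ.*-identityˡ m) d∣
    strip (suc k) {d} q∤d d∣ = strip k q∤d (Coprimality.coprime-divisor (prime-coprime pq q∤d) (subst (d ℕ∣.∣_) (ℕₚ.*-assoc q (q ℕ.^ k) m) d∣))

    ρ-0 : ρ 0 ≡ r m
    ρ-0 = cong r (ℕₚ.*-identityˡ m)

    -- The divisors of q^(k+1) m that q does not divide are those of m; the others are q times the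
    -- divisors of q^k m.
    ρ-suc : ∀ k → ρ (suc k) ≡ r m + ext χ q * ρ k
    ρ-suc k = trans (cong r (ℕₚ.*-assoc q (q ℕ.^ k) m)) (trans (S-≗ B split) (trans (S-distrib-+ B (λ d → ι (d ℕ∣.∣? m) * ext χ d) (λ d → ι (q ℕ∣.∣? d) * (ι (d ℕ∣.∣? q ℕ.* n) * ext χ d)))
      (cong₂ _+_ (r-upTo 0<m (s≤s m≤qn)) (trans (S-multiples {q} {B} {B} (λ d → ι (d ℕ∣.∣? q ℕ.* n) * ext χ d) 0<q ℕₚ.≤-refl)
        (trans (S-≗ B reindex) (trans (S-*ˡ B (ext χ q) (λ e → ι (e ℕ∣.∣? n) * ext χ e)) (cong (ext χ q *_) (r-upTo (0<qᵏm k) (s≤s (ℕₚ.m≤n*m n q))))))))))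
      where
      n = q ℕ.^ k ℕ.* m
      B = suc (q ℕ.* n)
      m≤n : m ℕ.≤ n
      m≤n = ℕₚ.m≤n*m m (q ℕ.^ k) {{ℕₚ.m^n≢0 q k}}
      m≤qn : m ℕ.≤ q ℕ.* n
      m≤qn = ℕₚ.≤-trans m≤n (ℕₚ.m≤n*m n q)
      split : ∀ d → ι (d ℕ∣.∣? q ℕ.* n) * ext χ d ≡ ι (d ℕ∣.∣? m) * ext χ d + ι (q ℕ∣.∣? d) * (ι (d ℕ∣.∣? q ℕ.* n) * ext χ d)
      split d with q ℕ∣.∣? d
      ... | yes q∣d = sym (trans (cong₂ _+_ (cong (_* ext χ d) (ι-false (d ℕ∣.∣? m) λ d∣m → q∤m (ℕ∣.∣-trans q∣d d∣m))) (ℤₚ.*-identityˡ _)) (ℤₚ.+-identityˡ _))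
      ... | no q∤d = trans (cong (_* ext χ d) (ι-cong (d ℕ∣.∣? q ℕ.* n) (d ℕ∣.∣? m)
          (λ d∣ → strip (suc k) q∤d (subst (d ℕ∣.∣_) (sym (ℕₚ.*-assoc q (q ℕ.^ k) m)) d∣)) (λ d∣m → ℕ∣.∣n⇒∣m*n q (ℕ∣.∣n⇒∣m*n (q ℕ.^ k) d∣m)))) (sym (ℤₚ.+-identityʳ _))
      collect : ∀ i a b → 1ℤ * (i * (a * b)) ≡ a * (i * b)
      collect = solve-∀
      zeroʳ : ∀ a b → a * (0ℤ * b) ≡ 0ℤ
      zeroʳ = solve-∀
      reindex : ∀ e → ι (q ℕ.* e ℕ.<? B) * (ι (q ℕ.* e ℕ∣.∣? q ℕ.* n) * ext χ (q ℕ.* e)) ≡ ext χ q * (ι (e ℕ∣.∣? n) * ext χ e)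
      reindex e with e ℕ∣.∣? n
      ... | no e∤n = trans (cong (λ z → ι (q ℕ.* e ℕ.<? B) * (z * ext χ (q ℕ.* e))) (ι-false (q ℕ.* e ℕ∣.∣? q ℕ.* n) (e∤n ∘ ℕ∣.*-cancelˡ-∣ q)))
            (trans (zeroʳ (ι (q ℕ.* e ℕ.<? B)) (ext χ (q ℕ.* e))) (sym (zeroʳ (ext χ q) (ext χ e))))
      ... | yes e∣n = trans (cong₂ (λ z w → z * (w * ext χ (q ℕ.* e)))
              (ι-true (q ℕ.* e ℕ.<? B) (s≤s (ℕₚ.*-monoʳ-≤ q (ℕ∣.∣⇒≤ {{ℕ.>-nonZero (0<qᵏm k)}} e∣n)))) (ι-true (q ℕ.* e ℕ∣.∣? q ℕ.* n) (ℕ∣.*-monoʳ-∣ q e∣n)))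
            (trans (cong (λ z → 1ℤ * (1ℤ * z)) (ext-* χ q e)) (collect 1ℤ (ext χ q) (ext χ e)))

    ρ-split : ext χ q ≡ 1ℤ → ∀ k → ρ k ≡ + suc k * r m
    ρ-split e zero = trans ρ-0 (sym (ℤₚ.*-identityˡ (r m)))
    ρ-split e (suc k) = trans (ρ-suc k) (trans (cong₂ (λ x y → r m + x * y) e (ρ-split e k)) (lemma (r m) (+ suc k)))
      where
      lemma : ∀ x k → x + 1ℤ * (k * x) ≡ (1ℤ + k) * x
      lemma = solve-∀

    ρ-even : ext χ q ≡ -1ℤ → ∀ j → ρ (j ℕ.+ j) ≡ r m
    ρ-odd : ext χ q ≡ -1ℤ → ∀ j → ρ (suc (j ℕ.+ j)) ≡ 0ℤ
    ρ-even e zero = ρ-0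
    ρ-even e (suc j) = trans (cong (λ k → ρ (suc k)) (ℕₚ.+-suc j j)) (trans (ρ-suc (suc (j ℕ.+ j))) (trans (cong₂ (λ x y → r m + x * y) e (ρ-odd e j)) (ℤₚ.+-identityʳ (r m))))
    ρ-odd e j = trans (ρ-suc (j ℕ.+ j)) (trans (cong₂ (λ x y → r m + x * y) e (ρ-even e j)) (lemma (r m)))
      where
      lemma : ∀ x → x + -1ℤ * x ≡ 0ℤ
      lemma = solve-∀

  val-1 : val χ 1 ≡ ⊕
  val-1 = idem (val χ 1) (mul χ {1} {1} unit-1 unit-1)
    where
    idem : ∀ s → s ≡ s · s → s ≡ ⊕
    idem ⊕ _ = refl
    idem ⊖ ()

  r-1 : r 1 ≡ 1ℤ
  r-1 = trans (cong₂ (λ x y → 0ℤ + x * ext χ 0 + y) (ι-false (0 ℕ∣.∣? 1) (λ d → case ℕ∣.0∣⇒≡0 d of λ ()))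
    (cong₂ _*_ (ι-true (1 ℕ∣.∣? 1) ℕ∣.∣-refl) (trans (ext-unit χ {1} unit-1) (cong σ val-1)))) refl

  module _ (N : ℤ) (roots : ∀ {q} → Prime q → Unit (+ q) (+ P) → val χ q ≡ ⊕ → SquareRoot N q) where

    -- One prime power q^k is split off at a time. It contributes a factor k + 1 to r if χ(q) = 1,
    -- and otherwise 1 or 0 according to the parity of k. At most one factor q is put into `a₀`, so
    -- square roots modulo primes suffice and none has to be lifted to a prime power.
    r-structure : ∀ a → Acc ℕ._<_ a → 0 ℕ.< a → Unit (+ a) (+ P) → (0ℤ ℤ.≤ r a) × (r a ≢ 0ℤ → SquareTimes N a)
    r-structure (suc zero) _ _ _ = subst (0ℤ ℤ.≤_) (sym r-1) (+≤+ z≤n) , λ _ → 1 , 1 , refl , 0ℤ , divides (0ℤ + N) (sym (ℤₚ.*-identityʳ (0ℤ + N)))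
    r-structure a@(suc (suc _)) (acc rec) _ u with factor-out {a} (s≤s (s≤s z≤n))
    ... | factored {q} {m} k pq q∤m 0<m m<a a≡ = go (val χ q) refl (halves (suc k))
      where
      open PrimePower pq q∤m 0<m
      u' : Unit (+ (q ℕ.^ suc k ℕ.* m)) (+ P)
      u' = subst (λ z → Unit (+ z) (+ P)) a≡ u
      uq : Unit (+ q) (+ P)
      uq = unit-ℕ*ˡ {q} {q ℕ.^ k} (unit-ℕ*ˡ {q ℕ.^ suc k} {m} u')
      IH = r-structure m (rec m<a) 0<m (unit-ℕ*ʳ {q ℕ.^ suc k} {m} u')
      even : ∀ j → suc k ≡ j ℕ.+ j → SquareTimes N m → SquareTimes N a
      even j e (m₀ , g , m≡ , root) = m₀ , q ℕ.^ j ℕ.* g , trans a≡ (trans (cong₂ (λ x y → q ℕ.^ x ℕ.* y) e m≡) (trans (cong (ℕ._* (m₀ ℕ.* (g ℕ.* g))) (ℕₚ.^-distribˡ-+-* q j j)) (lemma (q ℕ.^ j) m₀ g))) , root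
        where
        lemma : ∀ x m g → x ℕ.* x ℕ.* (m ℕ.* (g ℕ.* g)) ≡ m ℕ.* (x ℕ.* g ℕ.* (x ℕ.* g))
        lemma = ℕSolver.solve-∀
      odd : ∀ j → suc k ≡ suc (j ℕ.+ j) → val χ q ≡ ⊕ → SquareTimes N m → SquareTimes N a
      odd j e s (m₀ , g , m≡ , root) = m₀ ℕ.* q , q ℕ.^ j ℕ.* g , trans a≡ (trans (cong₂ (λ x y → q ℕ.^ x ℕ.* y) e m≡) (trans (cong (λ z → q ℕ.* z ℕ.* (m₀ ℕ.* (g ℕ.* g))) (ℕₚ.^-distribˡ-+-* q j j)) (lemma q (q ℕ.^ j) m₀ g))) ,
        squareRoot-* {N} (coprime⇒unit (prime-coprime pq λ q∣m₀ → q∤m (subst (q ℕ∣.∣_) (sym m≡) (ℕ∣.∣m⇒∣m*n (g ℕ.* g) q∣m₀)))) root (roots pq uq s)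
        where
        lemma : ∀ q x m g → q ℕ.* (x ℕ.* x) ℕ.* (m ℕ.* (g ℕ.* g)) ≡ m ℕ.* q ℕ.* (x ℕ.* g ℕ.* (x ℕ.* g))
        lemma = ℕSolver.solve-∀
      extχ : ∀ s → val χ q ≡ s → ext χ q ≡ σ s
      extχ s e = trans (ext-unit χ uq) (cong σ e)
      go : ∀ s → val χ q ≡ s → Σ[ j ∈ ℕ ] (suc k ≡ j ℕ.+ j ⊎ suc k ≡ suc (j ℕ.+ j)) → (0ℤ ℤ.≤ r a) × (r a ≢ 0ℤ → SquareTimes N a)
      go ⊕ s par = subst (0ℤ ℤ.≤_) (sym ra) (subst (ℤ._≤ + suc (suc k) * r m) (ℤₚ.*-zeroʳ (+ suc (suc k))) (ℤₚ.*-monoˡ-≤-nonNeg (+ suc (suc k)) (proj₁ IH))) , λ r≢0 →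
        build par (proj₂ IH λ e → r≢0 (trans ra (trans (cong (+ suc (suc k) *_) e) (ℤₚ.*-zeroʳ (+ suc (suc k))))))
        where
        ra : r a ≡ + suc (suc k) * r m
        ra = trans (cong r a≡) (ρ-split (extχ ⊕ s) (suc k))
        build : Σ[ j ∈ ℕ ] (suc k ≡ j ℕ.+ j ⊎ suc k ≡ suc (j ℕ.+ j)) → SquareTimes N m → SquareTimes N a
        build (j , inj₁ e) = even j e
        build (j , inj₂ e) = odd j e s
      go ⊖ s (j , inj₁ e) = subst (0ℤ ℤ.≤_) (sym ra) (proj₁ IH) , λ r≢0 → even j e (proj₂ IH λ e' → r≢0 (trans ra e'))
        where
        ra : r a ≡ r m
        ra = trans (cong r a≡) (trans (cong ρ e) (ρ-even (extχ ⊖ s) j))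
      go ⊖ s (j , inj₂ e) = subst (0ℤ ℤ.≤_) (sym ra) ℤₚ.≤-refl , λ r≢0 → ⊥-elim (r≢0 ra)
        where
        ra : r a ≡ 0ℤ
        ra = trans (cong r a≡) (trans (cong ρ e) (ρ-odd (extχ ⊖ s) j))

  r-≥1 : ∀ a → Acc ℕ._<_ a → 0 ℕ.< a → Unit (+ a) (+ P) → (∀ {q} → Prime q → q ℕ∣.∣ a → val χ q ≡ ⊕) → 1ℤ ℤ.≤ r a
  r-≥1 (suc zero) _ _ _ _ = ℤₚ.≤-reflexive (sym r-1)
  r-≥1 a@(suc (suc _)) (acc rec) _ u split with factor-out {a} (s≤s (s≤s z≤n))
  ... | factored {q} {m} k pq q∤m 0<m m<a a≡ = subst (1ℤ ℤ.≤_) (sym ra) (ℤₚ.≤-trans IH (ℤₚ.≤-trans (ℤₚ.≤-reflexive (sym (ℤₚ.*-identityˡ (r m))))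
      (ℤₚ.*-monoʳ-≤-nonNeg (r m) {{ℤ.nonNegative (ℤₚ.≤-trans (+≤+ z≤n) IH)}} {1ℤ} {+ suc (suc k)} (+≤+ (s≤s z≤n)))))
    where
    open PrimePower pq q∤m 0<m
    u' : Unit (+ (q ℕ.^ suc k ℕ.* m)) (+ P)
    u' = subst (λ z → Unit (+ z) (+ P)) a≡ u
    uq : Unit (+ q) (+ P)
    uq = unit-ℕ*ˡ {q} {q ℕ.^ k} (unit-ℕ*ˡ {q ℕ.^ suc k} {m} u')
    IH : 1ℤ ℤ.≤ r m
    IH = r-≥1 m (rec m<a) 0<m (unit-ℕ*ʳ {q ℕ.^ suc k} {m} u') λ {q'} pq' q'∣m → split pq' (subst (q' ℕ∣.∣_) (sym a≡) (ℕ∣.∣n⇒∣m*n (q ℕ.^ suc k) q'∣m))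
    ra : r a ≡ + suc (suc k) * r m
    ra = trans (cong r a≡) (ρ-split (trans (ext-unit χ uq) (cong σ (split pq (subst (q ℕ∣.∣_) (sym a≡) (ℕ∣.∣m⇒∣m*n m (ℕ∣.∣m⇒∣m*n (q ℕ.^ k) ℕ∣.∣-refl)))))) (suc k))

-- Counting numbers with prescribed characters

Twists : ℕ → Set
Twists P = List (Character P × Sign)

TrivialAt : ∀ {P} → ℕ → Twists P → Set
TrivialAt u = All (λ p → val (proj₁ p) u ≡ ⊕)

AgreesAt : ∀ {P} → ℕ → Twists P → Set
AgreesAt a = All (λ p → val (proj₁ p) a ≡ proj₂ p)

-- Linear independence over the field of two elements in triangular form: a product of twists whose
-- first factor is ψ takes the value -1 at the `u` attached to ψ, so it is nontrivial.
data Independent {P : ℕ} : Twists P → Set where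
  []  : Independent []
  _∷_ : ∀ {ψ ε L} → (Σ[ u ∈ ℕ ] Unit (+ u) (+ P) × val ψ u ≡ ⊖ × TrivialAt u L) → Independent L → Independent ((ψ , ε) ∷ L)

module Counting {P : ℕ} (1<P : 1 ℕ.< P) (χ : Character P) (N : ℕ) (0<N : 0 ℕ.< N)
  (roots : ∀ {q} → Prime q → Unit (+ q) (+ P) → val χ q ≡ ⊕ → SquareRoot (+ N) q)
  (splits : ∀ {q} → Prime q → Unit (+ q) (+ P) → (b : ℤ) → - (+ N) ≈ b * b [ + q ] → val χ q ≡ ⊕)
  where

  open Divisors 1<P χ

  private instance
    P≢0 : NonZero P
    P≢0 = ℕ.>-nonZero (ℕₚ.<⇒≤ 1<P)

  unit⇒0< : ∀ {a} → Unit (+ a) (+ P) → 0 ℕ.< a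
  unit⇒0< {zero} u = ⊥-elim (ℕₚ.<-irrefl (sym (unit⇒coprime u {P} ((P ℕ∣.∣0) , ℕ∣.∣-refl))) 1<P)
  unit⇒0< {suc a} u = s≤s z≤n

  -- `ext 𝟙` is the indicator of the numbers prime to P.
  weight : ℕ → ℤ
  weight a = ext {P} 𝟙 a * r a

  weight-≥0 : ∀ a → 0ℤ ℤ.≤ weight a
  weight-≥0 a = go (unit? a P)
    where
    go : Dec (Unit (+ a) (+ P)) → 0ℤ ℤ.≤ weight a
    go (yes u) = subst (0ℤ ℤ.≤_) (sym (trans (cong (_* r a) (ext-unit {P} 𝟙 u)) (ℤₚ.*-identityˡ (r a)))) (proj₁ (r-structure (+ N) roots a (<-wellFounded a) (unit⇒0< u) u))
    go (no ¬u) = ℤₚ.≤-reflexive (sym (cong (_* r a) (ext-nonunit {P} 𝟙 ¬u)))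

  -- The value of x² + N y² at x = P i + 1 and y = P^j. For j > 0 it is 1 modulo P, and then y is
  -- invertible modulo each of its prime factors.
  norm : ℕ → ℕ → ℕ
  norm i j = suc (P ℕ.* i) ℕ.* suc (P ℕ.* i) ℕ.+ N ℕ.* (P ℕ.^ j ℕ.* P ℕ.^ j)

  norm-unit : ∀ i j → Unit (+ norm i (suc j)) (+ P)
  norm-unit i j = unit-≈ (≈-sym (by (+ q) (trans (cong +_ (lemma P i N (P ℕ.^ j))) (cong (_+_ 1ℤ) (ℤₚ.pos-* q P))))) unit-1
    where
    q = i ℕ.* (2 ℕ.+ P ℕ.* i) ℕ.+ N ℕ.* (P ℕ.^ j ℕ.* (P ℕ.* P ℕ.^ j))
    lemma : ∀ P i N p → (1 ℕ.+ P ℕ.* i) ℕ.* (1 ℕ.+ P ℕ.* i) ℕ.+ N ℕ.* (P ℕ.* p ℕ.* (P ℕ.* p)) ≡ 1 ℕ.+ (i ℕ.* (2 ℕ.+ P ℕ.* i) ℕ.+ N ℕ.* (p ℕ.* (P ℕ.* p))) ℕ.* P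
    lemma = ℕSolver.solve-∀

  unit-^ : ∀ {a n} k → Unit (+ a) n → Unit (+ (a ℕ.^ k)) n
  unit-^ zero u = unit-1
  unit-^ {a} (suc k) u = unit-ℕ* u (unit-^ k u)

  -- From x² + N y² ≡ 0 modulo q it follows that -N is the square of x / y.
  norm-splits : ∀ i j {q} → Prime q → q ℕ∣.∣ norm i (suc j) → val χ q ≡ ⊕
  norm-splits i j {q} pq d@(ℕ∣.divides c eq) = splits pq uq (+ x * y⁻¹) root
    where
    x = suc (P ℕ.* i)
    y = P ℕ.^ suc j
    uq : Unit (+ q) (+ P)
    uq = unit-ℕ*ʳ {c} {q} (subst (λ z → Unit (+ z) (+ P)) eq (norm-unit i j))
    uy : Unit (+ y) (+ q)
    uy = unit-^ (suc j) (unit-sym uq)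
    y⁻¹ = Unit.inverse uy
    norm≡ : + norm i (suc j) ≡ + x * + x + + N * (+ y * + y)
    norm≡ = cong₂ _+_ (ℤₚ.pos-* x x) (trans (ℤₚ.pos-* N (y ℕ.* y)) (cong (+ N *_) (ℤₚ.pos-* y y)))
    base : + x * + x + + N * (+ y * + y) ≈ 0ℤ [ + q ]
    base = ∣⇒≈0 (subst (+ q ∣_) norm≡ (ℤ∣.∣ᵤ⇒∣ d))
    lemma : ∀ x y z n → x * z * (x * z) ≡ z * z * (x * x + n * (y * y)) - n * (y * z) * (y * z)
    lemma = solve-∀
    zeroed : ∀ z n → z * z * 0ℤ - n * 1ℤ * 1ℤ ≡ - n
    zeroed = solve-∀
    root : - (+ N) ≈ + x * y⁻¹ * (+ x * y⁻¹) [ + q ]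
    root = ≈-sym (≈-trans (≈-reflexive (lemma (+ x) (+ y) y⁻¹ (+ N)))
      (≈-trans (+-cong (*-congˡ (y⁻¹ * y⁻¹) base) (neg-cong (*-cong (*-congˡ (+ N) (Unit.isInverse uy)) (Unit.isInverse uy)))) (≈-reflexive (zeroed y⁻¹ (+ N)))))

  weight-norm : ∀ i j → 1ℤ ℤ.≤ weight (norm i (suc j))
  weight-norm i j = subst (1ℤ ℤ.≤_) (sym (trans (cong (_* r a) (ext-unit {P} 𝟙 u)) (ℤₚ.*-identityˡ (r a)))) (r-≥1 a (<-wellFounded a) (unit⇒0< u) u (norm-splits i j))
    where
    a = norm i (suc j)
    u = norm-unit i j

  norm-< : ∀ i j → norm i j ℕ.< norm i (suc j)
  norm-< i j = ℕₚ.+-monoʳ-< (suc (P ℕ.* i) ℕ.* suc (P ℕ.* i)) (ℕₚ.*-monoʳ-< N {{ℕ.>-nonZero 0<N}} (ℕₚ.*-mono-< pow pow))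
    where
    pow : P ℕ.^ j ℕ.< P ℕ.^ suc j
    pow = ℕₚ.^-monoʳ-< P 1<P {j} {suc j} ℕₚ.≤-refl

  add-one : ∀ {a b k} → a + + k ℤ.≤ b → ∀ {w} → 1ℤ ℤ.≤ w → a + + suc k ℤ.≤ b + w
  add-one {a} {b} {k} p {w} q = subst (ℤ._≤ b + w) (trans (ℤₚ.+-assoc a (+ k) 1ℤ) (cong (_+_ a) (cong +_ (ℕₚ.+-comm k 1)))) (ℤₚ.+-mono-≤ p q)

  -- The norms with exponents 1, ..., k increase strictly from above x² and stay below the norm with
  -- exponent k + 1; each adds at least 1.
  inner : ∀ i k → S (suc (P ℕ.* i) ℕ.* suc (P ℕ.* i)) weight + + k ℤ.≤ S (norm i (suc k)) weight
  inner i zero = subst (ℤ._≤ S (norm i 1) weight) (sym (ℤₚ.+-identityʳ (S x² weight))) (S-mono {x²} {norm i 1} weight-≥0 (ℕₚ.m≤m+n x² (N ℕ.* (P ℕ.^ 1 ℕ.* P ℕ.^ 1))))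
    where x² = suc (P ℕ.* i) ℕ.* suc (P ℕ.* i)
  inner i (suc k) = ℤₚ.≤-trans (add-one {S (suc (P ℕ.* i) ℕ.* suc (P ℕ.* i)) weight} {S (norm i (suc k)) weight} {k} (inner i k) (weight-norm i k))
    (S-mono {suc (norm i (suc k))} {norm i (suc (suc k))} weight-≥0 (norm-< i (suc k)))

  height : ℕ → ℕ
  height K = N ℕ.* (P ℕ.^ suc K ℕ.* P ℕ.^ suc K)

  side : ℕ → ℕ → ℕ
  side K i = suc (P ℕ.* (i ℕ.+ height K))

  outer : ∀ K i → + (i ℕ.* K) ℤ.≤ S (side K i ℕ.* side K i) weight
  outer K zero = S-nonneg (side K 0 ℕ.* side K 0) weight-≥0
  outer K (suc i) = ℤₚ.≤-trans (subst (ℤ._≤ S (x ℕ.* x) weight + + K) (cong +_ (ℕₚ.+-comm (i ℕ.* K) K)) (ℤₚ.+-monoˡ-≤ (+ K) (outer K i)))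
    (ℤₚ.≤-trans (inner (i ℕ.+ height K) K) (S-mono weight-≥0 gap))
    where
    x = side K i
    B₀ = height K
    gap : x ℕ.* x ℕ.+ B₀ ℕ.≤ side K (suc i) ℕ.* side K (suc i)
    gap = ℕₚ.≤-trans (ℕₚ.+-monoʳ-≤ (x ℕ.* x) (ℕₚ.≤-trans (ℕₚ.m≤n+m B₀ i) (ℕₚ.≤-trans (ℕₚ.m≤n*m (i ℕ.+ B₀) P) (ℕₚ.≤-trans (ℕₚ.n≤1+n _) (ℕₚ.≤-trans (ℕₚ.m≤n*m x P) (ℕₚ.m≤m+n (P ℕ.* x) (P ℕ.* x ℕ.+ P ℕ.* P)))))))
      (ℕₚ.≤-reflexive (lemma P (i ℕ.+ B₀)))
      where
      lemma : ∀ P t → (1 ℕ.+ P ℕ.* t) ℕ.* (1 ℕ.+ P ℕ.* t) ℕ.+ (P ℕ.* (1 ℕ.+ P ℕ.* t) ℕ.+ (P ℕ.* (1 ℕ.+ P ℕ.* t) ℕ.+ P ℕ.* P)) ≡ (1 ℕ.+ P ℕ.* (1 ℕ.+ t)) ℕ.* (1 ℕ.+ P ℕ.* (1 ℕ.+ t))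
      lemma = ℕSolver.solve-∀

  selector : Twists P → ℕ → ℤ
  selector [] a = 1ℤ
  selector ((ψ , ε) ∷ L) a = (1ℤ + σ ε * ext ψ a) * selector L a

  -- This is 2^n - 1, the number of nontrivial products of n twists.
  errors : Twists P → ℕ
  errors [] = 0
  errors (_ ∷ L) = errors L ℕ.+ 2 ℕ.^ List.length L

  module _ (u₀ : ℕ) (unit-u₀ : Unit (+ u₀) (+ P)) (χu₀ : val χ u₀ ≡ ⊖) where

    module _ (Y : ℕ) where
      X = Y ℕ.* Y
      E = Y ℕ.* (3 ℕ.* P)

      W : Twists P → Character P → ℤ
      W L F = S X (λ a → ext F a * r a * selector L a)

      W-∷ : ∀ ψ ε L F → W ((ψ , ε) ∷ L) F ≡ W L F + σ ε * W L (F ⊗ ψ)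
      W-∷ ψ ε L F = trans (S-≗ X λ a → trans (lemma (ext F a) (r a) (σ ε) (ext ψ a) (selector L a)) (cong (λ z → ext F a * r a * selector L a + σ ε * (z * r a * selector L a)) (sym (ext-⊗ F ψ a))))
        (trans (S-distrib-+ X (λ a → ext F a * r a * selector L a) (λ a → σ ε * (ext (F ⊗ ψ) a * r a * selector L a))) (cong (_+_ (W L F)) (S-*ˡ X (σ ε) (λ a → ext (F ⊗ ψ) a * r a * selector L a))))
        where
        lemma : ∀ f r e p k → f * r * ((1ℤ + e * p) * k) ≡ f * r * k + e * (f * p * r * k)
        lemma = solve-∀

      W-[] : ∀ F → W [] F ≡ S X (λ a → ext F a * r a)
      W-[] F = S-≗ X λ a → ℤₚ.*-identityʳ (ext F a * r a)

      -- Expanding the selector gives 2^n sums of r against F times a product of twists. The witness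
      -- `u` shows that each such character is nontrivial, and `u₀` that it remains so after
      -- multiplication by χ; the hyperbola bound asks for both.
      W-≤ : ∀ L F {u} → Unit (+ u) (+ P) → val F u ≡ ⊖ → TrivialAt u L → val F u₀ ≡ ⊕ → TrivialAt u₀ L → ∣ W L F ∣ ℕ.≤ 2 ℕ.^ List.length L ℕ.* E
      W-≤ [] F uu Fu _ Fu₀ _ = subst (λ z → ∣ z ∣ ℕ.≤ 1 ℕ.* E) (sym (trans (W-[] F) (r-convolution F X))) (ℕₚ.≤-trans
        (hyperbola Y (ext (χ ⊗ F)) (ext F) (ext-≤1 (χ ⊗ F)) (ext-≤1 F) (partial-sum-≤ (χ ⊗ F) unit-u₀ (cong₂ _·_ χu₀ Fu₀)) (partial-sum-≤ F uu Fu)) (ℕₚ.≤-reflexive (sym (ℕₚ.*-identityˡ E))))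
      W-≤ ((ψ , ε) ∷ L) F {u} uu Fu (ψu ∷ tu) Fu₀ (ψu₀ ∷ tu₀) = subst (λ z → ∣ z ∣ ℕ.≤ 2 ℕ.^ suc (List.length L) ℕ.* E) (sym (W-∷ ψ ε L F))
        (ℕₚ.≤-trans (ℤₚ.∣i+j∣≤∣i∣+∣j∣ (W L F) (σ ε * W L (F ⊗ ψ))) (ℕₚ.≤-trans (ℕₚ.+-mono-≤ (W-≤ L F uu Fu tu Fu₀ tu₀)
          (abs-*-≤ {σ ε} (abs-σ ε) (W-≤ L (F ⊗ ψ) uu (cong₂ _·_ Fu ψu) tu (cong₂ _·_ Fu₀ ψu₀) tu₀))) (ℕₚ.≤-reflexive (lemma (2 ℕ.^ List.length L) E))))
        where
        lemma : ∀ t E → t ℕ.* E ℕ.+ 1 ℕ.* (t ℕ.* E) ≡ 2 ℕ.* t ℕ.* E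
        lemma = ℕSolver.solve-∀

      -- Each twist doubles the number of terms, and every new one contains ψ, so that `W-≤` applies
      -- with the witness attached to ψ.
      W-main : ∀ L → Independent L → TrivialAt u₀ L → S X weight ℤ.≤ W L 𝟙 + + (errors L ℕ.* E)
      W-main [] _ _ = ℤₚ.≤-reflexive (trans (sym (W-[] 𝟙)) (sym (ℤₚ.+-identityʳ (W [] 𝟙))))
      W-main ((ψ , ε) ∷ L) ((u , uu , ψu , tu) ∷ ind) (ψu₀ ∷ tu₀) = ℤₚ.≤-trans (W-main L ind tu₀)
        (subst (W L 𝟙 + + (errors L ℕ.* E) ℤ.≤_) (sym total) (subst (ℤ._≤ W L 𝟙 + + (errors L ℕ.* E) + (z + + B)) (ℤₚ.+-identityʳ (W L 𝟙 + + (errors L ℕ.* E))) (ℤₚ.+-monoʳ-≤ (W L 𝟙 + + (errors L ℕ.* E)) (abs-bound z B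
          (ℕₚ.≤-trans (abs-*-≤ {σ ε} (abs-σ ε) (W-≤ L (𝟙 ⊗ ψ) uu ψu tu ψu₀ tu₀)) (ℕₚ.≤-reflexive (ℕₚ.*-identityˡ B)))))))
        where
        B = 2 ℕ.^ List.length L ℕ.* E
        z = σ ε * W L (𝟙 ⊗ ψ)
        abs-bound : ∀ z B → ∣ z ∣ ℕ.≤ B → 0ℤ ℤ.≤ z + + B
        abs-bound (+ n) B _ = +≤+ z≤n
        abs-bound -[1+ n ] B le = subst (0ℤ ℤ.≤_) (sym (ℤₚ.⊖-≥ le)) (+≤+ z≤n)
        lemma : ∀ a e z b → a + e + (z + b) ≡ a + z + (e + b)
        lemma = solve-∀
        total : W ((ψ , ε) ∷ L) 𝟙 + + (errors ((ψ , ε) ∷ L) ℕ.* E) ≡ W L 𝟙 + + (errors L ℕ.* E) + (z + + B)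
        total = trans (cong₂ _+_ (W-∷ ψ ε L 𝟙) (cong +_ (ℕₚ.*-distribʳ-+ E (errors L) (2 ℕ.^ List.length L)))) (sym (lemma (W L 𝟙) (+ (errors L ℕ.* E)) z (+ B)))

    selector-≢0 : ∀ L {a} → Unit (+ a) (+ P) → selector L a ≢ 0ℤ → AgreesAt a L
    selector-≢0 [] _ _ = []
    selector-≢0 ((ψ , ε) ∷ L) {a} u ne = agree ε (val ψ a) refl ∷ selector-≢0 L u (λ e → ne (trans (cong ((1ℤ + σ ε * ext ψ a) *_) e) (ℤₚ.*-zeroʳ (1ℤ + σ ε * ext ψ a))))
      where
      vanish : ∀ s → σ ε * σ s ≡ -1ℤ → val ψ a ≡ s → ⊥
      vanish s e v = ne (cong (_* selector L a) (trans (cong (λ z → 1ℤ + σ ε * z) (trans (ext-unit ψ u) (cong σ v))) (cong (_+_ 1ℤ) e)))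
      agree : ∀ δ s → ε ≡ δ → val ψ a ≡ δ
      agree δ s refl with val ψ a in eq
      agree ⊕ s refl | ⊕ = refl
      agree ⊖ s refl | ⊖ = refl
      agree ⊕ s refl | ⊖ = ⊥-elim (vanish ⊖ refl eq)
      agree ⊖ s refl | ⊕ = ⊥-elim (vanish ⊕ refl eq)

    -- The norms (Pi+1)² + N P²ʲ beat the error terms once the number K of exponents j exceeds 9P² times their number.
    exists-split′ : ∀ L → Independent L → TrivialAt u₀ L →
      Σ[ a ∈ ℕ ] Unit (+ a) (+ P) × AgreesAt a L × SquareTimes (+ N) a
    exists-split′ L ind tu₀ = conclude (S-nonzero (X Y) (λ a → ext {P} 𝟙 a * r a * selector L a) W≢0)
      where
      c = errors L
      K = suc (9 ℕ.* c ℕ.* P ℕ.* P)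
      B₀ = height K
      Y = side K B₀
      0<B₀ : 0 ℕ.< B₀
      0<B₀ = ℕₚ.*-mono-≤ 0<N (ℕₚ.*-mono-≤ (ℕₚ.m^n>0 P (suc K)) (ℕₚ.m^n>0 P (suc K)))
      0<PB₀ : 1 ℕ.≤ P ℕ.* B₀
      0<PB₀ = ℕₚ.*-mono-≤ (ℕₚ.<⇒≤ 1<P) 0<B₀
      -- `Y` is 2PB₀ + 1 ≤ 3PB₀, so the error c · 3PY is at most 9cP²B₀, which the choice of `K`
      -- keeps below KB₀.
      error< : c ℕ.* E Y ℕ.< B₀ ℕ.* K
      error< = ℕₚ.≤-<-trans (ℕₚ.*-monoʳ-≤ c (ℕₚ.*-monoˡ-≤ (3 ℕ.* P) (ℕₚ.+-monoˡ-≤ (P ℕ.* (B₀ ℕ.+ B₀)) 0<PB₀)))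
        (ℕₚ.<-≤-trans (ℕₚ.≤-<-trans (ℕₚ.≤-reflexive (lemma₁ c P B₀)) (ℕₚ.m<n+m _ 0<B₀)) (ℕₚ.≤-reflexive (lemma₂ c P B₀)))
        where
        lemma₁ : ∀ c P B → c ℕ.* ((P ℕ.* B ℕ.+ P ℕ.* (B ℕ.+ B)) ℕ.* (3 ℕ.* P)) ≡ B ℕ.* (9 ℕ.* c ℕ.* P ℕ.* P)
        lemma₁ = ℕSolver.solve-∀
        lemma₂ : ∀ c P B → B ℕ.+ B ℕ.* (9 ℕ.* c ℕ.* P ℕ.* P) ≡ B ℕ.* (1 ℕ.+ 9 ℕ.* c ℕ.* P ℕ.* P)
        lemma₂ = ℕSolver.solve-∀
      W≢0 : W Y L 𝟙 ≢ 0ℤ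
      W≢0 e = ℕₚ.<⇒≱ error< (ℤₚ.drop‿+≤+ (subst (+ (B₀ ℕ.* K) ℤ.≤_) (trans (cong (_+ + (c ℕ.* E Y)) e) (ℤₚ.+-identityˡ (+ (c ℕ.* E Y)))) (ℤₚ.≤-trans (outer K B₀) (W-main Y L ind tu₀))))
      conclude : Σ[ a ∈ ℕ ] ext {P} 𝟙 a * r a * selector L a ≢ 0ℤ → Σ[ a ∈ ℕ ] Unit (+ a) (+ P) × AgreesAt a L × SquareTimes (+ N) a
      conclude (a , ne) = go (unit? a P)
        where
        go : Dec (Unit (+ a) (+ P)) → Σ[ a ∈ ℕ ] Unit (+ a) (+ P) × AgreesAt a L × SquareTimes (+ N) a
        go (no ¬u) = ⊥-elim (ne (cong (λ z → z * r a * selector L a) (ext-nonunit {P} 𝟙 ¬u)))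
        go (yes u) = a , u , selector-≢0 L u (λ e → ne (trans (cong (ext {P} 𝟙 a * r a *_) e) (ℤₚ.*-zeroʳ (ext {P} 𝟙 a * r a)))) ,
          proj₂ (r-structure (+ N) roots a (<-wellFounded a) (unit⇒0< u) u) (λ e → ne (trans (cong (λ z → ext {P} 𝟙 a * z * selector L a) e) (cong (_* selector L a) (ℤₚ.*-zeroʳ (ext {P} 𝟙 a)))))

exists-split : ∀ {P N} → 1 ℕ.< P → 0 ℕ.< N → (χ : Character P) →
  (∀ {q} → Prime q → Unit (+ q) (+ P) → val χ q ≡ ⊕ → SquareRoot (+ N) q) →
  (∀ {q} → Prime q → Unit (+ q) (+ P) → (b : ℤ) → - (+ N) ≈ b * b [ + q ] → val χ q ≡ ⊕) →
  ∀ {u₀} → Unit (+ u₀) (+ P) → val χ u₀ ≡ ⊖ → ∀ {L} → Independent L → TrivialAt u₀ L →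
  Σ[ a ∈ ℕ ] Unit (+ a) (+ P) × AgreesAt a L × SquareTimes (+ N) a
exists-split {P} {N} 1<P 0<N χ roots splits {u₀} unit-u₀ χu₀ {L} ind tu₀ = Counting.exists-split′ {P} 1<P χ N 0<N roots splits u₀ unit-u₀ χu₀ L ind tu₀

-- The characters modulo 8, the character of -N, and numbers with prescribed residues

unit-2⇒odd : ∀ {a} → Unit (+ a) (+ 2) → Odd a
unit-2⇒odd {a} u with halves a
... | j , inj₂ e = odd-od j e
... | j , inj₁ refl = ⊥-elim (case unit⇒coprime u {2} (ℕ∣.divides j (trans (cong (j ℕ.+_) (sym (ℕₚ.+-identityʳ j))) (ℕₚ.*-comm 2 j)) , ℕ∣.∣-refl) of λ ())

J-neg : ∀ {N d} → Odd d → Unit (+ N) (+ d) → J (- (+ N)) d ≡ J -1ℤ d · J (+ N) d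
J-neg {N} {d} o u = trans (cong (λ z → J z d) (sym (ℤₚ.-1*i≡-i (+ N)))) (J-* o (unit-neg unit-1) u)

J-one : ∀ {n} → Odd n → J 1ℤ n ≡ ⊕
J-one o = J-square o unit-1 (≈-refl {1ℤ})

odd-+-even : ∀ {d} k → Odd d → Odd (d ℕ.+ k ℕ.* 4)
odd-+-even {d} k o = odd-od (⌊ d /2⌋ ℕ.+ 2 ℕ.* k) (trans (cong (ℕ._+ k ℕ.* 4) o) (lemma ⌊ d /2⌋ k))
  where
  lemma : ∀ h k → 1 ℕ.+ (h ℕ.+ h) ℕ.+ k ℕ.* 4 ≡ 1 ℕ.+ (h ℕ.+ 2 ℕ.* k ℕ.+ (h ℕ.+ 2 ℕ.* k))
  lemma = ℕSolver.solve-∀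

par-half-+4 : ∀ {d} k → Odd d → par ⌊ d ℕ.+ k ℕ.* 4 /2⌋ ≡ par ⌊ d /2⌋
par-half-+4 {d} k o = trans (cong (λ z → par ⌊ z /2⌋) (trans (cong (ℕ._+ k ℕ.* 4) o) (lemma h k))) (trans (cong par (half-od (h ℕ.+ (k ℕ.+ k))))
  (trans (par-+ h (k ℕ.+ k)) (trans (cong (par h ·_) (trans (par-+ k k) (Signₚ.s*s≡+ (par k)))) (Signₚ.*-identityʳ (par h)))))
  where
  h = ⌊ d /2⌋
  lemma : ∀ h k → 1 ℕ.+ (h ℕ.+ h) ℕ.+ k ℕ.* 4 ≡ 1 ℕ.+ (h ℕ.+ (k ℕ.+ k) ℕ.+ (h ℕ.+ (k ℕ.+ k)))
  lemma = ℕSolver.solve-∀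

J-minus-one-period : ∀ {d} k → Odd d → J -1ℤ (d ℕ.+ k ℕ.* 4) ≡ J -1ℤ d
J-minus-one-period {d} k o = trans (J-minus-one (d ℕ.+ k ℕ.* 4)) (trans (par-half-+4 k o) (sym (J-minus-one d)))

J-period-* : ∀ {N d} k → Odd d → Unit (+ N) (+ d) → J (+ N) (d ℕ.+ k ℕ.* (4 ℕ.* N)) ≡ J (+ N) d
J-period-* {N} {d} zero o u = cong (J (+ N)) (ℕₚ.+-identityʳ d)
J-period-* {N} {d} (suc k) o u = trans (cong (J (+ N)) (lemma d k N)) (trans (J-period o' u') (J-period-* k o u))
  where
  d' = d ℕ.+ k ℕ.* (4 ℕ.* N)
  lemma : ∀ d k N → d ℕ.+ (1 ℕ.+ k) ℕ.* (4 ℕ.* N) ≡ d ℕ.+ k ℕ.* (4 ℕ.* N) ℕ.+ 4 ℕ.* N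
  lemma = ℕSolver.solve-∀
  lemma' : ∀ k N → k ℕ.* (4 ℕ.* N) ≡ k ℕ.* N ℕ.* 4
  lemma' = ℕSolver.solve-∀
  o' : Odd d'
  o' = subst Odd (cong (d ℕ.+_) (sym (lemma' k N))) (odd-+-even (k ℕ.* N) o)
  u' : Unit (+ N) (+ d')
  u' = unit-sym (unit-≈ (≈-sym (by (+ (k ℕ.* 4)) (cong (_+_ (+ d)) (trans (cong +_ (sym (ℕₚ.*-assoc k 4 N))) (ℤₚ.pos-* (k ℕ.* 4) N))))) (unit-sym u))

opaque
  unfolding J

  J2-1 : J (+ 2) 1 ≡ ⊕
  J2-1 = refl
  J2-3 : J (+ 2) 3 ≡ ⊖
  J2-3 = refl
  J2-5 : J (+ 2) 5 ≡ ⊖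
  J2-5 = refl
  J2-7 : J (+ 2) 7 ≡ ⊕
  J2-7 = refl

data OddResidue : ℕ → ℕ → Set where
  one   : ∀ k → OddResidue (1 ℕ.+ k ℕ.* 8) 1
  three : ∀ k → OddResidue (3 ℕ.+ k ℕ.* 8) 3
  five  : ∀ k → OddResidue (5 ℕ.+ k ℕ.* 8) 5
  seven : ∀ k → OddResidue (7 ℕ.+ k ℕ.* 8) 7

oddResidue : ∀ {a} → Odd a → Σ[ s ∈ ℕ ] OddResidue a s
oddResidue {a} o = subst (λ z → Σ[ s ∈ ℕ ] OddResidue z s) (sym o) (go ⌊ a /2⌋)
  where
  next : ∀ {a s} → OddResidue a s → Σ[ s ∈ ℕ ] OddResidue (2 ℕ.+ a) s
  next (one k)   = 3 , three k
  next (three k) = 5 , five k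
  next (five k)  = 7 , seven k
  next (seven k) = 1 , one (suc k)
  go : ∀ h → Σ[ s ∈ ℕ ] OddResidue (od h) s
  go zero = 1 , one 0
  go (suc h) = subst (λ z → Σ[ s ∈ ℕ ] OddResidue (suc (suc z)) s) (sym (ℕₚ.+-suc h h)) (next (proj₂ (go h)))

-- The pair (-1/s), (2/s), which determines an odd s modulo 8. The last clause is meant for s = 1.
residueSigns : ℕ → Sign × Sign
residueSigns 3 = ⊖ , ⊖
residueSigns 5 = ⊕ , ⊖
residueSigns 7 = ⊖ , ⊕
residueSigns _ = ⊕ , ⊕

J-residue : ∀ {a s} → OddResidue a s → (J -1ℤ a , J (+ 2) a) ≡ residueSigns s
J-residue (one k)   = cong₂ _,_ (trans (cong (J -1ℤ) (cong (1 ℕ.+_) (sym (ℕₚ.*-assoc k 2 4)))) (trans (J-minus-one-period {1} (k ℕ.* 2) refl) (J-minus-one 1))) (trans (J-period-* {2} k refl (odd⇒unit-2 {1} refl)) J2-1)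
J-residue (three k) = cong₂ _,_ (trans (cong (J -1ℤ) (cong (3 ℕ.+_) (sym (ℕₚ.*-assoc k 2 4)))) (trans (J-minus-one-period {3} (k ℕ.* 2) refl) (J-minus-one 3))) (trans (J-period-* {2} k refl (odd⇒unit-2 {3} refl)) J2-3)
J-residue (five k)  = cong₂ _,_ (trans (cong (J -1ℤ) (cong (5 ℕ.+_) (sym (ℕₚ.*-assoc k 2 4)))) (trans (J-minus-one-period {5} (k ℕ.* 2) refl) (J-minus-one 5))) (trans (J-period-* {2} k refl (odd⇒unit-2 {5} refl)) J2-5)
J-residue (seven k) = cong₂ _,_ (trans (cong (J -1ℤ) (cong (7 ℕ.+_) (sym (ℕₚ.*-assoc k 2 4)))) (trans (J-minus-one-period {7} (k ℕ.* 2) refl) (J-minus-one 7))) (trans (J-period-* {2} k refl (odd⇒unit-2 {7} refl)) J2-7)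

residue-≈-8 : ∀ {a s} → OddResidue a s → + a ≈ + s [ + 8 ]
residue-≈-8 (one k)   = by (+ k) (cong (_+_ (+ 1)) (ℤₚ.pos-* k 8))
residue-≈-8 (three k) = by (+ k) (cong (_+_ (+ 3)) (ℤₚ.pos-* k 8))
residue-≈-8 (five k)  = by (+ k) (cong (_+_ (+ 5)) (ℤₚ.pos-* k 8))
residue-≈-8 (seven k) = by (+ k) (cong (_+_ (+ 7)) (ℤₚ.pos-* k 8))

residue-square : ∀ {a s} → OddResidue a s → + s * + s ≈ 1ℤ [ + 8 ]
residue-square (one k)   = by (+ 0) refl
residue-square (three k) = by (+ 1) refl
residue-square (five k)  = by (+ 3) refl
residue-square (seven k) = by (+ 6) refl

residue-≡ : ∀ {a b s t} → OddResidue a s → OddResidue b t → residueSigns s ≡ residueSigns t → s ≡ t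
residue-≡ (one _)   (one _)   _ = refl
residue-≡ (three _) (three _) _ = refl
residue-≡ (five _)  (five _)  _ = refl
residue-≡ (seven _) (seven _) _ = refl
residue-≡ (one _) (three _) ()
residue-≡ (one _) (five _) ()
residue-≡ (one _) (seven _) ()
residue-≡ (three _) (one _) ()
residue-≡ (three _) (five _) ()
residue-≡ (three _) (seven _) ()
residue-≡ (five _) (one _) ()
residue-≡ (five _) (three _) ()
residue-≡ (five _) (seven _) ()
residue-≡ (seven _) (one _) ()
residue-≡ (seven _) (three _) ()
residue-≡ (seven _) (five _) ()

residue-from : ∀ {a} s → (∀ k → OddResidue (s ℕ.+ k ℕ.* 8) s) → s ℕ/.% 8 ≡ s → + a ≈ + s [ + 8 ] → OddResidue a s
residue-from {a} s c s% e = subst (λ z → OddResidue z s) (sym (trans (ℕ/.m≡m%n+[m/n]*n a 8) (cong (ℕ._+ a ℕ/./ 8 ℕ.* 8) (trans (rem-cong {+ a} {+ s} 8 e) s%)))) (c (a ℕ/./ 8))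

residue-1 : ∀ {a} → + a ≈ 1ℤ [ + 8 ] → OddResidue a 1
residue-1 = residue-from 1 one refl

same-signs⇒≈1 : ∀ {a b} → Odd a → Odd b → J -1ℤ a ≡ J -1ℤ b → J (+ 2) a ≡ J (+ 2) b → + a * + b ≈ 1ℤ [ + 8 ]
same-signs⇒≈1 oa ob e₁ e₂ with oddResidue oa | oddResidue ob
... | s , ra | t , rb with residue-≡ ra rb (trans (sym (J-residue ra)) (trans (cong₂ _,_ e₁ e₂) (J-residue rb)))
... | refl = ≈-trans (*-cong (residue-≈-8 ra) (residue-≈-8 rb)) (residue-square ra)

SquareFree : ℕ → Set
SquareFree M = ∀ p → Prime p → ¬ (p ℕ.* p ℕ∣.∣ M)

unit-8 : ∀ {n} → Odd n → Unit (+ 8) (+ n)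
unit-8 o = unit-* {+ 2} {+ 4} (odd⇒unit-2 o) (unit-* {+ 2} {+ 2} (odd⇒unit-2 o) (odd⇒unit-2 o))

odd-∣ : ∀ {m n} → m ℕ∣.∣ n → Odd n → Odd m
odd-∣ d o = unit-2⇒odd (unit-sym (unit-∣ (ℤ∣.∣ᵤ⇒∣ d) (odd⇒unit-2 o)))

-- No sign is prescribed at ℓ: this leaves room for witness₀, where χ = J (- N) is -1 although all prescribed characters are trivial.
module Prescribed {P N ℓ M E k t : ℕ} (P≡8ℓM : P ≡ 8 ℕ.* (ℓ ℕ.* M)) (N≡EℓM : N ≡ E ℕ.* (ℓ ℕ.* M)) (pℓ : Prime ℓ) (oℓ : Odd ℓ) (oM : Odd M) (sqf : SquareFree M) (ℓ∤M : ¬ (ℓ ℕ∣.∣ M))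
  (kE : k ℕ.* E ≡ 2) (ot : Odd t) (ut : Unit (+ t) (+ M)) where

  oℓM : Odd (ℓ ℕ.* M)
  oℓM = odd-* oℓ oM

  0<ℓM : 0 ℕ.< ℓ ℕ.* M
  0<ℓM = subst (0 ℕ.<_) (sym oℓM) (s≤s z≤n)

  1<P : 1 ℕ.< P
  1<P = subst (1 ℕ.<_) (sym P≡8ℓM) (ℕₚ.≤-trans (s≤s (s≤s z≤n)) (ℕₚ.*-monoʳ-≤ 8 0<ℓM))

  0<N : 0 ℕ.< N
  0<N = subst (0 ℕ.<_) (sym N≡EℓM) (ℕₚ.*-mono-≤ (positive E kE) 0<ℓM)
    where
    positive : ∀ E → k ℕ.* E ≡ 2 → 0 ℕ.< E
    positive zero e = case trans (sym (ℕₚ.*-zeroʳ k)) e of λ ()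
    positive (suc E) _ = s≤s z≤n

  P≡k4N : P ≡ k ℕ.* (4 ℕ.* N)
  P≡k4N = trans P≡8ℓM (trans (cong (λ z → 4 ℕ.* z ℕ.* (ℓ ℕ.* M)) (sym kE)) (trans (lemma k E (ℓ ℕ.* M)) (cong (λ z → k ℕ.* (4 ℕ.* z)) (sym N≡EℓM))))
    where
    lemma : ∀ k E x → 4 ℕ.* (k ℕ.* E) ℕ.* x ≡ k ℕ.* (4 ℕ.* (E ℕ.* x))
    lemma = ℕSolver.solve-∀

  ∣P : ∀ {x a} → x ℕ∣.∣ P → Unit a (+ P) → Unit a (+ x)
  ∣P d = unit-∣ (ℤ∣.∣ᵤ⇒∣ d)

  8∣P : 8 ℕ∣.∣ P
  8∣P = subst (8 ℕ∣.∣_) (sym P≡8ℓM) (ℕ∣.m∣m*n (ℓ ℕ.* M))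

  2∣P : 2 ℕ∣.∣ P
  2∣P = ℕ∣.∣-trans (ℕ∣.divides 4 refl) 8∣P

  N∣P : N ℕ∣.∣ P
  N∣P = ℕ∣.divides (k ℕ.* 4) (trans P≡k4N (sym (ℕₚ.*-assoc k 4 N)))

  M∣P : M ℕ∣.∣ P
  M∣P = subst (M ℕ∣.∣_) (sym P≡8ℓM) (ℕ∣.∣n⇒∣m*n 8 (ℕ∣.n∣m*n ℓ))

  ℓ∣P : ℓ ℕ∣.∣ P
  ℓ∣P = subst (ℓ ℕ∣.∣_) (sym P≡8ℓM) (ℕ∣.∣n⇒∣m*n 8 (ℕ∣.m∣m*n M))

  unit⇒odd : ∀ {a} → Unit (+ a) (+ P) → Odd a
  unit⇒odd u = unit-2⇒odd (∣P 2∣P u)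

  -- Their periods are 4, 8 and 4N. All of them divide P = 8ℓM, the last because P = k · 4N.
  minusOne two χ : Character P
  minusOne = record
    { val = J -1ℤ
    ; mul = λ ua ub → J-lower-* (unit⇒odd ua) (unit⇒odd ub) (unit-neg unit-1) (unit-neg unit-1)
    ; per = λ {a} ua → trans (cong (λ z → J -1ℤ (a ℕ.+ z)) (trans P≡8ℓM (lemma (ℓ ℕ.* M)))) (J-minus-one-period (ℓ ℕ.* M ℕ.* 2) (unit⇒odd ua))
    }
    where
    lemma : ∀ x → 8 ℕ.* x ≡ x ℕ.* 2 ℕ.* 4
    lemma = ℕSolver.solve-∀
  two = record
    { val = J (+ 2)
    ; mul = λ ua ub → J-lower-* (unit⇒odd ua) (unit⇒odd ub) (odd⇒unit-2 (unit⇒odd ua)) (odd⇒unit-2 (unit⇒odd ub))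
    ; per = λ {a} ua → trans (cong (λ z → J (+ 2) (a ℕ.+ z)) (trans P≡8ℓM (ℕₚ.*-comm 8 (ℓ ℕ.* M)))) (J-period-* (ℓ ℕ.* M) (unit⇒odd ua) (odd⇒unit-2 (unit⇒odd ua)))
    }
  χ = record
    { val = J (- (+ N))
    ; mul = λ ua ub → J-lower-* (unit⇒odd ua) (unit⇒odd ub) (unit-neg (uN ua)) (unit-neg (uN ub))
    ; per = λ {a} ua → trans (J-neg (unit⇒odd (shifted ua)) (uN (shifted ua))) (trans (cong₂ _·_ (per minusOne ua)
        (trans (cong (λ z → J (+ N) (a ℕ.+ z)) P≡k4N) (J-period-* k (unit⇒odd ua) (uN ua)))) (sym (J-neg (unit⇒odd ua) (uN ua))))
    }
    where
    shifted : ∀ {a} → Unit (+ a) (+ P) → Unit (+ (a ℕ.+ P)) (+ P)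
    shifted {a} = unit-≈ (≈-sym (shift-≈ a P))
    uN : ∀ {a} → Unit (+ a) (+ P) → Unit (+ N) (+ a)
    uN u = unit-sym (∣P N∣P u)

  above : ∀ p → Odd p → p ℕ∣.∣ P → Character P
  above p op p∣P = record
    { val = λ a → J (+ a) p
    ; mul = λ {a} {b} ua ub → trans (cong (λ z → J z p) (ℤₚ.pos-* a b)) (J-* op (∣P p∣P ua) (∣P p∣P ub))
    ; per = λ {a} _ → J-≈ op (≈-weaken (ℤ∣.∣ᵤ⇒∣ p∣P) (shift-≈ a P))
    }

  square⇒root : ∀ {q} → Σ[ x ∈ ℤ ] (- (+ N) ≈ x * x [ + q ]) → SquareRoot (+ N) q
  square⇒root (x , s) = x , ≈0⇒∣ (≈-trans (+-cong (≈-sym s) (≈-refl {+ N})) (≈-reflexive (ℤₚ.+-inverseˡ (+ N))))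

  roots : ∀ {q} → Prime q → Unit (+ q) (+ P) → val χ q ≡ ⊕ → SquareRoot (+ N) q
  roots pq uq e = square⇒root (J-⊕⇒square pq (unit⇒odd uq) (unit-neg (unit-sym (∣P N∣P uq))) e)

  splits : ∀ {q} → Prime q → Unit (+ q) (+ P) → (b : ℤ) → - (+ N) ≈ b * b [ + q ] → val χ q ≡ ⊕
  splits {q} pq uq b e = J-square (unit⇒odd uq) (unit-*ˡ {b} {b} (unit-≈ e (unit-neg (unit-sym (∣P N∣P uq))))) e

  -- By the Chinese remainder theorem the nonresidue is visible at p only: to any character whose
  -- modulus divides R it looks like 1.
  nonresidue-at : ∀ {p R} → Prime p → Odd p → P ≡ p ℕ.* R → Unit (+ p) (+ R) →
    Σ[ u ∈ ℕ ] Unit (+ u) (+ P) × J (+ u) p ≡ ⊖ × (+ u ≈ 1ℤ [ + R ])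
  nonresidue-at {p} {R} pp op P≡ upR with J-nonresidue pp op
  ... | n , un , Jn with crt upR n 1ℤ
  ... | x , x≈n , x≈1 = u , subst (Unit (+ u)) (sym P≡') (unit-*-modulus (unit-≈ (≈-sym u≈n) un) (unit-≈ (≈-sym u≈1) unit-1)) , trans (J-≈ op u≈n) Jn , u≈1
    where
    instance
      P≢0 : NonZero P
      P≢0 = ℕ.>-nonZero (ℕₚ.<⇒≤ 1<P)
    P≡' : + P ≡ + p * + R
    P≡' = trans (cong +_ P≡) (ℤₚ.pos-* p R)
    u = x ℤ/.%ℕ P
    u≈n : + u ≈ n [ + p ]
    u≈n = ≈-trans (≈-weaken (ℤ∣.∣ᵤ⇒∣ (subst (p ℕ∣.∣_) (sym P≡) (ℕ∣.m∣m*n R))) (≈-sym (rem-≈ x P))) x≈n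
    u≈1 : + u ≈ 1ℤ [ + R ]
    u≈1 = ≈-trans (≈-weaken (ℤ∣.∣ᵤ⇒∣ (subst (R ℕ∣.∣_) (sym P≡) (ℕ∣.n∣m*n p))) (≈-sym (rem-≈ x P))) x≈1

  data Agrees (a : ℕ) (ps : List ℕ) : Set where
    agrees : J -1ℤ a ≡ J -1ℤ t → J (+ 2) a ≡ J (+ 2) t → All (λ p → J (+ a) p ≡ J (+ t) p) ps → Agrees a ps

  record TwistsFor (ps : List ℕ) : Set where
    field
      twists      : Twists P
      independent : Independent twists
      trivial     : ∀ u → + u ≈ 1ℤ [ + (8 ℕ.* product ps) ] → TrivialAt u twists
      conclusion  : ∀ a → AgreesAt a twists → Agrees a ps

  uℓM : Unit (+ ℓ) (+ M)
  uℓM = ∤⇒unit pℓ ℓ∤M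

  -- The factor `c` holds the primes already taken off the list. The field `trivial` drives the
  -- induction: the witness for p is 1 modulo 8 and modulo the remaining primes, so the twists
  -- collected there ignore it.
  twistsFor : ∀ c ps → All Prime ps → M ≡ c ℕ.* product ps → TwistsFor ps
  twistsFor c [] _ _ = record
    { twists = (minusOne , J -1ℤ t) ∷ (two , J (+ 2) t) ∷ []
    -- P - 1 is 7 modulo 8, where (-1/·) is -1 and (2/·) is 1. The number 4ℓM + 1 is 5 modulo 8,
    -- where (2/·) is -1, and it is prime to P because it is 1 modulo ℓM.
    ; independent = (P ℕ.∸ 1 , u₋ , trans (cong proj₁ (J-residue r₋)) refl , trans (cong proj₂ (J-residue r₋)) refl ∷ []) ∷ (4 ℕ.* (ℓ ℕ.* M) ℕ.+ 1 , u₅ , cong proj₂ (J-residue r₅) , []) ∷ []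
    ; trivial = λ u e → cong proj₁ (J-residue (residue-1 e)) ∷ cong proj₂ (J-residue (residue-1 e)) ∷ []
    ; conclusion = λ { a (e₁ ∷ e₂ ∷ []) → agrees e₁ e₂ [] }
    }
    where
    x = ℓ ℕ.* M
    h = ⌊ x /2⌋
    -1≡ : P ℕ.∸ 1 ≡ 7 ℕ.+ (h ℕ.+ h) ℕ.* 8
    -1≡ = trans (cong (ℕ._∸ 1) P≡8ℓM) (trans (cong (λ z → 8 ℕ.* z ℕ.∸ 1) oℓM) (cong (ℕ._∸ 1) (lemma h)))
      where
      lemma : ∀ h → 8 ℕ.* (1 ℕ.+ (h ℕ.+ h)) ≡ 8 ℕ.+ (h ℕ.+ h) ℕ.* 8
      lemma = ℕSolver.solve-∀
    r₋ : OddResidue (P ℕ.∸ 1) 7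
    r₋ = subst (λ z → OddResidue z 7) (sym -1≡) (seven (h ℕ.+ h))
    P≡suc : P ≡ suc (P ℕ.∸ 1)
    P≡suc = sym (ℕₚ.m+[n∸m]≡n (ℕₚ.<⇒≤ 1<P))
    u₋ : Unit (+ (P ℕ.∸ 1)) (+ P)
    u₋ = unit-≈ (≈-sym (by 1ℤ (trans (lemma (+ (P ℕ.∸ 1))) (cong (λ z → -1ℤ + 1ℤ * z) (cong +_ (sym P≡suc)))))) (unit-neg unit-1)
      where
      lemma : ∀ y → y ≡ -1ℤ + 1ℤ * (1ℤ + y)
      lemma = solve-∀
    r₅ : OddResidue (4 ℕ.* x ℕ.+ 1) 5
    r₅ = subst (λ z → OddResidue z 5) (sym (trans (cong (λ z → 4 ℕ.* z ℕ.+ 1) oℓM) (lemma h))) (five h)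
      where
      lemma : ∀ h → 4 ℕ.* (1 ℕ.+ (h ℕ.+ h)) ℕ.+ 1 ≡ 5 ℕ.+ h ℕ.* 8
      lemma = ℕSolver.solve-∀
    u₅ : Unit (+ (4 ℕ.* x ℕ.+ 1)) (+ P)
    u₅ = subst (Unit (+ (4 ℕ.* x ℕ.+ 1))) (sym (trans (cong +_ P≡8ℓM) (ℤₚ.pos-* 8 x))) (unit-*-modulus {m = + 8} {+ x} (unit-≈ (≈-sym (residue-≈-8 r₅)) (unit (+ 5) (by (+ 3) refl)))
      (unit-≈ (≈-sym (by (+ 4) (trans (cong +_ (ℕₚ.+-comm (4 ℕ.* x) 1)) (cong (_+_ 1ℤ) (ℤₚ.pos-* 4 x))))) unit-1))
  twistsFor c (p ∷ ps) (pp ∷ pps) M≡ = record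
    { twists = (above p op p∣P , J (+ t) p) ∷ twists
    ; independent = (proj₁ w , proj₁ (proj₂ w) , proj₁ (proj₂ (proj₂ w)) , trivial (proj₁ w) (≈-weaken (ℤ∣.∣ᵤ⇒∣ 8ps∣R) (proj₂ (proj₂ (proj₂ w))))) ∷ independent
    ; trivial = λ u e → trans (J-≈ op (≈-weaken (ℤ∣.∣ᵤ⇒∣ (ℕ∣.∣n⇒∣m*n 8 (ℕ∣.m∣m*n (product ps)))) e)) (J-one op) ∷ trivial u (≈-weaken (ℤ∣.∣ᵤ⇒∣ (ℕ∣.*-monoʳ-∣ 8 (ℕ∣.n∣m*n p))) e)
    ; conclusion = λ { a (e ∷ es) → extend e (conclusion a es) }
    }
    where
    open TwistsFor (twistsFor (c ℕ.* p) ps pps (trans M≡ (sym (ℕₚ.*-assoc c p (product ps)))))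
    extend : ∀ {a} → J (+ a) p ≡ J (+ t) p → Agrees a ps → Agrees a (p ∷ ps)
    extend e (agrees e₁ e₂ es) = agrees e₁ e₂ (e ∷ es)
    m' = c ℕ.* product ps
    R = 8 ℕ.* (ℓ ℕ.* m')
    M≡pm' : M ≡ p ℕ.* m'
    M≡pm' = trans M≡ (lemma c p (product ps))
      where
      lemma : ∀ c p x → c ℕ.* (p ℕ.* x) ≡ p ℕ.* (c ℕ.* x)
      lemma = ℕSolver.solve-∀
    p∣M : p ℕ∣.∣ M
    p∣M = subst (p ℕ∣.∣_) (sym M≡pm') (ℕ∣.m∣m*n m')
    p∣P : p ℕ∣.∣ P
    p∣P = ℕ∣.∣-trans p∣M M∣P
    op : Odd p
    op = odd-∣ p∣M oM
    P≡ : P ≡ p ℕ.* R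
    P≡ = trans P≡8ℓM (trans (cong (λ z → 8 ℕ.* (ℓ ℕ.* z)) M≡pm') (lemma ℓ p m'))
      where
      lemma : ∀ ℓ p m → 8 ℕ.* (ℓ ℕ.* (p ℕ.* m)) ≡ p ℕ.* (8 ℕ.* (ℓ ℕ.* m))
      lemma = ℕSolver.solve-∀
    upR : Unit (+ p) (+ R)
    upR = unit-sym (unit-ℕ* {8} (unit-8 op) (unit-ℕ* {ℓ} (unit-∣ (ℤ∣.∣ᵤ⇒∣ p∣M) uℓM)
      (unit-sym (∤⇒unit pp λ p∣m' → sqf p pp (subst (p ℕ.* p ℕ∣.∣_) (sym M≡pm') (ℕ∣.*-monoʳ-∣ p p∣m'))))))
    w = nonresidue-at pp op P≡ upR
    8ps∣R : 8 ℕ.* product ps ℕ∣.∣ R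
    8ps∣R = ℕ∣.*-monoʳ-∣ 8 (ℕ∣.∣n⇒∣m*n ℓ (ℕ∣.n∣m*n c))

  Witness : ℕ → Set
  Witness u = Unit (+ u) (+ P) × J (+ u) ℓ ≡ ⊖ × (+ u ≈ 1ℤ [ + (8 ℕ.* M) ])

  witness₀ : Σ[ u ∈ ℕ ] Witness u
  witness₀ = nonresidue-at pℓ oℓ (trans P≡8ℓM (lemma ℓ M)) (unit-sym (unit-ℕ* {8} (unit-8 oℓ) (unit-sym uℓM)))
    where
    lemma : ∀ ℓ M → 8 ℕ.* (ℓ ℕ.* M) ≡ ℓ ℕ.* (8 ℕ.* M)
    lemma = ℕSolver.solve-∀

  -- As u ≡ 1 modulo 8, the symbols (-1/u) and (E/u) and the sign in reciprocity are trivial. There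
  -- remains (ℓM/u) = (u/ℓ)(u/M) = (u/ℓ) = -1, since u ≡ 1 modulo M.
  χ-witness : ∀ {u} → Witness u → val χ u ≡ ⊖
  χ-witness {u} (uu , Ju , u≈1) = trans (J-neg ou uN) (cong₂ _·_ (cong proj₁ (J-residue r)) (trans (cong (λ z → J z u) (trans (cong +_ N≡EℓM) (ℤₚ.pos-* E (ℓ ℕ.* M)))) (trans (J-* ou uE uℓMu) (cong₂ _·_ (JE k E kE) Jℓ))))
    where
    ou = unit⇒odd uu
    uN : Unit (+ N) (+ u)
    uN = unit-sym (∣P N∣P uu)
    uN' : Unit (+ (E ℕ.* (ℓ ℕ.* M))) (+ u)
    uN' = subst (λ z → Unit (+ z) (+ u)) N≡EℓM uN
    uE : Unit (+ E) (+ u)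
    uE = unit-ℕ*ˡ {E} {ℓ ℕ.* M} uN'
    uℓMu : Unit (+ (ℓ ℕ.* M)) (+ u)
    uℓMu = unit-ℕ*ʳ {E} {ℓ ℕ.* M} uN'
    r : OddResidue u 1
    r = residue-1 (≈-weaken (ℤ∣.∣ᵤ⇒∣ (ℕ∣.m∣m*n M)) u≈1)
    JE : ∀ k E → k ℕ.* E ≡ 2 → J (+ E) u ≡ ⊕
    JE (suc k) zero e = case trans (sym (ℕₚ.*-zeroʳ k)) e of λ ()
    JE (suc k) (suc zero) e = J-one ou
    JE (suc k) (suc (suc zero)) e = cong proj₂ (J-residue r)
    JE (suc k) (suc (suc (suc E))) ()
    par-u : par ⌊ u /2⌋ ≡ ⊕
    par-u = trans (sym (J-minus-one u)) (cong proj₁ (J-residue r))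
    Jℓ : J (+ (ℓ ℕ.* M)) u ≡ ⊖
    Jℓ = trans (sym (J-reciprocity-⊕ ou oℓM (unit-sym uℓMu) par-u)) (trans (J-lower-* oℓ oM (∣P ℓ∣P uu) (∣P M∣P uu))
      (cong₂ _·_ Ju (trans (J-≈ oM (≈-weaken (ℤ∣.∣ᵤ⇒∣ (ℕ∣.n∣m*n 8)) u≈1)) (J-one oM))))

  -- Equal signs make a t equal to 1 modulo 8 and a square modulo each prime factor of M. The roots
  -- are glued by the Chinese remainder theorem, for which M has to be square-free.
  square-mod : ∀ {a} c ps → Unit (+ a) (+ P) → All Prime ps → M ≡ c ℕ.* product ps → Agrees a ps → Σ[ z ∈ ℤ ] + a * + t ≈ z * z [ + (8 ℕ.* product ps) ]
  square-mod c [] ua _ _ (agrees e₁ e₂ _) = 1ℤ , same-signs⇒≈1 (unit⇒odd ua) ot e₁ e₂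
  square-mod {a} c (p ∷ ps) ua (pp ∷ pps) M≡ (agrees e₁ e₂ (e ∷ es)) =
    combine (square-mod (c ℕ.* p) ps ua pps (trans M≡ (sym (ℕₚ.*-assoc c p x))) (agrees e₁ e₂ es))
      (J-⊕⇒square {p} {+ a * + t} pp op (unit-* uap utp) (trans (J-* op uap utp) (trans (cong (_· J (+ t) p) e) (Signₚ.s*s≡+ (J (+ t) p)))))
    where
    x = product ps
    p∣M : p ℕ∣.∣ M
    p∣M = subst (p ℕ∣.∣_) (sym M≡) (ℕ∣.∣n⇒∣m*n c (ℕ∣.m∣m*n x))
    op : Odd p
    op = odd-∣ p∣M oM
    uap : Unit (+ a) (+ p)
    uap = ∣P (ℕ∣.∣-trans p∣M M∣P) ua
    utp : Unit (+ t) (+ p)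
    utp = unit-∣ (ℤ∣.∣ᵤ⇒∣ p∣M) ut
    u : Unit (+ p) (+ (8 ℕ.* x))
    u = unit-sym (unit-ℕ* {8} (unit-8 op) (unit-sym (∤⇒unit pp λ p∣x → sqf p pp (subst (p ℕ.* p ℕ∣.∣_) (sym M≡) (ℕ∣.∣n⇒∣m*n c (ℕ∣.*-monoʳ-∣ p p∣x))))))
    modulus : + p * + (8 ℕ.* x) ≡ + (8 ℕ.* (p ℕ.* x))
    modulus = trans (sym (ℤₚ.pos-* p (8 ℕ.* x))) (cong +_ (lemma p x))
      where
      lemma : ∀ p x → p ℕ.* (8 ℕ.* x) ≡ 8 ℕ.* (p ℕ.* x)
      lemma = ℕSolver.solve-∀
    combine : Σ[ z ∈ ℤ ] + a * + t ≈ z * z [ + (8 ℕ.* x) ] → Σ[ y ∈ ℤ ] + a * + t ≈ y * y [ + p ] → Σ[ w ∈ ℤ ] + a * + t ≈ w * w [ + (8 ℕ.* (p ℕ.* x)) ]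
    combine (z , ez) (y , ey) = glue (crt u y z)
      where
      glue : Σ[ w ∈ ℤ ] (w ≈ y [ + p ]) × (w ≈ z [ + (8 ℕ.* x) ]) → Σ[ w ∈ ℤ ] + a * + t ≈ w * w [ + (8 ℕ.* (p ℕ.* x)) ]
      glue (w , w≈y , w≈z) = w , subst (λ n → + a * + t ≈ w * w [ n ]) modulus (crt-unique u (≈-trans ey (≈-sym (*-cong w≈y w≈y))) (≈-trans ez (≈-sym (*-cong w≈z w≈z))))

  divides-product : ∀ {q qs} → q ∈ qs → q ℕ∣.∣ product qs
  divides-product {qs = q ∷ qs} (here refl) = ℕ∣.m∣m*n (product qs)
  divides-product {qs = q ∷ qs} (there i) = ℕ∣.∣n⇒∣m*n q (divides-product i)

  Result : Set
  Result = Σ[ a ∈ ℕ ] Unit (+ a) (+ P) × SquareRoot (+ N) a × (Σ[ z ∈ ℤ ] + a * + t ≈ z * z [ + (8 ℕ.* M) ])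

  -- A sign-valued character is trivial on g², so `a₀` has the signs prescribed for `a`.
  descend : ∀ {a a₀ g} ps → Unit (+ a) (+ P) → a ≡ a₀ ℕ.* (g ℕ.* g) → M ≡ product ps → Agrees a ps → Unit (+ a₀) (+ P) × Agrees a₀ ps
  descend {a} {a₀} {g} ps ua a≡ M≡ (agrees e₁ e₂ es) = ua₀ , agrees (trans (sym (strip minusOne)) e₁) (trans (sym (strip two)) e₂) (all ps (λ {q} i → subst (q ℕ∣.∣_) (sym M≡) (divides-product i)) es)
    where
    ua' : Unit (+ (a₀ ℕ.* (g ℕ.* g))) (+ P)
    ua' = subst (λ z → Unit (+ z) (+ P)) a≡ ua
    ua₀ : Unit (+ a₀) (+ P)
    ua₀ = unit-ℕ*ˡ {a₀} {g ℕ.* g} ua'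
    ug : Unit (+ g) (+ P)
    ug = unit-ℕ*ˡ {g} {g} (unit-ℕ*ʳ {a₀} {g ℕ.* g} ua')
    strip : ∀ (ψ : Character P) → val ψ a ≡ val ψ a₀
    strip ψ = trans (cong (val ψ) a≡) (trans (mul ψ ua₀ (unit-ℕ* ug ug)) (trans (cong (val ψ a₀ ·_) (trans (mul ψ ug ug) (Signₚ.s*s≡+ (val ψ g)))) (Signₚ.*-identityʳ (val ψ a₀))))
    all : ∀ qs → (∀ {q} → q ∈ qs → q ℕ∣.∣ M) → All (λ p → J (+ a) p ≡ J (+ t) p) qs → All (λ p → J (+ a₀) p ≡ J (+ t) p) qs
    all [] _ [] = []
    all (q ∷ qs) d (e ∷ es) = trans (sym (strip (above q (odd-∣ (d (here refl)) oM) (ℕ∣.∣-trans (d (here refl)) M∣P)))) e ∷ all qs (d ∘ there) es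

  resultFor : ∀ ps → All Prime ps → M ≡ product ps → ∀ {u} → Witness u → Result
  resultFor ps pps M≡ {u} w@(uu , _ , u≈1) = conclude (exists-split 1<P 0<N χ roots splits uu (χ-witness w) independent (trivial u (subst (λ z → + u ≈ 1ℤ [ + (8 ℕ.* z) ]) M≡ u≈1)))
    where
    M≡1* : M ≡ 1 ℕ.* product ps
    M≡1* = trans M≡ (sym (ℕₚ.*-identityˡ (product ps)))
    open TwistsFor (twistsFor 1 ps pps M≡1*)
    conclude : Σ[ a ∈ ℕ ] Unit (+ a) (+ P) × AgreesAt a twists × SquareTimes (+ N) a → Result
    conclude (a , ua , es , a₀ , g , a≡ , root) = finish (descend {a} {a₀} {g} ps ua a≡ M≡ (conclusion a es))
      where
      finish : Unit (+ a₀) (+ P) × Agrees a₀ ps → Result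
      finish (ua₀ , agr) = a₀ , ua₀ , root , subst (λ m → Σ[ z ∈ ℤ ] + a₀ * + t ≈ z * z [ + (8 ℕ.* m) ]) (sym M≡) (square-mod 1 ps ua₀ pps M≡1* agr)

  result : Result
  result = go (factorise M {{ℕ.>-nonZero (subst (0 ℕ.<_) (sym oM) (s≤s z≤n))}})
    where
    go : PrimeFactorisation M → Result
    go record { factors = ps ; isFactorisation = M≡ ; factorsPrime = pps } = resultFor ps pps M≡ (proj₂ witness₀)

-- Reduction of positive ternary forms

record Form : Set where
  constructor form
  field
    A B C R S′ T : ℤ

value : Form → ℤ → ℤ → ℤ → ℤ
value (form A B C R S′ T) x y z = A * x * x + B * y * y + C * z * z + R * y * z + S′ * x * z + T * x * y

-- Half the determinant of the matrix of second derivatives.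
disc : Form → ℤ
disc (form A B C R S′ T) = + 4 * A * B * C + R * S′ * T - A * R * R - B * S′ * S′ - C * T * T

-- 4A · value = (2Ax + Ty + S′z)² + (p y² + 2q yz + r z²)
p-coeff q-coeff r-coeff : Form → ℤ
p-coeff (form A B C R S′ T) = + 4 * A * B - T * T
q-coeff (form A B C R S′ T) = + 2 * A * R - S′ * T
r-coeff (form A B C R S′ T) = + 4 * A * C - S′ * S′

Represented : Form → ℤ → Set
Represented F n = Σ[ x ∈ ℤ ] Σ[ y ∈ ℤ ] Σ[ z ∈ ℤ ] n ≡ value F x y z

pr-identity : ∀ F → p-coeff F * r-coeff F ≡ q-coeff F * q-coeff F + + 4 * Form.A F * disc F
pr-identity (form A B C R S′ T) = lemma A B C R S′ T
  where
  lemma : ∀ A B C R S T → (+ 4 * A * B - T * T) * (+ 4 * A * C - S * S) ≡ (+ 2 * A * R - S * T) * (+ 2 * A * R - S * T) + + 4 * A * (+ 4 * A * B * C + R * S * T - A * R * R - B * S * S - C * T * T)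
  lemma = solve-∀

0≤* : ∀ {a b} → 0ℤ ℤ.≤ a → 0ℤ ℤ.≤ b → 0ℤ ℤ.≤ a * b
0≤* {+ a} {+ b} _ _ = subst (0ℤ ℤ.≤_) (ℤₚ.pos-* a b) (+≤+ z≤n)

0≤+ : ∀ {a b} → 0ℤ ℤ.≤ a → 0ℤ ℤ.≤ b → 0ℤ ℤ.≤ a + b
0≤+ = ℤₚ.+-mono-≤

0<* : ∀ {a b} → 0ℤ ℤ.< a → 0ℤ ℤ.< b → 0ℤ ℤ.< a * b
0<* {+ suc a} {+ suc b} _ _ = +<+ (s≤s z≤n)
0<* {+ zero} (+<+ ()) _
0<* {+ suc a} {+ zero} _ (+<+ ())

0≤² : ∀ a → 0ℤ ℤ.≤ a * a
0≤² (+ a) = 0≤* {+ a} {+ a} (+≤+ z≤n) (+≤+ z≤n)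
0≤² -[1+ a ] = +≤+ z≤n

0<*⇒0< : ∀ {a b} → 0ℤ ℤ.< a → 0ℤ ℤ.< a * b → 0ℤ ℤ.< b
0<*⇒0< {+ suc a} {+ zero} _ lt = ⊥-elim (ℤₚ.<-irrefl refl (subst (0ℤ ℤ.<_) (ℤₚ.*-zeroʳ (+ suc a)) lt))
0<*⇒0< {+ suc a} {+ suc b} _ _ = +<+ (s≤s z≤n)
0<*⇒0< {+ suc a} { -[1+ b ]} _ ()
0<*⇒0< {+ zero} (+<+ ())

abs-< : ∀ {a b} → 0ℤ ℤ.≤ a → a ℤ.< b → ∣ a ∣ ℕ.< ∣ b ∣
abs-< {+ a} {+ b} _ (+<+ lt) = lt

-- Reducing 2q + p modulo 2p and subtracting p gives the residue of 2q of least absolute value.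
nearest : ∀ q p → 0ℤ ℤ.< p → Σ[ k ∈ ℤ ] (- p ℤ.≤ + 2 * (q + k * p)) × (+ 2 * (q + k * p) ℤ.≤ p)
nearest q (+ zero) (+<+ ())
nearest q p@(+ suc n) _ = - Q , subst (- p ℤ.≤_) (sym eq) (subst (ℤ._≤ + m - p) (ℤₚ.+-identityˡ (- p)) (ℤₚ.+-monoˡ-≤ (- p) {0ℤ} {+ m} (+≤+ z≤n))) ,
  subst (ℤ._≤ p) (sym eq) (subst (+ m - p ℤ.≤_) (cancel p) (ℤₚ.+-monoˡ-≤ (- p) {+ m} {p + p} (+≤+ (ℕₚ.<⇒≤ (ℤ/.n%ℕd<d s d)))))
  where
  d = suc n ℕ.+ suc n
  s = + 2 * q + p
  m = s ℤ/.%ℕ d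
  Q = s ℤ/./ℕ d
  cancel : ∀ p → p + p - p ≡ p
  cancel = solve-∀
  lemma : ∀ q k p m → + 2 * q + p ≡ m + k * (p + p) → + 2 * (q + - k * p) ≡ m - p
  lemma q k p m e = trans (step₁ q k p) (trans (cong (λ z → z - p - k * (p + p)) e) (step₂ m k p))
    where
    step₁ : ∀ q k p → + 2 * (q + - k * p) ≡ + 2 * q + p - p - k * (p + p)
    step₁ = solve-∀
    step₂ : ∀ m k p → m + k * (p + p) - p - k * (p + p) ≡ m - p
    step₂ = solve-∀
  eq : + 2 * (q + - Q * p) ≡ + m - p
  eq = lemma q Q p (+ m) (ℤ/.a≡a%ℕn+[a/ℕn]*n s d)

shearYZ shearXY shearXZ : ℤ → Form → Form
shearYZ k (form A B C R S′ T) = form A B (C + k * R + k * k * B) (R + + 2 * k * B) (S′ + k * T) T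
shearXY k (form A B C R S′ T) = form A (B + k * T + k * k * A) C (R + k * S′) S′ (T + + 2 * k * A)
shearXZ k (form A B C R S′ T) = form A B (C + k * S′ + k * k * A) (R + k * T) (S′ + + 2 * k * A) T

swapYZ swapXY : Form → Form
swapYZ (form A B C R S′ T) = form A C B R T S′
swapXY (form A B C R S′ T) = form B A C S′ R T

module _ (Δ n : ℤ) where

  -- For Δ > 0 the first three fields are Sylvester's criterion for a positive form. The last one
  -- carries a representation of n along the changes of variables.
  record Valid (F : Form) : Set where
    constructor valid
    field
      0<A         : 0ℤ ℤ.< Form.A F
      0<p         : 0ℤ ℤ.< p-coeff F
      disc≡       : disc F ≡ Δ
      represented : Represented F n

  open Valid

  shearYZ-valid : ∀ k {F} → Valid F → Valid (shearYZ k F)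
  shearYZ-valid k {form A B C R S′ T} (valid a p d (x , y , z , e)) = valid a p (trans (disc-lemma A B C R S′ T k) d) (x , y - k * z , z , trans e (value-lemma A B C R S′ T k x y z))
    where
    disc-lemma : ∀ A B C R S T k → + 4 * A * B * (C + k * R + k * k * B) + (R + + 2 * k * B) * (S + k * T) * T - A * (R + + 2 * k * B) * (R + + 2 * k * B) - B * (S + k * T) * (S + k * T) - (C + k * R + k * k * B) * T * T
      ≡ + 4 * A * B * C + R * S * T - A * R * R - B * S * S - C * T * T
    disc-lemma = solve-∀
    value-lemma : ∀ A B C R S T k x y z → A * x * x + B * y * y + C * z * z + R * y * z + S * x * z + T * x * y
      ≡ A * x * x + B * (y - k * z) * (y - k * z) + (C + k * R + k * k * B) * z * z + (R + + 2 * k * B) * (y - k * z) * z + (S + k * T) * x * z + T * x * (y - k * z)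
    value-lemma = solve-∀

  shearXY-valid : ∀ k {F} → Valid F → Valid (shearXY k F)
  shearXY-valid k {form A B C R S′ T} (valid a p d (x , y , z , e)) = valid a (subst (0ℤ ℤ.<_) (p-lemma A B T k) p) (trans (disc-lemma A B C R S′ T k) d) (x - k * y , y , z , trans e (value-lemma A B C R S′ T k x y z))
    where
    p-lemma : ∀ A B T k → + 4 * A * B - T * T ≡ + 4 * A * (B + k * T + k * k * A) - (T + + 2 * k * A) * (T + + 2 * k * A)
    p-lemma = solve-∀
    disc-lemma : ∀ A B C R S T k → + 4 * A * (B + k * T + k * k * A) * C + (R + k * S) * S * (T + + 2 * k * A) - A * (R + k * S) * (R + k * S) - (B + k * T + k * k * A) * S * S - C * (T + + 2 * k * A) * (T + + 2 * k * A)
      ≡ + 4 * A * B * C + R * S * T - A * R * R - B * S * S - C * T * T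
    disc-lemma = solve-∀
    value-lemma : ∀ A B C R S T k x y z → A * x * x + B * y * y + C * z * z + R * y * z + S * x * z + T * x * y
      ≡ A * (x - k * y) * (x - k * y) + (B + k * T + k * k * A) * y * y + C * z * z + (R + k * S) * y * z + S * (x - k * y) * z + (T + + 2 * k * A) * (x - k * y) * y
    value-lemma = solve-∀

  swapYZ-valid : ∀ {F} → 0ℤ ℤ.< r-coeff F → Valid F → Valid (swapYZ F)
  swapYZ-valid {form A B C R S′ T} r>0 (valid a p d (x , y , z , e)) = valid a r>0 (trans (disc-lemma A B C R S′ T) d) (x , z , y , trans e (value-lemma A B C R S′ T x y z))
    where
    disc-lemma : ∀ A B C R S T → + 4 * A * C * B + R * T * S - A * R * R - C * T * T - B * S * S ≡ + 4 * A * B * C + R * S * T - A * R * R - B * S * S - C * T * T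
    disc-lemma = solve-∀
    value-lemma : ∀ A B C R S T x y z → A * x * x + B * y * y + C * z * z + R * y * z + S * x * z + T * x * y ≡ A * x * x + C * z * z + B * y * y + R * z * y + T * x * y + S * x * z
    value-lemma = solve-∀

  shearXZ-valid : ∀ k {F} → Valid F → Valid (shearXZ k F)
  shearXZ-valid k {form A B C R S′ T} (valid a p d (x , y , z , e)) = valid a p (trans (disc-lemma A B C R S′ T k) d) (x - k * z , y , z , trans e (value-lemma A B C R S′ T k x y z))
    where
    disc-lemma : ∀ A B C R S T k → + 4 * A * B * (C + k * S + k * k * A) + (R + k * T) * (S + + 2 * k * A) * T - A * (R + k * T) * (R + k * T) - B * (S + + 2 * k * A) * (S + + 2 * k * A) - (C + k * S + k * k * A) * T * T
      ≡ + 4 * A * B * C + R * S * T - A * R * R - B * S * S - C * T * T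
    disc-lemma = solve-∀
    value-lemma : ∀ A B C R S T k x y z → A * x * x + B * y * y + C * z * z + R * y * z + S * x * z + T * x * y
      ≡ A * (x - k * z) * (x - k * z) + B * y * y + (C + k * S + k * k * A) * z * z + (R + k * T) * y * z + (S + + 2 * k * A) * (x - k * z) * z + T * (x - k * z) * y
    value-lemma = solve-∀

  B-positive : ∀ {F} → Valid F → 0ℤ ℤ.< Form.B F
  B-positive {form A B C R S′ T} v = 0<*⇒0< {+ 4 * A} (0<* {+ 4} (+<+ (s≤s z≤n)) (0<A v)) (subst (0ℤ ℤ.<_) (lemma (+ 4 * A * B) T) (ℤₚ.+-mono-<-≤ (0<p v) (0≤² T)))
    where
    lemma : ∀ x t → x - t * t + t * t ≡ x
    lemma = solve-∀

  swapXY-valid : ∀ {F} → Valid F → Valid (swapXY F)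
  swapXY-valid {F@(form A B C R S′ T)} v@(valid a p d (x , y , z , e)) = valid (B-positive {F} v) (subst (0ℤ ℤ.<_) (p-lemma A B T) p) (trans (disc-lemma A B C R S′ T) d) (y , x , z , trans e (value-lemma A B C R S′ T x y z))
    where
    p-lemma : ∀ A B T → + 4 * A * B - T * T ≡ + 4 * B * A - T * T
    p-lemma = solve-∀
    disc-lemma : ∀ A B C R S T → + 4 * B * A * C + S * R * T - B * S * S - A * R * R - C * T * T ≡ + 4 * A * B * C + R * S * T - A * R * R - B * S * S - C * T * T
    disc-lemma = solve-∀
    value-lemma : ∀ A B C R S T x y z → A * x * x + B * y * y + C * z * z + R * y * z + S * x * z + T * x * y ≡ B * y * y + A * x * x + C * z * z + S * x * z + R * y * z + T * y * x
    value-lemma = solve-∀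

  record BinaryReduced (F : Form) : Set where
    constructor binaryReduced
    field
      2q≥-p : - p-coeff F ℤ.≤ + 2 * q-coeff F
      2q≤p  : + 2 * q-coeff F ℤ.≤ p-coeff F
      p≤r   : p-coeff F ℤ.≤ r-coeff F

  open BinaryReduced

  module Reduction (0<Δ : 0ℤ ℤ.< Δ) (Δ≤4 : Δ ℤ.≤ + 4) where

    r-positive : ∀ {F} → Valid F → 0ℤ ℤ.< r-coeff F
    r-positive {F} v = 0<*⇒0< (0<p v) (subst (0ℤ ℤ.<_) (sym (pr-identity F)) (ℤₚ.+-mono-≤-< (0≤² (q-coeff F))
      (0<* {+ 4 * Form.A F} (0<* {+ 4} (+<+ (s≤s z≤n)) (0<A v)) (subst (0ℤ ℤ.<_) (sym (disc≡ v)) 0<Δ))))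

    -- Gauss reduction of the binary form with coefficients p, 2q, r. Changes of y and z leave A
    -- alone, `shearYZ k` adds k p to q, and a swap happens only for r < p, so that p decreases.
    reduceYZ : ∀ F → Acc ℕ._<_ ∣ p-coeff F ∣ → Valid F → Σ[ G ∈ Form ] Form.A G ≡ Form.A F × Valid G × BinaryReduced G
    reduceYZ F@(form A B C R S′ T) (acc rec) v with nearest (q-coeff F) (p-coeff F) (0<p v)
    ... | k , lo , hi with p-coeff F ℤ.≤? r-coeff (shearYZ k F)
    ...   | yes p≤r = shearYZ k F , refl , shearYZ-valid k v , binaryReduced (subst (- p-coeff F ℤ.≤_) (cong (_*_ (+ 2)) q≡) lo) (subst (ℤ._≤ p-coeff F) (cong (_*_ (+ 2)) q≡) hi) p≤r
      where
      lemma : ∀ A B R S T k → + 2 * A * R - S * T + k * (+ 4 * A * B - T * T) ≡ + 2 * A * (R + + 2 * k * B) - (S + k * T) * T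
      lemma = solve-∀
      q≡ : q-coeff F + k * p-coeff F ≡ q-coeff (shearYZ k F)
      q≡ = lemma A B R S′ T k
    ...   | no p≰r = reduceYZ (swapYZ (shearYZ k F)) (rec (abs-< (ℤₚ.<⇒≤ r>0) (ℤₚ.≰⇒> p≰r))) (swapYZ-valid {shearYZ k F} r>0 (shearYZ-valid k v))
      where
      r>0 = r-positive {shearYZ k F} (shearYZ-valid k v)

    -- From p ≤ r and |2q| ≤ p one has 4(p r - q²) ≥ 3p², and p r - q² = 4AΔ by `pr-identity`.
    binary-≤ : ∀ {F} → Valid F → BinaryReduced F → 0ℤ ℤ.≤ + 16 * Form.A F * Δ - + 3 * (p-coeff F * p-coeff F)
    binary-≤ {F} v b = subst (0ℤ ℤ.≤_) (trans (lemma₁ p q r) (trans (cong (λ z → + 4 * (z - q * q) - + 3 * (p * p)) (pr-identity F)) (trans (cong (λ z → + 4 * (q * q + + 4 * A * z - q * q) - + 3 * (p * p)) (disc≡ v)) (lemma₂ A Δ p q))))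
      (0≤+ {+ 4 * p * (r - p)} (0≤* {+ 4 * p} (0≤* {+ 4} (+≤+ z≤n) (ℤₚ.<⇒≤ (0<p v))) (ℤₚ.i≤j⇒0≤j-i (p≤r b))) (0≤* {p - + 2 * q} (ℤₚ.i≤j⇒0≤j-i (2q≤p b)) (subst (0ℤ ℤ.≤_) (lemma₃ p q) (ℤₚ.i≤j⇒0≤j-i (2q≥-p b)))))
      where
      A = Form.A F
      p = p-coeff F
      q = q-coeff F
      r = r-coeff F
      lemma₁ : ∀ p q r → + 4 * p * (r - p) + (p - + 2 * q) * (p + + 2 * q) ≡ + 4 * (p * r - q * q) - + 3 * (p * p)
      lemma₁ = solve-∀
      lemma₂ : ∀ A Δ p q → + 4 * (q * q + + 4 * A * Δ - q * q) - + 3 * (p * p) ≡ + 16 * A * Δ - + 3 * (p * p)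
      lemma₂ = solve-∀
      lemma₃ : ∀ p q → + 2 * q - - p ≡ p + + 2 * q
      lemma₃ = solve-∀

    -- Hermite's bound on the minimum: 27 A⁴ ≤ 3p² ≤ 16 A Δ ≤ 64 A.
    A-small : ∀ {F} → Valid F → BinaryReduced F → - Form.A F ℤ.≤ Form.T F → Form.T F ℤ.≤ Form.A F → Form.A F ℤ.≤ Form.B F → Form.A F ≡ 1ℤ
    A-small {F@(form A B C R S′ T)} v b lo hi A≤B = only-one A (0<A v) (subst (0ℤ ℤ.≤_) (lemma₄ A Δ p)
        (0≤+ (0≤+ {+ 16 * A * (+ 4 - Δ)} (0≤* {+ 16 * A} (0≤* {+ 16} (+≤+ z≤n) 0≤A) (ℤₚ.i≤j⇒0≤j-i Δ≤4)) (binary-≤ {F} v b)) (0≤* {+ 3 * (p - + 3 * A * A)} (0≤* {+ 3} (+≤+ z≤n) p≥3A²)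
          (0≤+ (ℤₚ.<⇒≤ (0<p v)) (0≤* {+ 3 * A} (0≤* {+ 3} (+≤+ z≤n) 0≤A) 0≤A)))))
      where
      p = p-coeff F
      0≤A = ℤₚ.<⇒≤ (0<A v)
      lemma₁ : ∀ A B T → + 4 * A * (B - A) + (A - T) * (T - - A) ≡ + 4 * A * B - T * T - + 3 * A * A
      lemma₁ = solve-∀
      p≥3A² : 0ℤ ℤ.≤ p - + 3 * A * A
      p≥3A² = subst (0ℤ ℤ.≤_) (lemma₁ A B T) (0≤+ {+ 4 * A * (B - A)} (0≤* {+ 4 * A} (0≤* {+ 4} (+≤+ z≤n) 0≤A) (ℤₚ.i≤j⇒0≤j-i A≤B)) (0≤* (ℤₚ.i≤j⇒0≤j-i hi) (ℤₚ.i≤j⇒0≤j-i lo)))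
      lemma₄ : ∀ A Δ p → + 16 * A * (+ 4 - Δ) + (+ 16 * A * Δ - + 3 * (p * p)) + + 3 * (p - + 3 * A * A) * (p + + 3 * A * A) ≡ + 64 * A - + 27 * A * A * A * A
      lemma₄ = solve-∀
      lemma₅ : ∀ t → - (+ 64 * (+ 2 + t) - + 27 * (+ 2 + t) * (+ 2 + t) * (+ 2 + t) * (+ 2 + t)) ≡ + 304 + (+ 800 * t + (+ 648 * t * t + (+ 216 * t * t * t + + 27 * t * t * t * t)))
      lemma₅ = solve-∀
      too-big : ∀ A t → A ≡ + 2 + t → 0ℤ ℤ.≤ t → 0ℤ ℤ.≤ + 64 * A - + 27 * A * A * A * A → ⊥
      too-big .(+ 2 + t) t refl 0≤t le = ℤₚ.<⇒≱ (ℤₚ.+-mono-<-≤ {0ℤ} {+ 304} {0ℤ} (+<+ (s≤s z≤n)) rest) (subst (ℤ._≤ 0ℤ) (lemma₅ t) (ℤₚ.neg-mono-≤ le))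
        where
        0≤c : ∀ c → 0ℤ ℤ.≤ + c * t
        0≤c c = 0≤* {+ c} (+≤+ z≤n) 0≤t
        rest : 0ℤ ℤ.≤ + 800 * t + (+ 648 * t * t + (+ 216 * t * t * t + + 27 * t * t * t * t))
        rest = 0≤+ (0≤c 800) (0≤+ (0≤* {+ 648 * t} (0≤c 648) 0≤t) (0≤+ (0≤* {+ 216 * t * t} (0≤* {+ 216 * t} (0≤c 216) 0≤t) 0≤t)
          (0≤* {+ 27 * t * t * t} (0≤* {+ 27 * t * t} (0≤* {+ 27 * t} (0≤c 27) 0≤t) 0≤t) 0≤t)))
      only-one : ∀ A → 0ℤ ℤ.< A → 0ℤ ℤ.≤ + 64 * A - + 27 * A * A * A * A → A ≡ 1ℤ
      only-one (+ zero) (+<+ ()) _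
      only-one (+ suc zero) _ _ = refl
      only-one A@(+ suc (suc m)) _ le = ⊥-elim (too-big A (+ m) refl (+≤+ z≤n) le)

    -- The coefficients p, q, r arise by completing the square in x, so replacing x by x - k y does
    -- not affect them.
    shearXY-reduced : ∀ k {F} → BinaryReduced F → BinaryReduced (shearXY k F)
    shearXY-reduced k {form A B C R S′ T} (binaryReduced lo hi le) = binaryReduced (subst₂ (λ p q → - p ℤ.≤ + 2 * q) p≡ q≡ lo) (subst₂ (λ p q → + 2 * q ℤ.≤ p) p≡ q≡ hi) (subst (ℤ._≤ + 4 * A * C - S′ * S′) p≡ le)
      where
      p-lemma : ∀ A B T k → + 4 * A * B - T * T ≡ + 4 * A * (B + k * T + k * k * A) - (T + + 2 * k * A) * (T + + 2 * k * A)
      p-lemma = solve-∀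
      q-lemma : ∀ A R S T k → + 2 * A * R - S * T ≡ + 2 * A * (R + k * S) - S * (T + + 2 * k * A)
      q-lemma = solve-∀
      p≡ = p-lemma A B T k
      q≡ = q-lemma A R S′ T k

    shearXZ-reduced : ∀ k {F} → BinaryReduced F → BinaryReduced (shearXZ k F)
    shearXZ-reduced k {form A B C R S′ T} (binaryReduced lo hi le) = binaryReduced (subst (λ q → - (+ 4 * A * B - T * T) ℤ.≤ + 2 * q) q≡ lo) (subst (λ q → + 2 * q ℤ.≤ + 4 * A * B - T * T) q≡ hi) (subst (+ 4 * A * B - T * T ℤ.≤_) (r-lemma A C S′ k) le)
      where
      r-lemma : ∀ A C S k → + 4 * A * C - S * S ≡ + 4 * A * (C + k * S + k * k * A) - (S + + 2 * k * A) * (S + + 2 * k * A)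
      r-lemma = solve-∀
      q-lemma : ∀ A R S T k → + 2 * A * R - S * T ≡ + 2 * A * (R + k * T) - (S + + 2 * k * A) * T
      q-lemma = solve-∀
      q≡ = q-lemma A R S′ T k

    -- Gauss reduction in (y, z) alternates with a shear in (x, y). If then B < A, exchanging x and
    -- y lowers A; if not, Hermite's bound gives A = 1.
    reduceMin : ∀ F → Acc ℕ._<_ ∣ Form.A F ∣ → Valid F → Σ[ G ∈ Form ] Form.A G ≡ 1ℤ × Valid G × BinaryReduced G
    reduceMin F (acc rec) v with reduceYZ F (<-wellFounded ∣ p-coeff F ∣) v
    ... | G@(form A B C R S′ T) , A≡ , vG , bG with nearest T (+ 2 * A) (0<* {+ 2} (+<+ (s≤s z≤n)) (0<A vG))
    ... | k , lo , hi with A ℤ.≤? Form.B (shearXY k G)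
    ...   | yes A≤B = shearXY k G , A-small {shearXY k G} vH (shearXY-reduced k bG) (halve₁ A T k lo) (halve₂ A T k hi) A≤B , vH , shearXY-reduced k bG
      where
      vH = shearXY-valid k vG
      double : ∀ A T k → + 2 * (T + + 2 * k * A) ≡ + 2 * (T + k * (+ 2 * A))
      double = solve-∀
      halve₂ : ∀ A T k → + 2 * (T + k * (+ 2 * A)) ℤ.≤ + 2 * A → T + + 2 * k * A ℤ.≤ A
      halve₂ A T k le = ℤₚ.*-cancelˡ-≤-pos (T + + 2 * k * A) A (+ 2) (subst (ℤ._≤ + 2 * A) (sym (double A T k)) le)
      halve₁ : ∀ A T k → - (+ 2 * A) ℤ.≤ + 2 * (T + k * (+ 2 * A)) → - A ℤ.≤ T + + 2 * k * A
      halve₁ A T k le = ℤₚ.*-cancelˡ-≤-pos (- A) (T + + 2 * k * A) (+ 2) (subst₂ ℤ._≤_ (ℤₚ.neg-distribʳ-* (+ 2) A) (sym (double A T k)) le)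
    ...   | no A≰B = reduceMin (swapXY H) (rec (subst (∣ Form.B H ∣ ℕ.<_) (cong ∣_∣ A≡) (abs-< (ℤₚ.<⇒≤ (B-positive {H} vH)) (ℤₚ.≰⇒> A≰B)))) (swapXY-valid {H} vH)
      where
      H = shearXY k G
      vH = shearXY-valid k vG

    data Bit : ℤ → Set where
      0b : Bit 0ℤ
      1b : Bit 1ℤ

    bit : ∀ x → Σ[ k ∈ ℤ ] Bit (x + + 2 * k * 1ℤ)
    bit x with x ℤ/.%ℕ 2 in eq | ℤ/.n%ℕd<d x 2
    ... | zero | _ = - (x ℤ/./ℕ 2) , subst Bit (trans (lemma 0ℤ (x ℤ/./ℕ 2)) (cong (λ z → z + + 2 * - (x ℤ/./ℕ 2) * 1ℤ) (trans (cong (λ m → + m + x ℤ/./ℕ 2 * + 2) (sym eq)) (sym (ℤ/.a≡a%ℕn+[a/ℕn]*n x 2))))) 0b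
      where
      lemma : ∀ m k → m ≡ m + k * + 2 + + 2 * - k * 1ℤ
      lemma = solve-∀
    ... | suc zero | _ = - (x ℤ/./ℕ 2) , subst Bit (trans (lemma 1ℤ (x ℤ/./ℕ 2)) (cong (λ z → z + + 2 * - (x ℤ/./ℕ 2) * 1ℤ) (trans (cong (λ m → + m + x ℤ/./ℕ 2 * + 2) (sym eq)) (sym (ℤ/.a≡a%ℕn+[a/ℕn]*n x 2))))) 1b
      where
      lemma : ∀ m k → m ≡ m + k * + 2 + + 2 * - k * 1ℤ
      lemma = solve-∀
    ... | suc (suc _) | s≤s (s≤s ())

    data Normalised : Set where
      normalised : ∀ {B C R S′ T} → Bit S′ → Bit T → Valid (form 1ℤ B C R S′ T) → BinaryReduced (form 1ℤ B C R S′ T) → Normalised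

    normalise : ∀ {F} → Valid F → Normalised
    normalise {F} v with reduceMin F (<-wellFounded ∣ Form.A F ∣) v
    ... | form .1ℤ B C R S′ T , refl , vG , bG = normalised (proj₂ (bit S′)) (proj₂ (bit T))
      (shearXZ-valid (proj₁ (bit S′)) (shearXY-valid (proj₁ (bit T)) vG))
      (shearXZ-reduced (proj₁ (bit S′)) (shearXY-reduced (proj₁ (bit T)) bG))

-- The classes of discriminant 3 and 4, and forms with a prescribed leading coefficient

quotient-of : ∀ c .{{_ : NonZero c}} q {x} → + c * x ≡ + (c ℕ.* q) → x ≡ + q
quotient-of c@(suc _) q {x} e = ℤₚ.*-cancelˡ-≡ (+ c) x (+ q) (trans e (ℤₚ.pos-* c q))

no-quotient : ∀ c k → ¬ (c ℕ∣.∣ k) → ∀ {x} → + c * x ≡ + k → ⊥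
no-quotient c k ∤ {x} e = ∤ (ℤ∣.∣⇒∣ᵤ {+ c} {+ k} (divides x (trans (sym e) (ℤₚ.*-comm (+ c) x))))

data Trit : ℤ → Set where
  -1t : Trit -1ℤ
  0t  : Trit 0ℤ
  1t  : Trit 1ℤ

trit : ∀ {x} → - (+ 2) ℤ.< x → x ℤ.< + 2 → Trit x
trit {+ 0} _ _ = 0t
trit {+ 1} _ _ = 1t
trit {+ suc (suc n)} _ (+<+ (s≤s (s≤s ())))
trit { -[1+ 0 ]} _ _ = -1t
trit { -[1+ suc n ]} (ℤ.-<- (s≤s ())) _

only-1 : ∀ {x} → 0ℤ ℤ.< x → x ℤ.< + 2 → x ≡ 1ℤ
only-1 {+ 0} (+<+ ()) _
only-1 {+ 1} _ _ = refl
only-1 {+ suc (suc n)} _ (+<+ (s≤s (s≤s ())))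

squares₃ : Form
squares₃ = form 1ℤ 1ℤ 1ℤ 0ℤ 0ℤ 0ℤ

eisenstein₁ : Form
eisenstein₁ = form 1ℤ 1ℤ 1ℤ 0ℤ 0ℤ 1ℤ

module _ (n : ℤ) where

  module Classification (Δ : ℤ) (0<Δ : 0ℤ ℤ.< Δ) (Δ≤4 : Δ ℤ.≤ + 4) where

    open Reduction Δ n 0<Δ Δ≤4
    open Valid
    open BinaryReduced

    p≤4 : ∀ {F} → Form.A F ≡ 1ℤ → Valid Δ n F → BinaryReduced Δ n F → p-coeff F ℤ.≤ + 4
    p≤4 {F} A≡1 v b = bound (p-coeff F) (subst (0ℤ ℤ.≤_) (lemma Δ (p-coeff F)) (0≤+ {+ 16 * (+ 4 - Δ)} (0≤* {+ 16} (+≤+ z≤n) (ℤₚ.i≤j⇒0≤j-i Δ≤4)) (subst (λ A → 0ℤ ℤ.≤ + 16 * A * Δ - + 3 * (p-coeff F * p-coeff F)) A≡1 (binary-≤ {F} v b))))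
      where
      lemma : ∀ Δ p → + 16 * (+ 4 - Δ) + (+ 16 * 1ℤ * Δ - + 3 * (p * p)) ≡ + 64 - + 3 * (p * p)
      lemma = solve-∀
      expand : ∀ t → - (+ 64 - + 3 * ((+ 5 + t) * (+ 5 + t))) ≡ + 11 + (+ 30 * t + + 3 * t * t)
      expand = solve-∀
      too-big : ∀ p t → p ≡ + 5 + t → 0ℤ ℤ.≤ t → 0ℤ ℤ.≤ + 64 - + 3 * (p * p) → ⊥
      too-big .(+ 5 + t) t refl 0≤t le = ℤₚ.<⇒≱ (ℤₚ.+-mono-<-≤ {0ℤ} {+ 11} {0ℤ} (+<+ (s≤s z≤n)) (0≤+ {+ 30 * t} (0≤* {+ 30} (+≤+ z≤n) 0≤t) (0≤* {+ 3 * t} (0≤* {+ 3} (+≤+ z≤n) 0≤t) 0≤t)))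
        (subst (ℤ._≤ 0ℤ) (expand t) (ℤₚ.neg-mono-≤ le))
      bound : ∀ p → 0ℤ ℤ.≤ + 64 - + 3 * (p * p) → p ℤ.≤ + 4
      bound p le with p ℤ.≤? + 4
      ... | yes p≤ = p≤
      ... | no p≰ = ⊥-elim (too-big p (p - + 5) (rearrange p) (ℤₚ.i≤j⇒0≤j-i (ℤₚ.i<j⇒suc[i]≤j (ℤₚ.≰⇒> p≰))) le)
        where
        rearrange : ∀ p → p ≡ + 5 + (p - + 5)
        rearrange = solve-∀

    C-equation₀ : ∀ {C R S′} → disc (form 1ℤ 1ℤ C R S′ 0ℤ) ≡ Δ → + 4 * C ≡ Δ + R * R + S′ * S′
    C-equation₀ {C} {R} {S′} e = trans (lemma C R S′) (cong (λ d → d + R * R + S′ * S′) e)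
      where
      lemma : ∀ C R S → + 4 * C ≡ + 4 * 1ℤ * 1ℤ * C + R * S * 0ℤ - 1ℤ * R * R - 1ℤ * S * S - C * 0ℤ * 0ℤ + R * R + S * S
      lemma = solve-∀

    C-equation₁ : ∀ {C R S′} → disc (form 1ℤ 1ℤ C R S′ 1ℤ) ≡ Δ → + 3 * C ≡ Δ + R * R + S′ * S′ - R * S′
    C-equation₁ {C} {R} {S′} e = trans (lemma C R S′) (cong (λ d → d + R * R + S′ * S′ - R * S′) e)
      where
      lemma : ∀ C R S → + 3 * C ≡ + 4 * 1ℤ * 1ℤ * C + R * S * 1ℤ - 1ℤ * R * R - 1ℤ * S * S - C * 1ℤ * 1ℤ + R * R + S * S - R * S
      lemma = solve-∀

    -- There are twelve choices of R, S′, T; in each the discriminant determines C or, by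
    -- divisibility, excludes the case. The lower bound for 2q is kept because in discriminant 3 the
    -- choice R = -1, S′ = T = 1 would allow C = 2.
    data Classified : Set where
      classified : ∀ {C R S′ T} → Trit R → Bit S′ → Bit T → - (+ 4) ℤ.≤ + 2 * (+ 2 * 1ℤ * R - S′ * T) → disc (form 1ℤ 1ℤ C R S′ T) ≡ Δ → Represented (form 1ℤ 1ℤ C R S′ T) n → Classified

    bit² : ∀ {x} → Bit x → x * x ℤ.≤ 1ℤ
    bit² 0b = +≤+ z≤n
    bit² 1b = ℤₚ.≤-refl

    bit*bit : ∀ {x y} → Bit x → Bit y → (0ℤ ℤ.≤ x * y) × (x * y ℤ.≤ 1ℤ)
    bit*bit 0b _ = +≤+ z≤n , +≤+ z≤n
    bit*bit 1b 0b = +≤+ z≤n , +≤+ z≤n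
    bit*bit 1b 1b = +≤+ z≤n , ℤₚ.≤-refl

    classify : ∀ {F} → Valid Δ n F → Classified
    classify v with normalise v
    ... | normalised {B} {C} {R} {S′} {T} s t vF bF = go (only-1 (B-positive Δ n {F} vF) B<2)
      where
      F = form 1ℤ B C R S′ T
      p = p-coeff F
      q = q-coeff F
      p≤ : p ℤ.≤ + 4
      p≤ = p≤4 {F} refl vF bF
      B<2 : B ℤ.< + 2
      B<2 = ℤₚ.*-cancelˡ-<-nonNeg (+ 4) (ℤₚ.≤-<-trans (subst (ℤ._≤ + 5) (lemma B T) (ℤₚ.+-mono-≤ p≤ (bit² t))) (+<+ (s≤s (s≤s (s≤s (s≤s (s≤s (s≤s z≤n))))))))
        where
        lemma : ∀ B T → + 4 * 1ℤ * B - T * T + T * T ≡ + 4 * B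
        lemma = solve-∀
      lower : - (+ 4) ℤ.≤ + 2 * q
      lower = ℤₚ.≤-trans (ℤₚ.neg-mono-≤ p≤) (2q≥-p bF)
      lemma : ∀ R s → + 2 * (+ 2 * 1ℤ * R - s) + + 2 * s ≡ + 4 * R
      lemma = solve-∀
      R<2 : R ℤ.< + 2
      R<2 = ℤₚ.*-cancelˡ-<-nonNeg (+ 4) (ℤₚ.≤-<-trans (subst (ℤ._≤ + 6) (lemma R (S′ * T)) (ℤₚ.+-mono-≤ (ℤₚ.≤-trans (2q≤p bF) p≤) (ℤₚ.*-monoˡ-≤-nonNeg (+ 2) (proj₂ (bit*bit s t))))) (+<+ (s≤s (s≤s (s≤s (s≤s (s≤s (s≤s (s≤s z≤n)))))))))
      -2<R : - (+ 2) ℤ.< R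
      -2<R = ℤₚ.*-cancelˡ-<-nonNeg (+ 4) (ℤₚ.<-≤-trans (ℤ.-<- (s≤s (s≤s (s≤s (s≤s z≤n))))) (subst (- (+ 4) ℤ.≤_) (lemma R (S′ * T)) (ℤₚ.+-mono-≤ lower (ℤₚ.*-monoˡ-≤-nonNeg (+ 2) (proj₁ (bit*bit s t))))))
      go : B ≡ 1ℤ → Classified
      go refl = classified {C} {R} {S′} {T} (trit -2<R R<2) s t lower (disc≡ vF) (represented vF)

  -- In the four surviving cases C = 1 and exactly one cross term is present, with coefficient ±1.
  -- They differ from `eisenstein₁` by a permutation of the variables and a sign.
  represented-by-eisenstein : ∀ {F} → Valid (+ 3) n F → Represented eisenstein₁ n
  represented-by-eisenstein v = go (classify v)
    where
    open Classification (+ 3) (+<+ (s≤s z≤n)) (+≤+ (s≤s (s≤s (s≤s z≤n))))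
    open Reduction (+ 3) n (+<+ (s≤s z≤n)) (+≤+ (s≤s (s≤s (s≤s z≤n)))) using (0b; 1b)
    permute1 : ∀ x y z → 1ℤ * x * x + 1ℤ * y * y + 1ℤ * z * z + -1ℤ * y * z + 0ℤ * x * z + 0ℤ * x * y ≡ 1ℤ * y * y + 1ℤ * (- z) * (- z) + 1ℤ * x * x + 0ℤ * (- z) * x + 0ℤ * y * x + 1ℤ * y * (- z)
    permute1 = solve-∀
    permute2 : ∀ x y z → 1ℤ * x * x + 1ℤ * y * y + 1ℤ * z * z + 1ℤ * y * z + 0ℤ * x * z + 0ℤ * x * y ≡ 1ℤ * y * y + 1ℤ * z * z + 1ℤ * x * x + 0ℤ * z * x + 0ℤ * y * x + 1ℤ * y * z
    permute2 = solve-∀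
    permute3 : ∀ x y z → 1ℤ * x * x + 1ℤ * y * y + 1ℤ * z * z + 0ℤ * y * z + 1ℤ * x * z + 0ℤ * x * y ≡ 1ℤ * x * x + 1ℤ * z * z + 1ℤ * y * y + 0ℤ * z * y + 0ℤ * x * y + 1ℤ * x * z
    permute3 = solve-∀
    permute4 : ∀ x y z → 1ℤ * x * x + 1ℤ * y * y + 1ℤ * z * z + 0ℤ * y * z + 0ℤ * x * z + 1ℤ * x * y ≡ 1ℤ * x * x + 1ℤ * y * y + 1ℤ * z * z + 0ℤ * y * z + 0ℤ * x * z + 1ℤ * x * y
    permute4 = solve-∀
    go : Classified → Represented eisenstein₁ n
    go (classified {C} -1t 0b 0b _ d rep) with quotient-of 4 1 (C-equation₀ {C} { -1ℤ} {0ℤ} d)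
    ... | refl with rep
    ... | x , y , z , e = y , - z , x , trans e (permute1 x y z)
    go (classified {C} 0t 0b 0b _ d _) = ⊥-elim (no-quotient 4 3 (from-no (4 ℕ∣.∣? 3)) (C-equation₀ {C} {0ℤ} {0ℤ} d))
    go (classified {C} 1t 0b 0b _ d rep) with quotient-of 4 1 (C-equation₀ {C} {1ℤ} {0ℤ} d)
    ... | refl with rep
    ... | x , y , z , e = y , z , x , trans e (permute2 x y z)
    go (classified {C} -1t 1b 0b _ d _) = ⊥-elim (no-quotient 4 5 (from-no (4 ℕ∣.∣? 5)) (C-equation₀ {C} { -1ℤ} {1ℤ} d))
    go (classified {C} 0t 1b 0b _ d rep) with quotient-of 4 1 (C-equation₀ {C} {0ℤ} {1ℤ} d)
    ... | refl with rep
    ... | x , y , z , e = x , z , y , trans e (permute3 x y z)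
    go (classified {C} 1t 1b 0b _ d _) = ⊥-elim (no-quotient 4 5 (from-no (4 ℕ∣.∣? 5)) (C-equation₀ {C} {1ℤ} {1ℤ} d))
    go (classified {C} -1t 0b 1b _ d _) = ⊥-elim (no-quotient 3 4 (from-no (3 ℕ∣.∣? 4)) (C-equation₁ {C} { -1ℤ} {0ℤ} d))
    go (classified {C} 0t 0b 1b _ d rep) with quotient-of 3 1 (C-equation₁ {C} {0ℤ} {0ℤ} d)
    ... | refl with rep
    ... | x , y , z , e = x , y , z , trans e (permute4 x y z)
    go (classified {C} 1t 0b 1b _ d _) = ⊥-elim (no-quotient 3 4 (from-no (3 ℕ∣.∣? 4)) (C-equation₁ {C} {1ℤ} {0ℤ} d))
    go (classified -1t 1b 1b (ℤ.-≤- (s≤s (s≤s (s≤s ())))) _ _)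
    go (classified {C} 0t 1b 1b _ d _) = ⊥-elim (no-quotient 3 4 (from-no (3 ℕ∣.∣? 4)) (C-equation₁ {C} {0ℤ} {1ℤ} d))
    go (classified {C} 1t 1b 1b _ d _) = ⊥-elim (no-quotient 3 4 (from-no (3 ℕ∣.∣? 4)) (C-equation₁ {C} {1ℤ} {1ℤ} d))

  represented-by-squares : ∀ {F} → Valid (+ 4) n F → Represented squares₃ n
  represented-by-squares v = go (classify v)
    where
    open Classification (+ 4) (+<+ (s≤s z≤n)) (ℤₚ.≤-refl)
    open Reduction (+ 4) n (+<+ (s≤s z≤n)) (ℤₚ.≤-refl) using (0b; 1b)
    permute1 : ∀ x y z → 1ℤ * x * x + 1ℤ * y * y + 1ℤ * z * z + 0ℤ * y * z + 0ℤ * x * z + 0ℤ * x * y ≡ 1ℤ * x * x + 1ℤ * y * y + 1ℤ * z * z + 0ℤ * y * z + 0ℤ * x * z + 0ℤ * x * y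
    permute1 = solve-∀
    go : Classified → Represented squares₃ n
    go (classified {C} -1t 0b 0b _ d _) = ⊥-elim (no-quotient 4 5 (from-no (4 ℕ∣.∣? 5)) (C-equation₀ {C} { -1ℤ} {0ℤ} d))
    go (classified {C} 0t 0b 0b _ d rep) with quotient-of 4 1 (C-equation₀ {C} {0ℤ} {0ℤ} d)
    ... | refl with rep
    ... | x , y , z , e = x , y , z , trans e (permute1 x y z)
    go (classified {C} 1t 0b 0b _ d _) = ⊥-elim (no-quotient 4 5 (from-no (4 ℕ∣.∣? 5)) (C-equation₀ {C} {1ℤ} {0ℤ} d))
    go (classified {C} -1t 1b 0b _ d _) = ⊥-elim (no-quotient 4 6 (from-no (4 ℕ∣.∣? 6)) (C-equation₀ {C} { -1ℤ} {1ℤ} d))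
    go (classified {C} 0t 1b 0b _ d _) = ⊥-elim (no-quotient 4 5 (from-no (4 ℕ∣.∣? 5)) (C-equation₀ {C} {0ℤ} {1ℤ} d))
    go (classified {C} 1t 1b 0b _ d _) = ⊥-elim (no-quotient 4 6 (from-no (4 ℕ∣.∣? 6)) (C-equation₀ {C} {1ℤ} {1ℤ} d))
    go (classified {C} -1t 0b 1b _ d _) = ⊥-elim (no-quotient 3 5 (from-no (3 ℕ∣.∣? 5)) (C-equation₁ {C} { -1ℤ} {0ℤ} d))
    go (classified {C} 0t 0b 1b _ d _) = ⊥-elim (no-quotient 3 4 (from-no (3 ℕ∣.∣? 4)) (C-equation₁ {C} {0ℤ} {0ℤ} d))
    go (classified {C} 1t 0b 1b _ d _) = ⊥-elim (no-quotient 3 5 (from-no (3 ℕ∣.∣? 5)) (C-equation₁ {C} {1ℤ} {0ℤ} d))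
    go (classified {C} -1t 1b 1b _ d _) = ⊥-elim (no-quotient 3 7 (from-no (3 ℕ∣.∣? 7)) (C-equation₁ {C} { -1ℤ} {1ℤ} d))
    go (classified {C} 0t 1b 1b _ d _) = ⊥-elim (no-quotient 3 5 (from-no (3 ℕ∣.∣? 5)) (C-equation₁ {C} {0ℤ} {1ℤ} d))
    go (classified {C} 1t 1b 1b _ d _) = ⊥-elim (no-quotient 3 5 (from-no (3 ℕ∣.∣? 5)) (C-equation₁ {C} {1ℤ} {1ℤ} d))

-- A form with leading coefficient n is determined by S′, T and the binary form p y² + 2q yz + r z², subject to congruences modulo n; only S′ remains to be chosen.
complete : ∀ {n κ z p q r e} → Unit z n → κ * p ≈ - (z * z) [ n ] → p * r ≡ q * q + e * n →
           Σ[ s ∈ ℤ ] (n ∣ q + s * z) × (n ∣ r + κ * (s * s))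
complete {n} {κ} {z} {p} {q} {r} {e} uz@(unit z⁻¹ zz⁻¹) κp pr = s , ≈0⇒∣ q+sz≈0 , unit-∣-cancel (unit-* uz uz) (≈0⇒∣ second)
  where
  s = - q * z⁻¹
  sz≈-q : s * z ≈ - q [ n ]
  sz≈-q = ≈-trans (≈-reflexive (lemma q z z⁻¹)) (≈-trans (*-congˡ (- q) zz⁻¹) (≈-reflexive (ℤₚ.*-identityʳ (- q))))
    where
    lemma : ∀ q z z⁻¹ → - q * z⁻¹ * z ≡ - q * (z * z⁻¹)
    lemma = solve-∀
  q+sz≈0 : q + s * z ≈ 0ℤ [ n ]
  q+sz≈0 = ≈-trans (+-cong (≈-refl {q}) sz≈-q) (≈-reflexive (ℤₚ.+-inverseʳ q))
  expand : ∀ κ r s z → z * z * (r + κ * (s * s)) ≡ - (- (z * z)) * r + κ * (s * z * (s * z))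
  expand = solve-∀
  collect : ∀ κ p q r → - (κ * p) * r + κ * (- q * - q) ≡ κ * (q * q) - κ * (p * r)
  collect = solve-∀
  cancel : ∀ κ q x → κ * (q * q) - κ * (q * q + x) ≡ 0ℤ + - κ * x
  cancel = solve-∀
  second : z * z * (r + κ * (s * s)) ≈ 0ℤ [ n ]
  second = ≈-trans (≈-reflexive (expand κ r s z)) (≈-trans (+-cong (*-congʳ r (neg-cong (≈-sym κp))) (*-congˡ κ (*-cong sz≈-q sz≈-q)))
    (≈-trans (≈-reflexive (trans (collect κ p q r) (trans (cong (λ y → κ * (q * q) - κ * y) pr) (cancel κ q (e * n)))))
    (by (- κ * e) (cong (_+_ 0ℤ) (sym (ℤₚ.*-assoc (- κ) e n))))))

cancel-pos : ∀ {n} x y → 0ℤ ℤ.< n → n * x ≡ n * y → x ≡ y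
cancel-pos {+ suc n} x y _ e = ℤₚ.*-cancelˡ-≡ (+ suc n) x y e
cancel-pos {+ zero} x y (+<+ ()) e

represents-leading : ∀ A B C R S′ T → Represented (form A B C R S′ T) A
represents-leading A B C R S′ T = 1ℤ , 0ℤ , 0ℤ , lemma A B C R S′ T
  where
  lemma : ∀ A B C R S T → A ≡ A * 1ℤ * 1ℤ + B * 0ℤ * 0ℤ + C * 0ℤ * 0ℤ + R * 0ℤ * 0ℤ + S * 1ℤ * 0ℤ + T * 1ℤ * 0ℤ
  lemma = solve-∀

-- The form `form m B C R (+ 2 * s) z` has the binary coefficients a, 2q, 4r. With these, a r = q² +
-- 3m is `pr-identity` for discriminant 3.
eisenstein-represents : ∀ {m a q r z} → 0ℤ ℤ.< m → 0ℤ ℤ.< a → Unit z m → + 4 * m ∣ a + z * z → a * r ≡ q * q + + 3 * m → Represented eisenstein₁ m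
eisenstein-represents {m} {a} {q} {r} {z} 0<m 0<a uz (divides B eB) ar = build (complete {m} {1ℤ} {z} {a} {q} {r} {+ 3} uz κp ar)
  where
  κp : 1ℤ * a ≈ - (z * z) [ m ]
  κp = by (B * + 4) (trans (lemma a z) (cong (_+_ (- (z * z))) (trans eB (sym (ℤₚ.*-assoc B (+ 4) m)))))
    where
    lemma : ∀ a z → 1ℤ * a ≡ - (z * z) + (a + z * z)
    lemma = solve-∀
  build : Σ[ s ∈ ℤ ] (m ∣ q + s * z) × (m ∣ r + 1ℤ * (s * s)) → Represented eisenstein₁ m
  build (s , divides R eR , divides C eC) = represented-by-eisenstein m {form m B C R (+ 2 * s) z} (valid 0<m (subst (0ℤ ℤ.<_) p≡ 0<a) (cancel-pos _ (+ 3) 0<m disc≡3) (represents-leading m B C R (+ 2 * s) z))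
    where
    cancelˡ : ∀ x y → x ≡ x + y - y
    cancelˡ = solve-∀
    p≡ : a ≡ + 4 * m * B - z * z
    p≡ = trans (cancelˡ a (z * z)) (cong (_- z * z) (trans eB (ℤₚ.*-comm B (+ 4 * m))))
    lemma₁ : ∀ m B C R s z → m * (+ 4 * m * B * C + R * (+ 2 * s) * z - m * R * R - B * (+ 2 * s) * (+ 2 * s) - C * z * z)
      ≡ (B * (+ 4 * m)) * (C * m) + + 2 * (R * m) * (s * z) - (R * m) * (R * m) - (B * (+ 4 * m)) * (s * s) - (C * m) * (z * z)
    lemma₁ = solve-∀
    lemma₂ : ∀ a q r s z → (a + z * z) * (r + 1ℤ * (s * s)) + + 2 * (q + s * z) * (s * z) - (q + s * z) * (q + s * z) - (a + z * z) * (s * s) - (r + 1ℤ * (s * s)) * (z * z) ≡ a * r - q * q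
    lemma₂ = solve-∀
    lemma₃ : ∀ q m → q * q + + 3 * m - q * q ≡ m * + 3
    lemma₃ = solve-∀
    disc≡3 : m * disc (form m B C R (+ 2 * s) z) ≡ m * + 3
    disc≡3 = trans (lemma₁ m B C R s z) (trans (cong₂ (λ x y → x * y + + 2 * (R * m) * (s * z) - (R * m) * (R * m) - x * (s * s) - y * (z * z)) (sym eB) (sym eC))
      (trans (cong (λ x → (a + z * z) * (r + 1ℤ * (s * s)) + + 2 * x * (s * z) - x * x - (a + z * z) * (s * s) - (r + 1ℤ * (s * s)) * (z * z)) (sym eR))
      (trans (lemma₂ a q r s z) (trans (cong (_- q * q) ar) (lemma₃ q m)))))

-- For the leading coefficient 3m, S′ and T are taken divisible by 3. The binary coefficients are
-- then 3a, 6q, 12r, and discriminant 3 amounts to a r = q² + m.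
eisenstein-represents-3 : ∀ {m a q r t} → 0ℤ ℤ.< m → 0ℤ ℤ.< a → Unit (+ 3 * t) m → + 4 * m ∣ a + + 3 * (t * t) → a * r ≡ q * q + m → Represented eisenstein₁ (+ 3 * m)
eisenstein-represents-3 {m} {a} {q} {r} {t} 0<m 0<a uz (divides B eB) ar = build (complete {m} {+ 3} {+ 3 * t} {a} {q} {r} {1ℤ} uz κp (trans ar (cong (_+_ (q * q)) (sym (ℤₚ.*-identityˡ m)))))
  where
  κp : + 3 * a ≈ - (+ 3 * t * (+ 3 * t)) [ m ]
  κp = by (+ 12 * B) (trans (lemma a t) (trans (cong (λ z → - (+ 3 * t * (+ 3 * t)) + + 3 * z) eB) (lemma' B m t)))
    where
    lemma : ∀ a t → + 3 * a ≡ - (+ 3 * t * (+ 3 * t)) + + 3 * (a + + 3 * (t * t))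
    lemma = solve-∀
    lemma' : ∀ B m t → - (+ 3 * t * (+ 3 * t)) + + 3 * (B * (+ 4 * m)) ≡ - (+ 3 * t * (+ 3 * t)) + + 12 * B * m
    lemma' = solve-∀
  build : Σ[ s ∈ ℤ ] (m ∣ q + s * (+ 3 * t)) × (m ∣ r + + 3 * (s * s)) → Represented eisenstein₁ (+ 3 * m)
  build (s , divides R eR , divides C eC) = represented-by-eisenstein (+ 3 * m) {form (+ 3 * m) B C R (+ 6 * s) (+ 3 * t)} (valid (0<* {+ 3} (+<+ (s≤s z≤n)) 0<m) (subst (0ℤ ℤ.<_) p≡ (0<* {+ 3} (+<+ (s≤s z≤n)) 0<a))
      (cancel-pos _ (+ 3) 0<m disc≡3) (represents-leading (+ 3 * m) B C R (+ 6 * s) (+ 3 * t)))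
    where
    p≡ : + 3 * a ≡ + 4 * (+ 3 * m) * B - + 3 * t * (+ 3 * t)
    p≡ = trans (lemma a t) (trans (cong (λ z → + 3 * z - + 3 * t * (+ 3 * t)) eB) (lemma' m B t))
      where
      lemma : ∀ a t → + 3 * a ≡ + 3 * (a + + 3 * (t * t)) - + 3 * t * (+ 3 * t)
      lemma = solve-∀
      lemma' : ∀ m B t → + 3 * (B * (+ 4 * m)) - + 3 * t * (+ 3 * t) ≡ + 4 * (+ 3 * m) * B - + 3 * t * (+ 3 * t)
      lemma' = solve-∀
    lemma₁ : ∀ m B C R s t → m * (+ 4 * (+ 3 * m) * B * C + R * (+ 6 * s) * (+ 3 * t) - + 3 * m * R * R - B * (+ 6 * s) * (+ 6 * s) - C * (+ 3 * t) * (+ 3 * t))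
      ≡ + 3 * ((B * (+ 4 * m)) * (C * m) + + 6 * (R * m) * (s * t) - (R * m) * (R * m) - + 3 * (B * (+ 4 * m)) * (s * s) - + 3 * (C * m) * (t * t))
    lemma₁ = solve-∀
    lemma₂ : ∀ a q r s t → + 3 * ((a + + 3 * (t * t)) * (r + + 3 * (s * s)) + + 6 * (q + s * (+ 3 * t)) * (s * t) - (q + s * (+ 3 * t)) * (q + s * (+ 3 * t)) - + 3 * (a + + 3 * (t * t)) * (s * s) - + 3 * (r + + 3 * (s * s)) * (t * t))
      ≡ + 3 * (a * r - q * q)
    lemma₂ = solve-∀
    lemma₃ : ∀ q m → + 3 * (q * q + m - q * q) ≡ m * + 3
    lemma₃ = solve-∀
    disc≡3 : m * disc (form (+ 3 * m) B C R (+ 6 * s) (+ 3 * t)) ≡ m * + 3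
    disc≡3 = trans (lemma₁ m B C R s t) (trans (cong₂ (λ x y → + 3 * (x * y + + 6 * (R * m) * (s * t) - (R * m) * (R * m) - + 3 * x * (s * s) - + 3 * y * (t * t))) (sym eB) (sym eC))
      (trans (cong (λ x → + 3 * ((a + + 3 * (t * t)) * (r + + 3 * (s * s)) + + 6 * x * (s * t) - x * x - + 3 * (a + + 3 * (t * t)) * (s * s) - + 3 * (r + + 3 * (s * s)) * (t * t))) (sym eR))
      (trans (lemma₂ a q r s t) (trans (cong (λ z → + 3 * (z - q * q)) ar) (lemma₃ q m)))))

-- All cross terms are even here, and the binary coefficients are 4p, 4q, 4r, so that discriminant 4
-- amounts to p r = q² + n.
squares-represent : ∀ {n p q r w} → 0ℤ ℤ.< n → 0ℤ ℤ.< p → Unit w n → n ∣ p + w * w → p * r ≡ q * q + n → Represented squares₃ n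
squares-represent {n} {p} {q} {r} {w} 0<n 0<p uw (divides B eB) pr = build (complete {n} {1ℤ} {w} {p} {q} {r} {1ℤ} uw κp (trans pr (cong (_+_ (q * q)) (sym (ℤₚ.*-identityˡ n)))))
  where
  κp : 1ℤ * p ≈ - (w * w) [ n ]
  κp = by B (trans (lemma p w) (cong (_+_ (- (w * w))) eB))
    where
    lemma : ∀ a z → 1ℤ * a ≡ - (z * z) + (a + z * z)
    lemma = solve-∀
  build : Σ[ s ∈ ℤ ] (n ∣ q + s * w) × (n ∣ r + 1ℤ * (s * s)) → Represented squares₃ n
  build (s , divides R eR , divides C eC) = represented-by-squares n {form n B C (+ 2 * R) (+ 2 * s) (+ 2 * w)} (valid 0<n (subst (0ℤ ℤ.<_) p≡ (0<* {+ 4} (+<+ (s≤s z≤n)) 0<p)) (cancel-pos _ (+ 4) 0<n disc≡4)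
      (represents-leading n B C (+ 2 * R) (+ 2 * s) (+ 2 * w)))
    where
    p≡ : + 4 * p ≡ + 4 * n * B - + 2 * w * (+ 2 * w)
    p≡ = trans (lemma p w) (trans (cong (λ z → + 4 * z - + 2 * w * (+ 2 * w)) eB) (lemma' n B w))
      where
      lemma : ∀ a t → + 4 * a ≡ + 4 * (a + t * t) - + 2 * t * (+ 2 * t)
      lemma = solve-∀
      lemma' : ∀ m B t → + 4 * (B * m) - + 2 * t * (+ 2 * t) ≡ + 4 * m * B - + 2 * t * (+ 2 * t)
      lemma' = solve-∀
    lemma₁ : ∀ n B C R s w → n * (+ 4 * n * B * C + + 2 * R * (+ 2 * s) * (+ 2 * w) - n * (+ 2 * R) * (+ 2 * R) - B * (+ 2 * s) * (+ 2 * s) - C * (+ 2 * w) * (+ 2 * w))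
      ≡ + 4 * ((B * n) * (C * n) + + 2 * (R * n) * (s * w) - (R * n) * (R * n) - (B * n) * (s * s) - (C * n) * (w * w))
    lemma₁ = solve-∀
    lemma₂ : ∀ p q r s w → + 4 * ((p + w * w) * (r + 1ℤ * (s * s)) + + 2 * (q + s * w) * (s * w) - (q + s * w) * (q + s * w) - (p + w * w) * (s * s) - (r + 1ℤ * (s * s)) * (w * w)) ≡ + 4 * (p * r - q * q)
    lemma₂ = solve-∀
    lemma₃ : ∀ q n → + 4 * (q * q + n - q * q) ≡ n * + 4
    lemma₃ = solve-∀
    disc≡4 : n * disc (form n B C (+ 2 * R) (+ 2 * s) (+ 2 * w)) ≡ n * + 4
    disc≡4 = trans (lemma₁ n B C R s w) (trans (cong₂ (λ x y → + 4 * (x * y + + 2 * (R * n) * (s * w) - (R * n) * (R * n) - x * (s * s) - y * (w * w))) (sym eB) (sym eC))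
      (trans (cong (λ x → + 4 * ((p + w * w) * (r + 1ℤ * (s * s)) + + 2 * x * (s * w) - x * x - (p + w * w) * (s * s) - (r + 1ℤ * (s * s)) * (w * w))) (sym eR))
      (trans (lemma₂ p q r s w) (trans (cong (λ z → + 4 * (z - q * q)) pr) (lemma₃ q n)))))

-- Representation of square-free numbers

odd>0 : ∀ {a} → Odd a → 0ℤ ℤ.< + a
odd>0 {zero} ()
odd>0 {suc a} _ = +<+ (s≤s z≤n)

∣-modulus : ∀ {a b m n} → m ℕ∣.∣ n → a ≈ b [ + n ] → a ≈ b [ + m ]
∣-modulus d = ≈-weaken (ℤ∣.∣ᵤ⇒∣ d)

square-unit : ∀ {z a n} → z * z ≈ a [ n ] → Unit a n → Unit z n
square-unit {z} e u = unit-*ˡ {z} {z} (unit-≈ (≈-sym e) u)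

prime-3 : Prime 3
prime-3 = from-yes (Primality.prime? 3)

prime-5 : Prime 5
prime-5 = from-yes (Primality.prime? 5)

module ResultFor {P N t M a : ℕ} (2∣P : 2 ℕ∣.∣ P) (M∣P : 8 ℕ.* M ℕ∣.∣ P) (N∣P : N ℕ∣.∣ P) (ua : Unit (+ a) (+ P)) (b : ℤ) (r : ℤ) (er : b * b + + N ≡ r * + a)
  (z : ℤ) (ez : + a * + t ≈ z * z [ + (8 ℕ.* M) ]) (c : ℤ) (t≈c : + t ≈ c [ + (8 ℕ.* M) ]) where

  oa : Odd a
  oa = unit-2⇒odd (unit-∣ (ℤ∣.∣ᵤ⇒∣ 2∣P) ua)

  0<a : 0ℤ ℤ.< + a
  0<a = odd>0 oa

  ca≈z² : c * + a ≈ z * z [ + (8 ℕ.* M) ]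
  ca≈z² = ≈-trans (≈-reflexive (ℤₚ.*-comm c (+ a))) (≈-trans (*-congˡ (+ a) (≈-sym t≈c)) ez)

  ua8M : Unit (+ a) (+ (8 ℕ.* M))
  ua8M = unit-∣ (ℤ∣.∣ᵤ⇒∣ M∣P) ua

  uN : Unit (+ N) (+ a)
  uN = unit-sym (unit-∣ (ℤ∣.∣ᵤ⇒∣ N∣P) ua)

  J-minus-N : J (- (+ N)) a ≡ ⊕
  J-minus-N = J-square {b = b} oa (square-unit (≈-sym e) (unit-neg uN)) e
    where
    rearrange : ∀ x n → - n ≡ x - (x + n)
    rearrange = solve-∀
    e : - (+ N) ≈ b * b [ + a ]
    e = by (- r) (trans (rearrange (b * b) (+ N)) (cong (_+_ (b * b)) (trans (cong -_ er) (ℤₚ.neg-distribˡ-* r (+ a)))))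

  J-minus-one·J-N : J -1ℤ a · J (+ N) a ≡ ⊕
  J-minus-one·J-N = trans (sym (J-neg oa uN)) J-minus-N

-- Here ℓ = 3 and N = 3m with m = E M, so -N being a square modulo a reads a r = b² + 3m. As t ≡ -1,
-- -a is a square modulo 8M, a multiple of 4m. This is what `eisenstein-represents` asks for, and no
-- condition at 3 occurs.
odd-squarefree-eisenstein : ∀ {M E k} → Odd M → SquareFree M → ¬ (3 ℕ∣.∣ M) → k ℕ.* E ≡ 2 → 0 ℕ.< E → Represented eisenstein₁ (+ (E ℕ.* M))
odd-squarefree-eisenstein {M} {E} {k} oM sqf 3∤M kE 0<E = go (Prescribed.result {8 ℕ.* (3 ℕ.* M)} {E ℕ.* (3 ℕ.* M)} {3} {M} {E} {k} {t} refl refl prime-3 refl oM sqf 3∤M kE (odd-od (3 ℕ.+ 8 ℕ.* h) (lemma h)) ut)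
  where
  h = ⌊ M /2⌋
  t = 7 ℕ.+ 16 ℕ.* h
  lemma : ∀ h → 7 ℕ.+ 16 ℕ.* h ≡ 1 ℕ.+ (3 ℕ.+ 8 ℕ.* h ℕ.+ (3 ℕ.+ 8 ℕ.* h))
  lemma = ℕSolver.solve-∀
  lemma' : ∀ h → 1 ℕ.+ (7 ℕ.+ 16 ℕ.* h) ≡ 8 ℕ.* (1 ℕ.+ (h ℕ.+ h))
  lemma' = ℕSolver.solve-∀
  t≈-1 : + t ≈ -1ℤ [ + (8 ℕ.* M) ]
  t≈-1 = by 1ℤ (trans (shift (+ t)) (cong (λ z → -1ℤ + 1ℤ * z) (cong +_ (trans (lemma' h) (cong (8 ℕ.*_) (sym oM))))))
    where
    shift : ∀ t → t ≡ -1ℤ + 1ℤ * (1ℤ + t)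
    shift = solve-∀
  ut : Unit (+ t) (+ M)
  ut = unit-≈ (≈-sym (∣-modulus (ℕ∣.n∣m*n 8) t≈-1)) (unit-neg unit-1)
  m = E ℕ.* M
  4m∣8M : 4 ℕ.* m ℕ∣.∣ 8 ℕ.* M
  4m∣8M = ℕ∣.divides k (trans (cong (λ e → 4 ℕ.* e ℕ.* M) (sym kE)) (rearrange k E M))
    where
    rearrange : ∀ k E M → 4 ℕ.* (k ℕ.* E) ℕ.* M ≡ k ℕ.* (4 ℕ.* (E ℕ.* M))
    rearrange = ℕSolver.solve-∀
  go : Σ[ a ∈ ℕ ] Unit (+ a) (+ (8 ℕ.* (3 ℕ.* M))) × SquareRoot (+ (E ℕ.* (3 ℕ.* M))) a × (Σ[ z ∈ ℤ ] + a * + t ≈ z * z [ + (8 ℕ.* M) ]) → Represented eisenstein₁ (+ m)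
  go (a , ua , (b , divides r er) , z , ez) = eisenstein-represents {+ m} {+ a} {b} {r} {z} (+<+ (ℕₚ.*-mono-≤ 0<E (ℤₚ.drop‿+<+ (odd>0 oM)))) 0<a
      (unit-∣ (ℤ∣.∣ᵤ⇒∣ (ℕ∣.∣-trans (ℕ∣.n∣m*n 4) 4m∣8M)) (square-unit (≈-sym ca≈z²) (unit-* (unit-neg unit-1) ua8M)))
      (subst (_∣ + a + z * z) (ℤₚ.pos-* 4 m) (≈0⇒∣ (∣-modulus 4m∣8M a+z²≈0)))
      (trans (ℤₚ.*-comm (+ a) r) (trans (sym er) (cong (_+_ (b * b)) (trans (cong +_ (rearrange E M)) (ℤₚ.pos-* 3 m)))))
    where
    M∣P : 8 ℕ.* M ℕ∣.∣ 8 ℕ.* (3 ℕ.* M)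
    M∣P = ℕ∣.*-monoʳ-∣ 8 (ℕ∣.n∣m*n 3 {M})
    N∣P : E ℕ.* (3 ℕ.* M) ℕ∣.∣ 8 ℕ.* (3 ℕ.* M)
    N∣P = ℕ∣.divides (4 ℕ.* k) (trans (cong (λ e → 4 ℕ.* e ℕ.* (3 ℕ.* M)) (sym kE)) (rearr k E (3 ℕ.* M)))
      where
      rearr : ∀ k E x → 4 ℕ.* (k ℕ.* E) ℕ.* x ≡ 4 ℕ.* k ℕ.* (E ℕ.* x)
      rearr = ℕSolver.solve-∀
    open ResultFor {t = t} {M} (ℕ∣.∣-trans (ℕ∣.divides 4 refl) (ℕ∣.m∣m*n (3 ℕ.* M))) M∣P N∣P ua b r er z ez -1ℤ t≈-1
    rearrange : ∀ E M → E ℕ.* (3 ℕ.* M) ≡ 3 ℕ.* (E ℕ.* M)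
    rearrange = ℕSolver.solve-∀
    a+z²≈0 : + a + z * z ≈ 0ℤ [ + (8 ℕ.* M) ]
    a+z²≈0 = ≈-trans (+-cong (≈-refl {+ a}) (≈-sym ca≈z²)) (≈-reflexive (cancel (+ a)))
      where
      cancel : ∀ a → a + -1ℤ * a ≡ 0ℤ
      cancel = solve-∀

odd-square-≈1 : ∀ {g} → Odd g → + g * + g ≈ 1ℤ [ + 8 ]
odd-square-≈1 o = ≈-trans (*-cong (residue-≈-8 (proj₂ (oddResidue o))) (residue-≈-8 (proj₂ (oddResidue o)))) (residue-square (proj₂ (oddResidue o)))

unit-8-square : ∀ {z} → Unit z (+ 8) → z * z ≈ 1ℤ [ + 8 ]
unit-8-square {z} u = ≈-trans (*-cong (rem-≈ z 8) (rem-≈ z 8)) (odd-square-≈1 (unit-2⇒odd (unit-∣ (divides (+ 4) refl) (unit-≈ (rem-≈ z 8) u))))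

·-≡ʳ : ∀ {s t} → s · t ≡ ⊕ → t ≡ ⊕ → s ≡ ⊕
·-≡ʳ {⊕} _ _ = refl
·-≡ʳ {⊖} {⊕} () _
·-≡ʳ {⊖} {⊖} _ ()

·-cancel-⊖ : ∀ {s t} → ⊖ · s ≡ t → s ≡ ⊖ · t
·-cancel-⊖ {⊕} {⊖} _ = refl
·-cancel-⊖ {⊖} {⊕} _ = refl

-- The quadratic character of -3 is n ↦ (n/3).
J-minus-three : ∀ {n} → Odd n → + n ≈ + 2 [ + 3 ] → J (- (+ 3)) n ≡ ⊖
J-minus-three {n} o n≈2 = trans (J-neg {3} o u) (lemma (J -1ℤ n) (J (+ 3) n) (J (+ n) 3) (trans (J-reciprocity {3} {n} refl o u) (trans (cong par (ℕₚ.*-identityʳ ⌊ n /2⌋)) (sym (J-minus-one n)))) (trans (J-≈ refl n≈2) J2-3))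
  where
  u : Unit (+ 3) (+ n)
  u = unit-sym (unit-≈ (≈-sym n≈2) (unit (+ 2) (by 1ℤ refl)))
  lemma : ∀ m x y → x · y ≡ m → y ≡ ⊖ → m · x ≡ ⊖
  lemma ⊕ ⊖ ⊖ _ _ = refl
  lemma ⊖ ⊕ ⊖ _ _ = refl
  lemma ⊕ ⊕ ⊖ () _
  lemma ⊖ ⊖ ⊖ () _

-- Now N = 2n is prime to 3, and the prime without a prescribed sign is a factor p of n = p M.
-- Taking t ≡ -3 makes -3a a square modulo 8M. Modulo p it is a square by reciprocity: (-3/n) = -1
-- as n ≡ 2 modulo 3, and (a/n) = (n/a) = -1 follows from (-2n/a) = 1 and a ≡ 5 modulo 8, so (-3a/n)
-- = 1.
odd-squarefree-eisenstein-6 : ∀ {n} → Odd n → SquareFree n → + n ≈ + 2 [ + 3 ] → Represented eisenstein₁ (+ 3 * + (2 ℕ.* n))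
odd-squarefree-eisenstein-6 {n} on sqf n≈2 = split (prime-factor {n} (n>1 on n≈2))
  where
  n>1 : ∀ {n} → Odd n → + n ≈ + 2 [ + 3 ] → 1 ℕ.< n
  n>1 {zero} ()
  n>1 {suc zero} _ e = case rem-cong {+ 1} {+ 2} 3 e of λ ()
  n>1 {suc (suc _)} _ _ = s≤s (s≤s z≤n)
  u3 : Unit (+ 3) (+ n)
  u3 = unit-sym (unit-≈ (≈-sym n≈2) (unit (+ 2) (by 1ℤ refl)))
  split : Σ[ p ∈ ℕ ] Prime p × p ℕ∣.∣ n → Represented eisenstein₁ (+ 3 * + (2 ℕ.* n))
  split (p , pp , ℕ∣.divides M n≡Mp) = go (Prescribed.result {8 ℕ.* (p ℕ.* M)} {2 ℕ.* (p ℕ.* M)} {p} {M} {2} {1} {t} refl refl pp op oM sqfM p∤M refl (odd-od (2 ℕ.+ 8 ℕ.* h) (lemma h)) ut)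
    where
    n≡ : n ≡ p ℕ.* M
    n≡ = trans n≡Mp (ℕₚ.*-comm M p)
    p∣n : p ℕ∣.∣ n
    p∣n = ℕ∣.divides M n≡Mp
    M∣n : M ℕ∣.∣ n
    M∣n = ℕ∣.divides p n≡
    op = odd-∣ p∣n on
    oM = odd-∣ M∣n on
    sqfM : SquareFree M
    sqfM q pq d = sqf q pq (ℕ∣.∣-trans d M∣n)
    p∤M : ¬ (p ℕ∣.∣ M)
    p∤M d = sqf p pp (subst (p ℕ.* p ℕ∣.∣_) (sym n≡) (ℕ∣.*-monoʳ-∣ p d))
    h = ⌊ M /2⌋
    t = 5 ℕ.+ 16 ℕ.* h
    lemma : ∀ h → 5 ℕ.+ 16 ℕ.* h ≡ 1 ℕ.+ (2 ℕ.+ 8 ℕ.* h ℕ.+ (2 ℕ.+ 8 ℕ.* h))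
    lemma = ℕSolver.solve-∀
    lemma' : ∀ h → 3 ℕ.+ (5 ℕ.+ 16 ℕ.* h) ≡ 8 ℕ.* (1 ℕ.+ (h ℕ.+ h))
    lemma' = ℕSolver.solve-∀
    t≈-3 : + t ≈ - (+ 3) [ + (8 ℕ.* M) ]
    t≈-3 = by 1ℤ (trans (shift (+ t)) (cong (λ z → - (+ 3) + 1ℤ * z) (cong +_ (trans (lemma' h) (cong (8 ℕ.*_) (sym oM))))))
      where
      shift : ∀ t → t ≡ - (+ 3) + 1ℤ * (+ 3 + t)
      shift = solve-∀
    u-3M : Unit (- (+ 3)) (+ M)
    u-3M = unit-neg (unit-∣ (ℤ∣.∣ᵤ⇒∣ M∣n) u3)
    ut : Unit (+ t) (+ M)
    ut = unit-≈ (≈-sym (∣-modulus (ℕ∣.n∣m*n 8) t≈-3)) u-3M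
    go : Σ[ a ∈ ℕ ] Unit (+ a) (+ (8 ℕ.* (p ℕ.* M))) × SquareRoot (+ (2 ℕ.* (p ℕ.* M))) a × (Σ[ z ∈ ℤ ] + a * + t ≈ z * z [ + (8 ℕ.* M) ]) → Represented eisenstein₁ (+ 3 * + (2 ℕ.* n))
    go (a , ua , (b , divides r er) , z , ez) = finish (J-⊕⇒square {p} { - (+ 3) * + a} pp op (unit-* u-3p uap) J-3a-p)
      where
      8M∣P : 8 ℕ.* M ℕ∣.∣ 8 ℕ.* (p ℕ.* M)
      8M∣P = ℕ∣.*-monoʳ-∣ 8 (ℕ∣.n∣m*n p {M})
      2∣P : 2 ℕ∣.∣ 8 ℕ.* (p ℕ.* M)
      2∣P = ℕ∣.∣-trans (ℕ∣.divides 4 refl) (ℕ∣.m∣m*n (p ℕ.* M))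
      2∣8 : 2 ℕ∣.∣ 8
      2∣8 = ℕ∣.divides 4 refl
      N∣P : 2 ℕ.* (p ℕ.* M) ℕ∣.∣ 8 ℕ.* (p ℕ.* M)
      N∣P = ℕ∣.*-monoˡ-∣ (p ℕ.* M) 2∣8
      open ResultFor {t = t} {M} 2∣P 8M∣P N∣P ua b r er z ez (- (+ 3)) t≈-3
      uan : Unit (+ a) (+ n)
      uan = unit-∣ (ℤ∣.∣ᵤ⇒∣ (subst (ℕ∣._∣ 8 ℕ.* (p ℕ.* M)) (sym n≡) (ℕ∣.n∣m*n 8))) ua
      uap : Unit (+ a) (+ p)
      uap = unit-∣ (ℤ∣.∣ᵤ⇒∣ p∣n) uan
      uaM : Unit (+ a) (+ M)
      uaM = unit-∣ (ℤ∣.∣ᵤ⇒∣ M∣n) uan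
      u-3p : Unit (- (+ 3)) (+ p)
      u-3p = unit-neg (unit-∣ (ℤ∣.∣ᵤ⇒∣ p∣n) u3)
      u-3a8M : Unit (- (+ 3) * + a) (+ (8 ℕ.* M))
      u-3a8M = unit-* (unit-neg (subst (Unit (+ 3)) (sym (ℤₚ.pos-* 8 M)) (unit-*-modulus {m = + 8} {+ M} (unit (+ 3) (by 1ℤ refl)) (unit-∣ (ℤ∣.∣ᵤ⇒∣ M∣n) u3)))) ua8M
      uz : Unit z (+ (8 ℕ.* M))
      uz = square-unit (≈-sym ca≈z²) u-3a8M
      -- -3a is the square of a unit modulo 8, hence 1, and 5 is the inverse of -3 modulo 8.
      residue-a : OddResidue a 5
      residue-a = residue-from 5 five refl (≈-trans (by (+ 2 * + a) (rearrange (+ a))) (*-congˡ (+ 5) -3a≈1))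
        where
        rearrange : ∀ a → a ≡ + 5 * (- (+ 3) * a) + + 2 * a * + 8
        rearrange = solve-∀
        -3a≈1 : - (+ 3) * + a ≈ 1ℤ [ + 8 ]
        -3a≈1 = ≈-trans (∣-modulus (ℕ∣.m∣m*n M) ca≈z²) (unit-8-square (unit-∣ (ℤ∣.∣ᵤ⇒∣ (ℕ∣.m∣m*n M)) uz))
      opM : Odd (p ℕ.* M)
      opM = odd-* op oM
      upM : Unit (+ (p ℕ.* M)) (+ a)
      upM = unit-ℕ*ʳ {2} {p ℕ.* M} uN
      J-n-a : J (+ (p ℕ.* M)) a ≡ ⊖
      J-n-a = ·-cancel-⊖ (trans (sym (trans (cong (_· J (+ (2 ℕ.* (p ℕ.* M))) a) (cong proj₁ (J-residue residue-a)))
        (trans (cong (λ x → J x a) (ℤₚ.pos-* 2 (p ℕ.* M))) (trans (J-* oa (odd⇒unit-2 oa) upM) (cong (_· J (+ (p ℕ.* M)) a) (cong proj₂ (J-residue residue-a))))))) J-minus-one·J-N)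
      J-a-n : J (+ a) (p ℕ.* M) ≡ ⊖
      J-a-n = trans (J-reciprocity-⊕ oa opM (unit-sym upM) (trans (sym (J-minus-one a)) (cong proj₁ (J-residue residue-a)))) J-n-a
      J-3a-p : J (- (+ 3) * + a) p ≡ ⊕
      J-3a-p = ·-≡ʳ (trans (sym (J-lower-* op oM (unit-* u-3p uap) (unit-* u-3M uaM))) (trans (J-* opM (unit-neg (subst (λ x → Unit (+ 3) (+ x)) n≡ u3)) (unit-sym upM))
          (cong₂ _·_ (trans (cong (J (- (+ 3))) (sym n≡)) (J-minus-three on n≈2)) J-a-n)))
        (J-square {b = z} oM (unit-∣ (ℤ∣.∣ᵤ⇒∣ (ℕ∣.n∣m*n 8)) uz) (∣-modulus (ℕ∣.n∣m*n 8) ca≈z²))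
      finish : Σ[ y ∈ ℤ ] - (+ 3) * + a ≈ y * y [ + p ] → Represented eisenstein₁ (+ 3 * + (2 ℕ.* n))
      finish (y , ey) = glue (crt u-p-8M y z)
        where
        u-p-8M : Unit (+ p) (+ (8 ℕ.* M))
        u-p-8M = unit-sym (unit-ℕ* {8} (unit-8 op) (unit-sym (∤⇒unit pp p∤M)))
        8n≡ : + p * + (8 ℕ.* M) ≡ + 4 * + (2 ℕ.* n)
        8n≡ = trans (sym (ℤₚ.pos-* p (8 ℕ.* M))) (trans (cong +_ (trans (rearrange p M) (cong (λ x → 4 ℕ.* (2 ℕ.* x)) (sym n≡)))) (ℤₚ.pos-* 4 (2 ℕ.* n)))
          where
          rearrange : ∀ p M → p ℕ.* (8 ℕ.* M) ≡ 4 ℕ.* (2 ℕ.* (p ℕ.* M))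
          rearrange = ℕSolver.solve-∀
        glue : Σ[ w ∈ ℤ ] (w ≈ y [ + p ]) × (w ≈ z [ + (8 ℕ.* M) ]) → Represented eisenstein₁ (+ 3 * + (2 ℕ.* n))
        glue (w , w≈y , w≈z) = third (subst (λ x → Unit (+ 3) x) 8n≡ (unit-*-modulus {m = + p} {+ (8 ℕ.* M)} (unit-∣ (ℤ∣.∣ᵤ⇒∣ p∣n) u3)
             (subst (Unit (+ 3)) (sym (ℤₚ.pos-* 8 M)) (unit-*-modulus {m = + 8} {+ M} (unit (+ 3) (by 1ℤ refl)) (unit-∣ (ℤ∣.∣ᵤ⇒∣ M∣n) u3)))))
          where
          -3a≈w² : - (+ 3) * + a ≈ w * w [ + 4 * + (2 ℕ.* n) ]
          -3a≈w² = subst (λ x → - (+ 3) * + a ≈ w * w [ x ]) 8n≡ (crt-unique u-p-8M (≈-trans ey (≈-sym (*-cong w≈y w≈y))) (≈-trans ca≈z² (≈-sym (*-cong w≈z w≈z))))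
          m∣4m : + (2 ℕ.* n) ∣ + 4 * + (2 ℕ.* n)
          m∣4m = divides (+ 4) refl
          third : Unit (+ 3) (+ 4 * + (2 ℕ.* n)) → Represented eisenstein₁ (+ 3 * + (2 ℕ.* n))
          -- `w * i` is w divided by 3. For this T, 3(a + 3T²) ≡ 3a + w² ≡ 0, and the factor 3 can
          -- be cancelled.
          third u3'@(unit i 3i) = eisenstein-represents-3 {+ (2 ℕ.* n)} {+ a} {b} {r} {w * i} (+<+ (ℕₚ.*-mono-≤ {1} {2} (s≤s z≤n) (ℤₚ.drop‿+<+ (odd>0 on)))) 0<a
              (unit-≈ (≈-sym (≈-weaken m∣4m 3T≈w)) (unit-∣ m∣4m (square-unit (≈-sym -3a≈w²) (unit-* (unit-neg u3') (subst (Unit (+ a)) (trans (trans (cong +_ (rearrange p M)) (ℤₚ.pos-* p (8 ℕ.* M))) 8n≡) ua)))))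
              (unit-∣-cancel u3' (≈0⇒∣ 3[a+3T²]≈0))
              (trans (ℤₚ.*-comm (+ a) r) (trans (sym er) (cong (λ x → b * b + + (2 ℕ.* x)) (sym n≡))))
            where
            rearrange : ∀ p M → 8 ℕ.* (p ℕ.* M) ≡ p ℕ.* (8 ℕ.* M)
            rearrange = ℕSolver.solve-∀
            3T≈w : + 3 * (w * i) ≈ w [ + 4 * + (2 ℕ.* n) ]
            3T≈w = ≈-trans (≈-reflexive (swap w i)) (≈-trans (*-congˡ w 3i) (≈-reflexive (ℤₚ.*-identityʳ w)))
              where
              swap : ∀ w i → + 3 * (w * i) ≡ w * (+ 3 * i)
              swap = solve-∀
            3[a+3T²]≈0 : + 3 * (+ a + + 3 * (w * i * (w * i))) ≈ 0ℤ [ + 4 * + (2 ℕ.* n) ]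
            3[a+3T²]≈0 = ≈-trans (≈-reflexive (expand (+ a) (w * i))) (≈-trans (+-cong (≈-refl { - (- (+ 3) * + a)}) (≈-trans (*-cong 3T≈w 3T≈w) (≈-sym -3a≈w²))) (≈-reflexive (ℤₚ.+-inverseˡ (- (+ 3) * + a))))
              where
              expand : ∀ a T → + 3 * (a + + 3 * (T * T)) ≡ - (- (+ 3) * a) + + 3 * T * (+ 3 * T)
              expand = solve-∀

residue-odd : ∀ {a s} → OddResidue a s → Odd a
residue-odd (one k) = odd-od (k ℕ.* 4) (double k)
  where
  double : ∀ k → 1 ℕ.+ k ℕ.* 8 ≡ 1 ℕ.+ (k ℕ.* 4 ℕ.+ k ℕ.* 4)
  double = ℕSolver.solve-∀
residue-odd (three k) = odd-od (1 ℕ.+ k ℕ.* 4) (double k)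
  where
  double : ∀ k → 3 ℕ.+ k ℕ.* 8 ≡ 1 ℕ.+ (1 ℕ.+ k ℕ.* 4 ℕ.+ (1 ℕ.+ k ℕ.* 4))
  double = ℕSolver.solve-∀
residue-odd (five k) = odd-od (2 ℕ.+ k ℕ.* 4) (double k)
  where
  double : ∀ k → 5 ℕ.+ k ℕ.* 8 ≡ 1 ℕ.+ (2 ℕ.+ k ℕ.* 4 ℕ.+ (2 ℕ.+ k ℕ.* 4))
  double = ℕSolver.solve-∀
residue-odd (seven k) = odd-od (3 ℕ.+ k ℕ.* 4) (double k)
  where
  double : ∀ k → 7 ℕ.+ k ℕ.* 8 ≡ 1 ℕ.+ (3 ℕ.+ k ℕ.* 4 ℕ.+ (3 ℕ.+ k ℕ.* 4))
  double = ℕSolver.solve-∀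

-- Here ℓ = 5 and N = n = 5M ≡ 3 modulo 8, and t makes -2a a square modulo M. Modulo 5 it is a
-- square by reciprocity: (-2/n) = 1 and (a/n) = (-n/a) = 1, so (-2a/n) = 1. `squares-represent` is
-- then applied with p = 2a.
odd-squarefree-squares : ∀ {M} → OddResidue M 7 → SquareFree M → ¬ (5 ℕ∣.∣ M) → Represented squares₃ (+ (5 ℕ.* M))
odd-squarefree-squares {M} rM sqf 5∤M = go (Prescribed.result {8 ℕ.* (5 ℕ.* M)} {1 ℕ.* (5 ℕ.* M)} {5} {M} {1} {2} {t} refl refl prime-5 refl oM sqf 5∤M refl (odd-od (3 ℕ.* h) (lemma h)) ut)
  where
  oM : Odd M
  oM = residue-odd rM
  n = 5 ℕ.* M
  on : Odd n
  on = odd-* {5} refl oM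
  times5 : ∀ {M} → OddResidue M 7 → OddResidue (5 ℕ.* M) 3
  times5 (seven k) = subst (λ x → OddResidue x 3) (sym (expand k)) (three (4 ℕ.+ 5 ℕ.* k))
    where
    expand : ∀ k → 5 ℕ.* (7 ℕ.+ k ℕ.* 8) ≡ 3 ℕ.+ (4 ℕ.+ 5 ℕ.* k) ℕ.* 8
    expand = ℕSolver.solve-∀
  rn : OddResidue n 3
  rn = times5 rM
  h = ⌊ M /2⌋
  -- This is 3M - 2: congruent to -2 modulo M, and odd, as `Prescribed` requires.
  t = 1 ℕ.+ 6 ℕ.* h
  lemma : ∀ h → 1 ℕ.+ 6 ℕ.* h ≡ 1 ℕ.+ (3 ℕ.* h ℕ.+ 3 ℕ.* h)
  lemma = ℕSolver.solve-∀
  t≈-2 : + t ≈ - (+ 2) [ + M ]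
  t≈-2 = by (+ 3) (trans (shift (+ t)) (cong (_+_ (- (+ 2))) (trans (cong +_ (trans (expand h) (cong (3 ℕ.*_) (sym oM)))) (ℤₚ.pos-* 3 M))))
    where
    shift : ∀ t → t ≡ - (+ 2) + (+ 2 + t)
    shift = solve-∀
    expand : ∀ h → 2 ℕ.+ (1 ℕ.+ 6 ℕ.* h) ≡ 3 ℕ.* (1 ℕ.+ (h ℕ.+ h))
    expand = ℕSolver.solve-∀
  u-2 : ∀ {m} → Odd m → Unit (- (+ 2)) (+ m)
  u-2 o = unit-neg (odd⇒unit-2 o)
  ut : Unit (+ t) (+ M)
  ut = unit-≈ (≈-sym t≈-2) (u-2 oM)
  go : Σ[ a ∈ ℕ ] Unit (+ a) (+ (8 ℕ.* (5 ℕ.* M))) × SquareRoot (+ (1 ℕ.* (5 ℕ.* M))) a × (Σ[ z ∈ ℤ ] + a * + t ≈ z * z [ + (8 ℕ.* M) ]) → Represented squares₃ (+ n)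
  go (a , ua , (b , divides r er) , z , ez) = finish (J-⊕⇒square {5} { - (+ 2) * + a} prime-5 refl (unit-* (u-2 {5} refl) ua5) J-2a-5)
    where
    n∣P : n ℕ∣.∣ 8 ℕ.* n
    n∣P = ℕ∣.n∣m*n 8
    2∣P : 2 ℕ∣.∣ 8 ℕ.* n
    2∣P = ℕ∣.∣-trans (ℕ∣.divides 4 refl) (ℕ∣.m∣m*n n)
    8M∣P : 8 ℕ.* M ℕ∣.∣ 8 ℕ.* n
    8M∣P = ℕ∣.*-monoʳ-∣ 8 (ℕ∣.n∣m*n 5 {M})
    N∣P : 1 ℕ.* n ℕ∣.∣ 8 ℕ.* n
    N∣P = ℕ∣.*-monoˡ-∣ n (ℕ∣.1∣ 8)
    open ResultFor {8 ℕ.* n} {1 ℕ.* n} {t} {M} {a} 2∣P 8M∣P N∣P ua b r er z ez (+ t) ≈-refl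
    uan : Unit (+ a) (+ n)
    uan = unit-∣ (ℤ∣.∣ᵤ⇒∣ n∣P) ua
    ua5 : Unit (+ a) (+ 5)
    ua5 = unit-∣ (ℤ∣.∣ᵤ⇒∣ (ℕ∣.m∣m*n M)) uan
    uaM : Unit (+ a) (+ M)
    uaM = unit-∣ (ℤ∣.∣ᵤ⇒∣ (ℕ∣.n∣m*n 5)) uan
    -2a≈z² : - (+ 2) * + a ≈ z * z [ + M ]
    -2a≈z² = ≈-trans (*-congʳ (+ a) (≈-sym t≈-2)) (∣-modulus (ℕ∣.n∣m*n 8) ca≈z²)
    J-a-n : J (+ a) n ≡ ⊕
    J-a-n = combine (J -1ℤ a) (J (+ n) a) (J (+ a) n) (trans (cong (λ x → J -1ℤ a · J (+ x) a) (sym (ℕₚ.*-identityˡ n))) J-minus-one·J-N)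
      (trans (J-reciprocity {n} {a} on oa (unit-sym uan)) (trans (par-*-⊖ ⌊ n /2⌋ ⌊ a /2⌋ (trans (sym (J-minus-one n)) (cong proj₁ (J-residue rn)))) (sym (J-minus-one a))))
      where
      combine : ∀ m x y → m · x ≡ ⊕ → x · y ≡ m → y ≡ ⊕
      combine ⊕ ⊕ ⊕ _ _ = refl
      combine ⊖ ⊖ ⊕ _ _ = refl
      combine ⊕ ⊕ ⊖ _ ()
      combine ⊖ ⊖ ⊖ _ ()
    J-2a-5 : J (- (+ 2) * + a) 5 ≡ ⊕
    J-2a-5 = ·-≡ʳ (trans (sym (J-lower-* {m = 5} {M} refl oM (unit-* (u-2 {5} refl) ua5) (unit-* (u-2 oM) uaM))) (trans (J-* on (u-2 on) uan)
        (cong₂ _·_ (trans (J-neg {2} on (odd⇒unit-2 on)) (cong₂ _·_ (cong proj₁ (J-residue rn)) (cong proj₂ (J-residue rn)))) J-a-n)))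
      (J-square {b = z} oM (square-unit (≈-sym -2a≈z²) (unit-* (u-2 oM) uaM)) -2a≈z²)
    finish : Σ[ y ∈ ℤ ] - (+ 2) * + a ≈ y * y [ + 5 ] → Represented squares₃ (+ n)
    -- The second system replaces the root b modulo a by an odd q. As n is odd too, q² + n becomes
    -- divisible by 2a.
    finish (y , ey) = glue (crt u5M y z) (crt (unit-sym (odd⇒unit-2 oa)) b 1ℤ)
      where
      u5M : Unit (+ 5) (+ M)
      u5M = ∤⇒unit prime-5 5∤M
      glue : Σ[ w ∈ ℤ ] (w ≈ y [ + 5 ]) × (w ≈ z [ + M ]) → Σ[ q ∈ ℤ ] (q ≈ b [ + a ]) × (q ≈ 1ℤ [ + 2 ]) → Represented squares₃ (+ n)
      glue (w , w≈y , w≈z) (q , q≈b , q≈1) = last (∣-coprime-* (unit-sym (odd⇒unit-2 oa)) a∣ 2∣)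
        where
        -2a≈w² : - (+ 2) * + a ≈ w * w [ + n ]
        -2a≈w² = subst (λ x → - (+ 2) * + a ≈ w * w [ x ]) (sym (ℤₚ.pos-* 5 M)) (crt-unique u5M (≈-trans ey (≈-sym (*-cong w≈y w≈y))) (≈-trans -2a≈z² (≈-sym (*-cong w≈z w≈z))))
        a∣ : + a ∣ q * q + + n
        a∣ = ≈0⇒∣ (≈-trans (+-cong (*-cong q≈b q≈b) (≈-reflexive (cong +_ (sym (ℕₚ.*-identityˡ n))))) (∣⇒≈0 (divides r er)))
        n≈1 : + n ≈ 1ℤ [ + 2 ]
        n≈1 = by (+ ⌊ n /2⌋) (trans (cong +_ on) (cong (_+_ 1ℤ) (trans (cong +_ (twice ⌊ n /2⌋)) (ℤₚ.pos-* ⌊ n /2⌋ 2))))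
          where
          twice : ∀ h → h ℕ.+ h ≡ h ℕ.* 2
          twice = ℕSolver.solve-∀
        2∣ : + 2 ∣ q * q + + n
        2∣ = ≈0⇒∣ (≈-trans (+-cong (*-cong q≈1 q≈1) n≈1) (by 1ℤ refl))
        last : + a * + 2 ∣ q * q + + n → Represented squares₃ (+ n)
        last (divides r' er') = squares-represent {+ n} {+ a * + 2} {q} {r'} {w} (odd>0 on) (0<* 0<a (+<+ (s≤s z≤n)))
          (square-unit (≈-sym -2a≈w²) (unit-* (u-2 on) uan))
          (≈0⇒∣ (≈-trans (+-cong (≈-refl {+ a * + 2}) (≈-sym -2a≈w²)) (≈-reflexive (cancel (+ a)))))
          (trans (ℤₚ.*-comm (+ a * + 2) r') (sym er'))
          where
          cancel : ∀ a → a * + 2 + - (+ 2) * a ≡ 0ℤ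
          cancel = solve-∀

-- Square-free parts and the passage to arbitrary numbers

squareFree-1 : SquareFree 1
squareFree-1 p pp d with ℕ∣.∣1⇒≡1 d
... | e = ℕₚ.<-irrefl (sym e) (ℕₚ.*-mono-< {1} {p} {1} {p} (prime>1 pp) (prime>1 pp))

squareFree-* : ∀ {q m} → Prime q → SquareFree m → ¬ (q ℕ∣.∣ m) → SquareFree (q ℕ.* m)
squareFree-* {q} {m} pq sqf q∤m p pp d with p ℕ.≟ q
... | yes refl = q∤m (ℕ∣.*-cancelˡ-∣ p {{ℕ.>-nonZero (ℕₚ.<⇒≤ (prime>1 pp))}} d)
... | no p≢q = sqf p pp (Coprimality.coprime-divisor c d)
  where
  p∤q : ¬ (p ℕ∣.∣ q)
  p∤q p∣q with Primality.prime⇒irreducible pq p∣q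
  ... | inj₁ refl = Primality.¬prime[1] pp
  ... | inj₂ p≡q = p≢q p≡q
  c : Coprime (p ℕ.* p) q
  c = unit⇒coprime (unit-ℕ* (∤⇒unit pp p∤q) (∤⇒unit pp p∤q))

SquareFreePart : ℕ → Set
SquareFreePart n = Σ[ n₀ ∈ ℕ ] Σ[ g ∈ ℕ ] n ≡ n₀ ℕ.* (g ℕ.* g) × SquareFree n₀

squareFreePart : ∀ {n} → 0 ℕ.< n → SquareFreePart n
squareFreePart {n} = go n (<-wellFounded n)
  where
  go : ∀ n → Acc ℕ._<_ n → 0 ℕ.< n → SquareFreePart n
  go (suc zero) _ _ = 1 , 1 , refl , squareFree-1
  go (suc (suc n)) (acc rec) _ with factor-out {suc (suc n)} (s≤s (s≤s z≤n))
  ... | factored {q} {m} k pq q∤m 0<m m<a a≡ = build (go m (rec m<a) 0<m) (halves (suc k))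
    where
    build : SquareFreePart m → Σ[ j ∈ ℕ ] (suc k ≡ j ℕ.+ j ⊎ suc k ≡ suc (j ℕ.+ j)) → SquareFreePart (suc (suc n))
    build (m₀ , g , m≡ , sqf) (j , inj₁ e) = m₀ , q ℕ.^ j ℕ.* g , trans a≡ (trans (cong₂ (λ x y → q ℕ.^ x ℕ.* y) e m≡) (trans (cong (ℕ._* (m₀ ℕ.* (g ℕ.* g))) (ℕₚ.^-distribˡ-+-* q j j)) (lemma (q ℕ.^ j) m₀ g))) , sqf
      where
      lemma : ∀ x m g → x ℕ.* x ℕ.* (m ℕ.* (g ℕ.* g)) ≡ m ℕ.* (x ℕ.* g ℕ.* (x ℕ.* g))
      lemma = ℕSolver.solve-∀
    build (m₀ , g , m≡ , sqf) (j , inj₂ e) = q ℕ.* m₀ , q ℕ.^ j ℕ.* g , trans a≡ (trans (cong₂ (λ x y → q ℕ.^ x ℕ.* y) e m≡) (trans (cong (λ z → q ℕ.* z ℕ.* (m₀ ℕ.* (g ℕ.* g))) (ℕₚ.^-distribˡ-+-* q j j)) (lemma q (q ℕ.^ j) m₀ g))) ,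
      squareFree-* pq sqf (λ q∣m₀ → q∤m (subst (q ℕ∣.∣_) (sym m≡) (ℕ∣.∣m⇒∣m*n (g ℕ.* g) q∣m₀)))
      where
      lemma : ∀ q x m g → q ℕ.* (x ℕ.* x) ℕ.* (m ℕ.* (g ℕ.* g)) ≡ q ℕ.* m ℕ.* (x ℕ.* g ℕ.* (x ℕ.* g))
      lemma = ℕSolver.solve-∀

represented-scale : ∀ F {n} g → Represented F n → Represented F (n * (g * g))
represented-scale (form A B C R S′ T) {n} g (x , y , z , e) = x * g , y * g , z * g , trans (cong (_* (g * g)) e) (lemma A B C R S′ T x y z g)
  where
  lemma : ∀ A B C R S T x y z g → (A * x * x + B * y * y + C * z * z + R * y * z + S * x * z + T * x * y) * (g * g)
    ≡ A * (x * g) * (x * g) + B * (y * g) * (y * g) + C * (z * g) * (z * g) + R * (y * g) * (z * g) + S * (x * g) * (z * g) + T * (x * g) * (y * g)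
  lemma = solve-∀

pos-*-square : ∀ {c n n₀ g} → n ≡ n₀ ℕ.* (g ℕ.* g) → + c * + n ≡ + c * + n₀ * (+ g * + g)
pos-*-square {c} {n} {n₀} {g} e = trans (cong (λ k → + c * + k) e) (trans (cong (+ c *_) (trans (ℤₚ.pos-* n₀ (g ℕ.* g)) (cong (+ n₀ *_) (ℤₚ.pos-* g g)))) (sym (ℤₚ.*-assoc (+ c) (+ n₀) (+ g * + g))))

-- The square-free part of n is odd or twice an odd number, which are the cases E = 1 and E = 2 of
-- `odd-squarefree-eisenstein`.
eisenstein-represents-all : ∀ {n} → 0 ℕ.< n → ¬ (3 ℕ∣.∣ n) → Represented eisenstein₁ (+ n)
eisenstein-represents-all {n} 0<n 3∤n with squareFreePart 0<n
... | n₀ , g , n≡ , sqf = subst (Represented eisenstein₁) (sym (trans (cong +_ n≡) (trans (ℤₚ.pos-* n₀ (g ℕ.* g)) (cong (+ n₀ *_) (ℤₚ.pos-* g g))))) (represented-scale eisenstein₁ (+ g) (base (halves n₀)))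
  where
  n₀∣n : n₀ ℕ∣.∣ n
  n₀∣n = subst (n₀ ℕ∣.∣_) (sym n≡) (ℕ∣.m∣m*n (g ℕ.* g))
  base : Σ[ j ∈ ℕ ] (n₀ ≡ j ℕ.+ j ⊎ n₀ ≡ suc (j ℕ.+ j)) → Represented eisenstein₁ (+ n₀)
  base (j , inj₂ e) = subst (λ k → Represented eisenstein₁ (+ k)) (ℕₚ.*-identityˡ n₀)
    (odd-squarefree-eisenstein {n₀} {1} {2} (odd-od j e) sqf (λ d → 3∤n (ℕ∣.∣-trans d n₀∣n)) refl (s≤s z≤n))
  base (j , inj₁ e) = subst (λ k → Represented eisenstein₁ (+ k)) (sym n₀≡)
    (odd-squarefree-eisenstein {j} {2} {1} (oj (halves j)) (λ p pp d → sqf p pp (ℕ∣.∣-trans d j∣n₀)) (λ d → 3∤n (ℕ∣.∣-trans d (ℕ∣.∣-trans j∣n₀ n₀∣n))) refl (s≤s z≤n))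
    where
    n₀≡ : n₀ ≡ 2 ℕ.* j
    n₀≡ = trans e (cong (j ℕ.+_) (sym (ℕₚ.+-identityʳ j)))
    j∣n₀ : j ℕ∣.∣ n₀
    j∣n₀ = ℕ∣.divides 2 n₀≡
    oj : Σ[ i ∈ ℕ ] (j ≡ i ℕ.+ i ⊎ j ≡ suc (i ℕ.+ i)) → Odd j
    oj (i , inj₂ e') = odd-od i e'
    oj (i , inj₁ e') = ⊥-elim (sqf 2 Primality.prime[2] (ℕ∣.divides i (trans n₀≡ (trans (cong (2 ℕ.*_) e') (lemma i)))))
      where
      lemma : ∀ i → 2 ℕ.* (i ℕ.+ i) ≡ i ℕ.* 4
      lemma = ℕSolver.solve-∀

data Mod3 (x : ℤ) : Set where
  zero₃ : x ≈ 0ℤ [ + 3 ] → Mod3 x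
  one₃  : x ≈ 1ℤ [ + 3 ] → Mod3 x
  two₃  : x ≈ + 2 [ + 3 ] → Mod3 x

mod3 : ∀ x → Mod3 x
mod3 x = go (x ℤ/.%ℕ 3) (rem-≈ x 3) (ℤ/.n%ℕd<d x 3)
  where
  go : ∀ r → x ≈ + r [ + 3 ] → r ℕ.< 3 → Mod3 x
  go 0 e _ = zero₃ e
  go 1 e _ = one₃ e
  go 2 e _ = two₃ e
  go (suc (suc (suc r))) _ (s≤s (s≤s (s≤s ())))

mod3-square : ∀ x → (x * x ≈ 0ℤ [ + 3 ] × x ≈ 0ℤ [ + 3 ]) ⊎ x * x ≈ 1ℤ [ + 3 ]
mod3-square x with mod3 x
... | zero₃ e = inj₁ (*-cong e e , e)
... | one₃ e = inj₂ (*-cong e e)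
... | two₃ e = inj₂ (≈-trans (*-cong e e) (by 1ℤ refl))

clash : ∀ {a b} m .{{_ : NonZero m}} → (a ℤ/.%ℕ m ≡ b ℤ/.%ℕ m → ⊥) → a ≈ b [ + m ] → ⊥
clash m ne e = ne (rem-cong m e)

-- As 3 does not divide n = n₀ g², g² ≡ 1 modulo 3 and the square-free part keeps the residue 2.
eisenstein-represents-all-6 : ∀ {n} → Odd n → + n ≈ + 2 [ + 3 ] → Represented eisenstein₁ (+ 3 * + (2 ℕ.* n))
eisenstein-represents-all-6 {n} on n≈2 with squareFreePart (ℤₚ.drop‿+<+ (odd>0 on))
... | n₀ , g , n≡ , sqf = subst (Represented eisenstein₁) scaled (represented-scale eisenstein₁ (+ g) (odd-squarefree-eisenstein-6 (odd-∣ (subst (n₀ ℕ∣.∣_) (sym n≡) (ℕ∣.m∣m*n (g ℕ.* g))) on) sqf (go (mod3-square (+ g)))))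
  where
  2≈n₀g² : + 2 ≈ + n₀ * (+ g * + g) [ + 3 ]
  2≈n₀g² = ≈-trans (≈-sym n≈2) (≈-reflexive (trans (cong +_ n≡) (trans (ℤₚ.pos-* n₀ (g ℕ.* g)) (cong (+ n₀ *_) (ℤₚ.pos-* g g)))))
  go : (+ g * + g ≈ 0ℤ [ + 3 ] × + g ≈ 0ℤ [ + 3 ]) ⊎ + g * + g ≈ 1ℤ [ + 3 ] → + n₀ ≈ + 2 [ + 3 ]
  go (inj₁ (e , _)) = ⊥-elim (clash 3 (λ ()) (≈-trans 2≈n₀g² (≈-trans (*-congˡ (+ n₀) e) (≈-reflexive (ℤₚ.*-zeroʳ (+ n₀))))))
  go (inj₂ e) = ≈-sym (≈-trans 2≈n₀g² (≈-trans (*-congˡ (+ n₀) e) (≈-reflexive (ℤₚ.*-identityʳ (+ n₀)))))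
  scaled : + 3 * + (2 ℕ.* n₀) * (+ g * + g) ≡ + 3 * + (2 ℕ.* n)
  scaled = sym (trans (pos-*-square {3} {2 ℕ.* n} {2 ℕ.* n₀} {g} (trans (cong (2 ℕ.*_) n≡) (sym (ℕₚ.*-assoc 2 n₀ (g ℕ.* g))))) refl)

squares-represent-all-5 : ∀ {M} → OddResidue M 7 → ¬ (5 ℕ∣.∣ M) → Represented squares₃ (+ 5 * + M)
squares-represent-all-5 {M} rM 5∤M with squareFreePart (ℤₚ.drop‿+<+ (odd>0 (residue-odd rM)))
... | n₀ , g , n≡ , sqf = subst (Represented squares₃) (sym (trans (pos-*-square {5} {M} {n₀} {g} n≡) (cong (_* (+ g * + g)) (sym (ℤₚ.pos-* 5 n₀)))))
    (represented-scale squares₃ (+ g) (odd-squarefree-squares (residue-from 7 seven refl n₀≈7) sqf (λ d → 5∤M (subst (5 ℕ∣.∣_) (sym n≡) (ℕ∣.∣m⇒∣m*n (g ℕ.* g) d)))))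
  where
  n₀≈7 : + n₀ ≈ + 7 [ + 8 ]
  n₀≈7 = ≈-trans (≈-reflexive (sym (ℤₚ.*-identityʳ (+ n₀)))) (≈-trans (*-congˡ (+ n₀) (≈-sym (odd-square-≈1 (odd-∣ (subst (g ℕ∣.∣_) (sym n≡) (ℕ∣.∣n⇒∣m*n n₀ (ℕ∣.m∣m*n g))) (residue-odd rM)))))
    (≈-trans (≈-reflexive (sym (trans (cong +_ n≡) (trans (ℤₚ.pos-* n₀ (g ℕ.* g)) (cong (+ n₀ *_) (ℤₚ.pos-* g g)))))) (residue-≈-8 rM)))

-- From the forms to the six tuples

data Parity : ℤ → Set where
  even : ∀ k → Parity (k * + 2)
  odd  : ∀ k → Parity (1ℤ + k * + 2)

parity : ∀ x → Parity x
parity x = go (x ℤ/.%ℕ 2) (x ℤ/./ℕ 2) (ℤ/.a≡a%ℕn+[a/ℕn]*n x 2) (ℤ/.n%ℕd<d x 2)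
  where
  go : ∀ r q → x ≡ + r + q * + 2 → r ℕ.< 2 → Parity x
  go 0 q e _ = subst Parity (sym (trans e (ℤₚ.+-identityˡ (q * + 2)))) (even q)
  go 1 q e _ = subst Parity (sym e) (odd q)
  go (suc (suc r)) _ _ (s≤s (s≤s ()))

even² : ∀ k → k * + 2 * (k * + 2) ≈ 0ℤ [ + 4 ]
even² k = by (k * k) (lemma k)
  where
  lemma : ∀ k → k * + 2 * (k * + 2) ≡ 0ℤ + k * k * + 4
  lemma = solve-∀

odd² : ∀ k → (1ℤ + k * + 2) * (1ℤ + k * + 2) ≈ 1ℤ [ + 4 ]
odd² k = by (k + k * k) (lemma k)
  where
  lemma : ∀ k → (1ℤ + k * + 2) * (1ℤ + k * + 2) ≡ 1ℤ + (k + k * k) * + 4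
  lemma = solve-∀

residue² : ∀ {x} → Parity x → ℤ
residue² (even _) = 0ℤ
residue² (odd _)  = 1ℤ

residue²-≈ : ∀ {x} (p : Parity x) → x * x ≈ residue² p [ + 4 ]
residue²-≈ (even k) = even² k
residue²-≈ (odd k)  = odd² k

-- Up to sign, an integer prime to m is congruent to a chosen half of the units modulo m.
record Normal (m : ℕ) (r x : ℤ) : Set where
  constructor normal
  field
    k      : ℤ
    square : x * x ≡ (r + + m * k) * (r + + m * k)

normal⁺ : ∀ {m r x} → x ≈ r [ + m ] → Normal m r x
normal⁺ {m} {r} (by q refl) = normal q (cong (λ y → (r + y) * (r + y)) (ℤₚ.*-comm q (+ m)))

normal⁻ : ∀ {m r x} → x ≈ - r [ + m ] → Normal m r x
normal⁻ {m} {r} (by q refl) = normal (- q) (lemma r q (+ m))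
  where
  lemma : ∀ r q m → (- r + q * m) * (- r + q * m) ≡ (r + m * - q) * (r + m * - q)
  lemma = solve-∀

crt-literal : ∀ {m n} → Unit (+ m) (+ n) → ∀ {x r} → x ≈ r [ + m ] → x ≈ r [ + n ] → x ≈ r [ + (m ℕ.* n) ]
crt-literal {m} {n} u {x} {r} p q = subst (x ≈ r [_]) (sym (ℤₚ.pos-* m n)) (crt-unique u p q)

odd≈1 : ∀ k → 1ℤ + k * + 2 ≈ 1ℤ [ + 2 ]
odd≈1 k = by k refl

unit-3-2 : Unit (+ 3) (+ 2)
unit-3-2 = unit 1ℤ (by 1ℤ refl)

unit-5-2 : Unit (+ 5) (+ 2)
unit-5-2 = unit 1ℤ (by (+ 2) refl)

normal-4 : ∀ k → Normal 4 1ℤ (1ℤ + k * + 2)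
normal-4 k with parity k
... | even j = normal⁺ (by j (lemma j))
  where
  lemma : ∀ j → 1ℤ + j * + 2 * + 2 ≡ 1ℤ + j * + 4
  lemma = solve-∀
... | odd j = normal⁻ (by (1ℤ + j) (lemma j))
  where
  lemma : ∀ j → 1ℤ + (1ℤ + j * + 2) * + 2 ≡ - 1ℤ + (1ℤ + j) * + 4
  lemma = solve-∀

normal-3 : ∀ {x} → ¬ (x ≈ 0ℤ [ + 3 ]) → Normal 3 1ℤ x
normal-3 {x} ne with mod3 x
... | zero₃ e = ⊥-elim (ne e)
... | one₃ e = normal⁺ e
... | two₃ e = normal⁻ (≈-trans e (by 1ℤ refl))

normal-6 : ∀ k → ¬ (1ℤ + k * + 2 ≈ 0ℤ [ + 3 ]) → Normal 6 1ℤ (1ℤ + k * + 2)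
normal-6 k ne with mod3 (1ℤ + k * + 2)
... | zero₃ e = ⊥-elim (ne e)
... | one₃ e = normal⁺ (crt-literal unit-3-2 e (odd≈1 k))
... | two₃ e = normal⁻ (crt-literal unit-3-2 (≈-trans e (by 1ℤ refl)) (≈-trans (odd≈1 k) (by 1ℤ refl)))

data Mod5 (x : ℤ) : Set where
  zero₅ : x ≈ 0ℤ [ + 5 ] → Mod5 x
  one₅  : ∀ s → x ≈ σ s [ + 5 ] → Mod5 x
  two₅  : ∀ s → x ≈ σ s * + 2 [ + 5 ] → Mod5 x

mod5 : ∀ x → Mod5 x
mod5 x = go (x ℤ/.%ℕ 5) (rem-≈ x 5) (ℤ/.n%ℕd<d x 5)
  where
  go : ∀ r → x ≈ + r [ + 5 ] → r ℕ.< 5 → Mod5 x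
  go 0 e _ = zero₅ e
  go 1 e _ = one₅ ⊕ e
  go 2 e _ = two₅ ⊕ e
  go 3 e _ = two₅ ⊖ (≈-trans e (by 1ℤ refl))
  go 4 e _ = one₅ ⊖ (≈-trans e (by 1ℤ refl))
  go (suc (suc (suc (suc (suc r))))) _ (s≤s (s≤s (s≤s (s≤s (s≤s ())))))

square-mod5 : ∀ {x} → Mod5 x → ℤ
square-mod5 (zero₅ _) = 0ℤ
square-mod5 (one₅ _ _) = 1ℤ
square-mod5 (two₅ _ _) = + 4

square-mod5-≈ : ∀ {x} (v : Mod5 x) → x * x ≈ square-mod5 v [ + 5 ]
square-mod5-≈ (zero₅ e) = *-cong e e
square-mod5-≈ (one₅ ⊕ e) = *-cong e e
square-mod5-≈ (one₅ ⊖ e) = *-cong e e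
square-mod5-≈ (two₅ ⊕ e) = *-cong e e
square-mod5-≈ (two₅ ⊖ e) = *-cong e e

Double₅ : ℤ → ℤ → Set
Double₅ a b = Σ[ s ∈ Sign ] a ≈ σ s * + 2 * b [ + 5 ]

data Isotropic₅ (a b c : ℤ) : Set where
  isotropic : Double₅ a b → c ≈ 0ℤ [ + 5 ] → Isotropic₅ a b c

SomeIsotropic₅ : ℤ → ℤ → ℤ → Set
SomeIsotropic₅ a b c = Isotropic₅ a b c ⊎ Isotropic₅ b a c ⊎ Isotropic₅ a c b ⊎ Isotropic₅ c a b ⊎ Isotropic₅ b c a ⊎ Isotropic₅ c b a

double-zero : ∀ {a b} → a ≈ 0ℤ [ + 5 ] → b ≈ 0ℤ [ + 5 ] → Double₅ a b
double-zero ea eb = ⊕ , ≈-trans ea (≈-sym (*-congˡ (σ ⊕ * + 2) eb))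

double-21 : ∀ {a b} s t → a ≈ σ s * + 2 [ + 5 ] → b ≈ σ t [ + 5 ] → Double₅ a b
double-21 s t ea eb = s · t , ≈-trans ea (≈-sym (≈-trans (*-congˡ (σ (s · t) * + 2) eb) (≈-reflexive (signs s t))))
  where
  signs : ∀ s t → σ (s · t) * + 2 * σ t ≡ σ s * + 2
  signs ⊕ ⊕ = refl
  signs ⊕ ⊖ = refl
  signs ⊖ ⊕ = refl
  signs ⊖ ⊖ = refl

-- Squares modulo 5 are 0, 1, 4, and three of them have sum 0 only as 0 + 0 + 0 or as 0 + 1 + 4 in
-- some order. So one variable vanishes, and one of the other two is twice the remaining one up to
-- sign.
isotropic₅ : ∀ a b c → a * a + b * b + c * c ≈ 0ℤ [ + 5 ] →
  SomeIsotropic₅ a b c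
isotropic₅ a b c e = go (mod5 a) (mod5 b) (mod5 c)
  where
  sum≈ : ∀ (u : Mod5 a) (v : Mod5 b) (w : Mod5 c) → square-mod5 u + square-mod5 v + square-mod5 w ≈ 0ℤ [ + 5 ]
  sum≈ u v w = ≈-trans (≈-sym (+-cong (+-cong (square-mod5-≈ u) (square-mod5-≈ v)) (square-mod5-≈ w))) e
  go : Mod5 a → Mod5 b → Mod5 c → SomeIsotropic₅ a b c
  go (zero₅ e0) (zero₅ e1) (zero₅ e2) = inj₁ (isotropic (double-zero e0 e1) e2)
  go u0@(zero₅ _) u1@(zero₅ _) u2@(one₅ _ _) = ⊥-elim (clash 5 (λ ()) (sum≈ u0 u1 u2))
  go u0@(zero₅ _) u1@(zero₅ _) u2@(two₅ _ _) = ⊥-elim (clash 5 (λ ()) (sum≈ u0 u1 u2))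
  go u0@(zero₅ _) u1@(one₅ _ _) u2@(zero₅ _) = ⊥-elim (clash 5 (λ ()) (sum≈ u0 u1 u2))
  go u0@(zero₅ _) u1@(one₅ _ _) u2@(one₅ _ _) = ⊥-elim (clash 5 (λ ()) (sum≈ u0 u1 u2))
  go (zero₅ e0) (one₅ s1 e1) (two₅ s2 e2) = inj₂ (inj₂ (inj₂ (inj₂ (inj₂ (isotropic (double-21 s2 s1 e2 e1) e0)))))
  go u0@(zero₅ _) u1@(two₅ _ _) u2@(zero₅ _) = ⊥-elim (clash 5 (λ ()) (sum≈ u0 u1 u2))
  go (zero₅ e0) (two₅ s1 e1) (one₅ s2 e2) = inj₂ (inj₂ (inj₂ (inj₂ (inj₁ (isotropic (double-21 s1 s2 e1 e2) e0)))))
  go u0@(zero₅ _) u1@(two₅ _ _) u2@(two₅ _ _) = ⊥-elim (clash 5 (λ ()) (sum≈ u0 u1 u2))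
  go u0@(one₅ _ _) u1@(zero₅ _) u2@(zero₅ _) = ⊥-elim (clash 5 (λ ()) (sum≈ u0 u1 u2))
  go u0@(one₅ _ _) u1@(zero₅ _) u2@(one₅ _ _) = ⊥-elim (clash 5 (λ ()) (sum≈ u0 u1 u2))
  go (one₅ s0 e0) (zero₅ e1) (two₅ s2 e2) = inj₂ (inj₂ (inj₂ (inj₁ (isotropic (double-21 s2 s0 e2 e0) e1))))
  go u0@(one₅ _ _) u1@(one₅ _ _) u2@(zero₅ _) = ⊥-elim (clash 5 (λ ()) (sum≈ u0 u1 u2))
  go u0@(one₅ _ _) u1@(one₅ _ _) u2@(one₅ _ _) = ⊥-elim (clash 5 (λ ()) (sum≈ u0 u1 u2))
  go u0@(one₅ _ _) u1@(one₅ _ _) u2@(two₅ _ _) = ⊥-elim (clash 5 (λ ()) (sum≈ u0 u1 u2))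
  go (one₅ s0 e0) (two₅ s1 e1) (zero₅ e2) = inj₂ (inj₁ (isotropic (double-21 s1 s0 e1 e0) e2))
  go u0@(one₅ _ _) u1@(two₅ _ _) u2@(one₅ _ _) = ⊥-elim (clash 5 (λ ()) (sum≈ u0 u1 u2))
  go u0@(one₅ _ _) u1@(two₅ _ _) u2@(two₅ _ _) = ⊥-elim (clash 5 (λ ()) (sum≈ u0 u1 u2))
  go u0@(two₅ _ _) u1@(zero₅ _) u2@(zero₅ _) = ⊥-elim (clash 5 (λ ()) (sum≈ u0 u1 u2))
  go (two₅ s0 e0) (zero₅ e1) (one₅ s2 e2) = inj₂ (inj₂ (inj₁ (isotropic (double-21 s0 s2 e0 e2) e1)))
  go u0@(two₅ _ _) u1@(zero₅ _) u2@(two₅ _ _) = ⊥-elim (clash 5 (λ ()) (sum≈ u0 u1 u2))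
  go (two₅ s0 e0) (one₅ s1 e1) (zero₅ e2) = inj₁ (isotropic (double-21 s0 s1 e0 e1) e2)
  go u0@(two₅ _ _) u1@(one₅ _ _) u2@(one₅ _ _) = ⊥-elim (clash 5 (λ ()) (sum≈ u0 u1 u2))
  go u0@(two₅ _ _) u1@(one₅ _ _) u2@(two₅ _ _) = ⊥-elim (clash 5 (λ ()) (sum≈ u0 u1 u2))
  go u0@(two₅ _ _) u1@(two₅ _ _) u2@(zero₅ _) = ⊥-elim (clash 5 (λ ()) (sum≈ u0 u1 u2))
  go u0@(two₅ _ _) u1@(two₅ _ _) u2@(one₅ _ _) = ⊥-elim (clash 5 (λ ()) (sum≈ u0 u1 u2))
  go u0@(two₅ _ _) u1@(two₅ _ _) u2@(two₅ _ _) = ⊥-elim (clash 5 (λ ()) (sum≈ u0 u1 u2))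

data OneDivisible₅ (w x y : ℤ) : Set where
  oneDivisible : x ≈ 0ℤ [ + 5 ] → (y ≈ w [ + 5 ] ⊎ y ≈ - w [ + 5 ]) → OneDivisible₅ w x y

signed : ∀ {y} s → y ≈ σ s [ + 5 ] → y ≈ 1ℤ [ + 5 ] ⊎ y ≈ - 1ℤ [ + 5 ]
signed ⊕ e = inj₁ e
signed ⊖ e = inj₂ e

-- ±2 is written as ∓3 because an odd representative is needed to pass to the modulus 10.
signed-2 : ∀ {y} s → y ≈ σ s * + 2 [ + 5 ] → y ≈ + 3 [ + 5 ] ⊎ y ≈ - (+ 3) [ + 5 ]
signed-2 ⊕ e = inj₂ (≈-trans e (by 1ℤ refl))
signed-2 ⊖ e = inj₁ (≈-trans e (by -1ℤ refl))

oneDivisible-1 : ∀ x y → x * x + y * y ≈ 1ℤ [ + 5 ] → OneDivisible₅ 1ℤ x y ⊎ OneDivisible₅ 1ℤ y x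
oneDivisible-1 x y e = go (mod5 x) (mod5 y)
  where
  sum≈ : ∀ (u : Mod5 x) (v : Mod5 y) → square-mod5 u + square-mod5 v ≈ 1ℤ [ + 5 ]
  sum≈ u v = ≈-trans (≈-sym (+-cong (square-mod5-≈ u) (square-mod5-≈ v))) e
  go : Mod5 x → Mod5 y → OneDivisible₅ 1ℤ x y ⊎ OneDivisible₅ 1ℤ y x
  go u0@(zero₅ _) u1@(zero₅ _) = ⊥-elim (clash 5 (λ ()) (sum≈ u0 u1))
  go (zero₅ e0) (one₅ s1 e1) = inj₁ (oneDivisible e0 (signed s1 e1))
  go u0@(zero₅ _) u1@(two₅ _ _) = ⊥-elim (clash 5 (λ ()) (sum≈ u0 u1))
  go (one₅ s0 e0) (zero₅ e1) = inj₂ (oneDivisible e1 (signed s0 e0))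
  go u0@(one₅ _ _) u1@(one₅ _ _) = ⊥-elim (clash 5 (λ ()) (sum≈ u0 u1))
  go u0@(one₅ _ _) u1@(two₅ _ _) = ⊥-elim (clash 5 (λ ()) (sum≈ u0 u1))
  go u0@(two₅ _ _) u1@(zero₅ _) = ⊥-elim (clash 5 (λ ()) (sum≈ u0 u1))
  go u0@(two₅ _ _) u1@(one₅ _ _) = ⊥-elim (clash 5 (λ ()) (sum≈ u0 u1))
  go u0@(two₅ _ _) u1@(two₅ _ _) = ⊥-elim (clash 5 (λ ()) (sum≈ u0 u1))

oneDivisible-4 : ∀ x y → x * x + y * y ≈ + 4 [ + 5 ] → OneDivisible₅ (+ 3) x y ⊎ OneDivisible₅ (+ 3) y x
oneDivisible-4 x y e = go (mod5 x) (mod5 y)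
  where
  sum≈ : ∀ (u : Mod5 x) (v : Mod5 y) → square-mod5 u + square-mod5 v ≈ + 4 [ + 5 ]
  sum≈ u v = ≈-trans (≈-sym (+-cong (square-mod5-≈ u) (square-mod5-≈ v))) e
  go : Mod5 x → Mod5 y → OneDivisible₅ (+ 3) x y ⊎ OneDivisible₅ (+ 3) y x
  go u0@(zero₅ _) u1@(zero₅ _) = ⊥-elim (clash 5 (λ ()) (sum≈ u0 u1))
  go u0@(zero₅ _) u1@(one₅ _ _) = ⊥-elim (clash 5 (λ ()) (sum≈ u0 u1))
  go (zero₅ e0) (two₅ s1 e1) = inj₁ (oneDivisible e0 (signed-2 s1 e1))
  go u0@(one₅ _ _) u1@(zero₅ _) = ⊥-elim (clash 5 (λ ()) (sum≈ u0 u1))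
  go u0@(one₅ _ _) u1@(one₅ _ _) = ⊥-elim (clash 5 (λ ()) (sum≈ u0 u1))
  go u0@(one₅ _ _) u1@(two₅ _ _) = ⊥-elim (clash 5 (λ ()) (sum≈ u0 u1))
  go (two₅ s0 e0) (zero₅ e1) = inj₂ (oneDivisible e1 (signed-2 s0 e0))
  go u0@(two₅ _ _) u1@(one₅ _ _) = ⊥-elim (clash 5 (λ ()) (sum≈ u0 u1))
  go u0@(two₅ _ _) u1@(two₅ _ _) = ⊥-elim (clash 5 (λ ()) (sum≈ u0 u1))

-- The form x² + y² + 5z² and the two tuples beginning with 20, 10

Form-1-1-5 : ℤ → Set
Form-1-1-5 m = Σ[ x ∈ ℤ ] Σ[ y ∈ ℤ ] Σ[ z ∈ ℤ ] m ≡ x * x + y * y + + 5 * (z * z)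

-- For a = ±2b + 5k one has a² + b² = 5((b ± 2k)² + k²), which is division by a Gaussian integer of
-- norm 5; and c² = 25z².
descend-5 : ∀ {m a b c} → + 5 * m ≡ a * a + b * b + c * c → Isotropic₅ a b c → Form-1-1-5 m
descend-5 {m} {a} {b} {c} e (isotropic (s , by k a≡) (by z c≡)) = b + σ s * + 2 * k , k , z ,
  ℤₚ.*-cancelˡ-≡ (+ 5) m _ (trans e (trans (cong₂ (λ x y → x * x + b * b + y * y) a≡ (trans c≡ (ℤₚ.+-identityˡ (z * + 5)))) (go s)))
  where
  go : ∀ s → (σ s * + 2 * b + k * + 5) * (σ s * + 2 * b + k * + 5) + b * b + z * + 5 * (z * + 5) ≡ + 5 * ((b + σ s * + 2 * k) * (b + σ s * + 2 * k) + k * k + + 5 * (z * z))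
  go ⊕ = lemma b k z
    where
    lemma : ∀ b k z → (1ℤ * + 2 * b + k * + 5) * (1ℤ * + 2 * b + k * + 5) + b * b + z * + 5 * (z * + 5) ≡ + 5 * ((b + 1ℤ * + 2 * k) * (b + 1ℤ * + 2 * k) + k * k + + 5 * (z * z))
    lemma = solve-∀
  go ⊖ = lemma b k z
    where
    lemma : ∀ b k z → (-1ℤ * + 2 * b + k * + 5) * (-1ℤ * + 2 * b + k * + 5) + b * b + z * + 5 * (z * + 5) ≡ + 5 * ((b + -1ℤ * + 2 * k) * (b + -1ℤ * + 2 * k) + k * k + + 5 * (z * z))
    lemma = solve-∀

descend-squares : ∀ {m} → Represented squares₃ (+ 5 * m) → Form-1-1-5 m
descend-squares {m} (a , b , c , e) = go (isotropic₅ a b c (≈-trans (≈-reflexive (sym 5m≡)) (by m (trans (ℤₚ.*-comm (+ 5) m) (sym (ℤₚ.+-identityˡ (m * + 5)))))))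
  where
  simplify : ∀ a b c → 1ℤ * a * a + 1ℤ * b * b + 1ℤ * c * c + 0ℤ * b * c + 0ℤ * a * c + 0ℤ * a * b ≡ a * a + b * b + c * c
  simplify = solve-∀
  5m≡ : + 5 * m ≡ a * a + b * b + c * c
  5m≡ = trans e (simplify a b c)
  p₁ : ∀ a b c → a * a + b * b + c * c ≡ b * b + a * a + c * c
  p₁ = solve-∀
  p₂ : ∀ a b c → a * a + b * b + c * c ≡ a * a + c * c + b * b
  p₂ = solve-∀
  p₃ : ∀ a b c → a * a + b * b + c * c ≡ c * c + a * a + b * b
  p₃ = solve-∀
  p₄ : ∀ a b c → a * a + b * b + c * c ≡ b * b + c * c + a * a
  p₄ = solve-∀
  p₅ : ∀ a b c → a * a + b * b + c * c ≡ c * c + b * b + a * a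
  p₅ = solve-∀
  go : SomeIsotropic₅ a b c → Form-1-1-5 m
  go (inj₁ i) = descend-5 5m≡ i
  go (inj₂ (inj₁ i)) = descend-5 (trans 5m≡ (p₁ a b c)) i
  go (inj₂ (inj₂ (inj₁ i))) = descend-5 (trans 5m≡ (p₂ a b c)) i
  go (inj₂ (inj₂ (inj₂ (inj₁ i)))) = descend-5 (trans 5m≡ (p₃ a b c)) i
  go (inj₂ (inj₂ (inj₂ (inj₂ (inj₁ i))))) = descend-5 (trans 5m≡ (p₄ a b c)) i
  go (inj₂ (inj₂ (inj₂ (inj₂ (inj₂ i))))) = descend-5 (trans 5m≡ (p₅ a b c)) i

represents-115 : ∀ {m} → OddResidue m 7 → ¬ (5 ℕ∣.∣ m) → Form-1-1-5 (+ m)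
represents-115 {m} rm 5∤m = descend-squares (squares-represent-all-5 rm 5∤m)

IsOdd : ℤ → Set
IsOdd x = Σ[ i ∈ ℤ ] x ≡ 1ℤ + i * + 2

all-odd : ∀ {m} x y z → m ≈ + 3 [ + 4 ] → m ≡ x * x + y * y + + 5 * (z * z) → IsOdd x × IsOdd y × IsOdd z
all-odd {m} x y z m≈3 e = go (parity x) (parity y) (parity z)
  where
  sum : ∀ (p : Parity x) (q : Parity y) (r : Parity z) → residue² p + residue² q + + 5 * residue² r ≈ + 3 [ + 4 ]
  sum p q r = ≈-trans (≈-sym (+-cong (+-cong (residue²-≈ p) (residue²-≈ q)) (*-congˡ (+ 5) (residue²-≈ r)))) (≈-trans (≈-reflexive (sym e)) m≈3)
  go : Parity x → Parity y → Parity z → IsOdd x × IsOdd y × IsOdd z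
  go (odd i) (odd j) (odd k) = (i , refl) , (j , refl) , (k , refl)
  go p@(even _) q@(even _) r@(even _) = ⊥-elim (clash 4 (λ ()) (sum p q r))
  go p@(even _) q@(even _) r@(odd _)  = ⊥-elim (clash 4 (λ ()) (sum p q r))
  go p@(even _) q@(odd _)  r@(even _) = ⊥-elim (clash 4 (λ ()) (sum p q r))
  go p@(even _) q@(odd _)  r@(odd _)  = ⊥-elim (clash 4 (λ ()) (sum p q r))
  go p@(odd _)  q@(even _) r@(even _) = ⊥-elim (clash 4 (λ ()) (sum p q r))
  go p@(odd _)  q@(even _) r@(odd _)  = ⊥-elim (clash 4 (λ ()) (sum p q r))
  go p@(odd _)  q@(odd _)  r@(even _) = ⊥-elim (clash 4 (λ ()) (sum p q r))

Form-25-1-5 : ℤ → ℤ → Set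
Form-25-1-5 c m = Σ[ u ∈ ℤ ] Σ[ v ∈ ℤ ] Σ[ w ∈ ℤ ] m ≡ + 25 * ((1ℤ + + 4 * u) * (1ℤ + + 4 * u)) + (c + + 10 * v) * (c + + 10 * v) + + 5 * ((1ℤ + + 4 * w) * (1ℤ + + 4 * w))

normalise-25-1-5 : ∀ {c m} i j k → c ≈ 1ℤ [ + 2 ] → m ≡ (1ℤ + i * + 2) * (1ℤ + i * + 2) + (1ℤ + j * + 2) * (1ℤ + j * + 2) + + 5 * ((1ℤ + k * + 2) * (1ℤ + k * + 2)) →
  OneDivisible₅ c (1ℤ + i * + 2) (1ℤ + j * + 2) → Form-25-1-5 c m
normalise-25-1-5 {c} {m} i j k c≈1 e (oneDivisible (by q x≡) y≈) = assemble (parity q) x≡ (normal-y y≈) (normal-4 k)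
  where
  y = 1ℤ + j * + 2
  normal-y : y ≈ c [ + 5 ] ⊎ y ≈ - c [ + 5 ] → Normal 10 c y
  normal-y (inj₁ y≈c) = normal⁺ (crt-literal unit-5-2 y≈c (≈-trans (odd≈1 j) (≈-sym c≈1)))
  normal-y (inj₂ y≈-c) = normal⁻ (crt-literal unit-5-2 y≈-c (≈-trans (odd≈1 j) (≈-trans (by 1ℤ refl) (neg-cong (≈-sym c≈1)))))
  lemma : ∀ u → (0ℤ + u * + 5) * (0ℤ + u * + 5) ≡ + 25 * (u * u)
  lemma = solve-∀
  assemble : ∀ {q} → Parity q → 1ℤ + i * + 2 ≡ 0ℤ + q * + 5 → Normal 10 c y → Normal 4 1ℤ (1ℤ + k * + 2) → Form-25-1-5 c m
  assemble (even l) x≡ _ _ = ⊥-elim (clash {1ℤ} {0ℤ} 2 (λ ()) (≈-trans (≈-sym (odd≈1 i)) (≈-trans (≈-reflexive x≡) (by (l * + 5) (swap l)))))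
    where
    swap : ∀ l → 0ℤ + l * + 2 * + 5 ≡ 0ℤ + l * + 5 * + 2
    swap = solve-∀
  assemble (odd l) x≡ (normal v y²) (normal w z²) = combine (normal-4 l)
    where
    combine : Normal 4 1ℤ (1ℤ + l * + 2) → Form-25-1-5 c m
    combine (normal u x²) = u , v , w , trans e (cong₂ _+_ (cong₂ _+_ (trans (cong (λ x → x * x) x≡) (trans (lemma (1ℤ + l * + 2)) (cong (+ 25 *_) x²))) y²) (cong (+ 5 *_) z²))

-- m ≡ 3 modulo 4 forces x, y, z to be odd. By `choose`, the residue of m modulo 5 makes one of x, y
-- a multiple of 5 and the other ±c modulo 5; it is then ±c modulo 10, as both are odd.
form-25-1-5 : ∀ {m} c → c ≈ 1ℤ [ + 2 ] → OddResidue m 7 → ¬ (5 ℕ∣.∣ m) →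
  (∀ x y → x * x + y * y ≈ + m [ + 5 ] → OneDivisible₅ c x y ⊎ OneDivisible₅ c y x) → Form-25-1-5 c (+ m)
form-25-1-5 {m} c c≈1 rm 5∤m choose = fromForm (represents-115 rm 5∤m)
  where
  lemma : ∀ a b c → a + b ≡ a + b + + 5 * c + - c * + 5
  lemma = solve-∀
  m≈3 : + m ≈ + 3 [ + 4 ]
  m≈3 = ≈-trans (≈-weaken (divides (+ 2) refl) (residue-≈-8 rm)) (by 1ℤ refl)
  oddForm : ∀ i j k → + m ≡ (1ℤ + i * + 2) * (1ℤ + i * + 2) + (1ℤ + j * + 2) * (1ℤ + j * + 2) + + 5 * ((1ℤ + k * + 2) * (1ℤ + k * + 2)) → Form-25-1-5 c (+ m)
  oddForm i j k e = go (choose X Y (≈-trans (by (- (Z * Z)) (lemma (X * X) (Y * Y) (Z * Z))) (≈-reflexive (sym e))))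
    where
    X = 1ℤ + i * + 2
    Y = 1ℤ + j * + 2
    Z = 1ℤ + k * + 2
    go : OneDivisible₅ c X Y ⊎ OneDivisible₅ c Y X → Form-25-1-5 c (+ m)
    go (inj₁ d) = normalise-25-1-5 i j k c≈1 e d
    go (inj₂ d) = normalise-25-1-5 j i k c≈1 (trans e (cong (_+ + 5 * (Z * Z)) (ℤₚ.+-comm (X * X) (Y * Y)))) d
  fromForm : Form-1-1-5 (+ m) → Form-25-1-5 c (+ m)
  fromForm (x , y , z , e) = fromOdd (all-odd x y z m≈3 e)
    where
    fromOdd : IsOdd x × IsOdd y × IsOdd z → Form-25-1-5 c (+ m)
    fromOdd ((i , refl) , (j , refl) , (k , refl)) = oddForm i j k e

-- The form x² + xy + y² + z² and the other four tuples

SumForm : ℤ → Set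
SumForm m = Σ[ x ∈ ℤ ] Σ[ y ∈ ℤ ] Σ[ z ∈ ℤ ] m ≡ x * x + x * y + y * y + z * z

sumForm : ∀ {m} → Represented eisenstein₁ m → SumForm m
sumForm (x , y , z , e) = x , y , z , trans e (lemma x y z)
  where
  lemma : ∀ x y z → 1ℤ * x * x + 1ℤ * y * y + 1ℤ * z * z + 0ℤ * y * z + 0ℤ * x * z + 1ℤ * x * y ≡ x * x + x * y + y * y + z * z
  lemma = solve-∀

-- One of x, y, x + y is even. If x is, complete the square in y; if y is, in x; otherwise use (x -
-- y)/2 and (x + y)/2.
norm-1-3 : ∀ x y → Σ[ c ∈ ℤ ] Σ[ d ∈ ℤ ] x * x + x * y + y * y ≡ c * c + + 3 * (d * d)
norm-1-3 x y = go (parity x) (parity y)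
  where
  go : ∀ {x y} → Parity x → Parity y → Σ[ c ∈ ℤ ] Σ[ d ∈ ℤ ] x * x + x * y + y * y ≡ c * c + + 3 * (d * d)
  go {y = y} (even k) _ = y + k , k , lemma k y
    where
    lemma : ∀ k y → k * + 2 * (k * + 2) + k * + 2 * y + y * y ≡ (y + k) * (y + k) + + 3 * (k * k)
    lemma = solve-∀
  go {x} (odd _) (even k) = x + k , k , lemma x k
    where
    lemma : ∀ x k → x * x + x * (k * + 2) + k * + 2 * (k * + 2) ≡ (x + k) * (x + k) + + 3 * (k * k)
    lemma = solve-∀
  go (odd i) (odd j) = i - j , 1ℤ + i + j , lemma i j
    where
    lemma : ∀ i j → (1ℤ + i * + 2) * (1ℤ + i * + 2) + (1ℤ + i * + 2) * (1ℤ + j * + 2) + (1ℤ + j * + 2) * (1ℤ + j * + 2) ≡ (i - j) * (i - j) + + 3 * ((1ℤ + i + j) * (1ℤ + i + j))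
    lemma = solve-∀

TwoOddSquares : ℤ → Set
TwoOddSquares m = Σ[ i ∈ ℤ ] Σ[ j ∈ ℤ ] Σ[ e ∈ ℤ ] m ≡ (1ℤ + i * + 2) * (1ℤ + i * + 2) + (1ℤ + j * + 2) * (1ℤ + j * + 2) + + 12 * (e * e)

-- For m = c² + 3d² + z² ≡ 2 modulo 4 the only possible parities are c and z odd and d even, so 3d²
-- = 12e².
twoOddSquares : ∀ {m} → m ≈ + 2 [ + 4 ] → SumForm m → TwoOddSquares m
twoOddSquares {m} m≈2 (x , y , z , e) = withNorm (norm-1-3 x y)
  where
  withNorm : Σ[ c ∈ ℤ ] Σ[ d ∈ ℤ ] x * x + x * y + y * y ≡ c * c + + 3 * (d * d) → TwoOddSquares m
  withNorm (c , d , f) = go (parity c) (parity d) (parity z) (trans e (cong (_+ z * z) f))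
    where
    sum : ∀ {c d z} (p : Parity c) (q : Parity d) (r : Parity z) → m ≡ c * c + + 3 * (d * d) + z * z → residue² p + + 3 * residue² q + residue² r ≈ + 2 [ + 4 ]
    sum p q r e = ≈-trans (≈-sym (+-cong (+-cong (residue²-≈ p) (*-congˡ (+ 3) (residue²-≈ q))) (residue²-≈ r))) (≈-trans (≈-reflexive (sym e)) m≈2)
    go : ∀ {c d z} → Parity c → Parity d → Parity z → m ≡ c * c + + 3 * (d * d) + z * z → TwoOddSquares m
    go (odd i) (even k) (odd j) e = i , j , k , trans e (lemma i j k)
      where
      lemma : ∀ i j k → (1ℤ + i * + 2) * (1ℤ + i * + 2) + + 3 * (k * + 2 * (k * + 2)) + (1ℤ + j * + 2) * (1ℤ + j * + 2) ≡ (1ℤ + i * + 2) * (1ℤ + i * + 2) + (1ℤ + j * + 2) * (1ℤ + j * + 2) + + 12 * (k * k)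
      lemma = solve-∀
    go (even i) (even k) (even j) e = ⊥-elim (clash 4 (λ ()) (sum (even i) (even k) (even j) e))
    go (even i) (even k) (odd j) e = ⊥-elim (clash 4 (λ ()) (sum (even i) (even k) (odd j) e))
    go (even i) (odd k) (even j) e = ⊥-elim (clash 4 (λ ()) (sum (even i) (odd k) (even j) e))
    go (even i) (odd k) (odd j) e = ⊥-elim (clash 4 (λ ()) (sum (even i) (odd k) (odd j) e))
    go (odd i) (even k) (even j) e = ⊥-elim (clash 4 (λ ()) (sum (odd i) (even k) (even j) e))
    go (odd i) (odd k) (even j) e = ⊥-elim (clash 4 (λ ()) (sum (odd i) (odd k) (even j) e))
    go (odd i) (odd k) (odd j) e = ⊥-elim (clash 4 (λ ()) (sum (odd i) (odd k) (odd j) e))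

square-not-2 : ∀ x → ¬ (x * x ≈ + 2 [ + 3 ])
square-not-2 x e = go (mod3-square x)
  where
  go : (x * x ≈ 0ℤ [ + 3 ] × x ≈ 0ℤ [ + 3 ]) ⊎ x * x ≈ 1ℤ [ + 3 ] → ⊥
  go (inj₁ (p , _)) = clash {0ℤ} {+ 2} 3 (λ ()) (≈-trans (≈-sym p) e)
  go (inj₂ p) = clash {1ℤ} {+ 2} 3 (λ ()) (≈-trans (≈-sym p) e)

both-nonzero : ∀ {x y} → x * x + y * y ≈ + 2 [ + 3 ] → ¬ (x ≈ 0ℤ [ + 3 ]) × ¬ (y ≈ 0ℤ [ + 3 ])
both-nonzero {x} {y} e = (λ z → square-not-2 y (≈-trans (≈-reflexive (sym (ℤₚ.+-identityˡ (y * y)))) (≈-trans (+-cong (≈-sym (*-cong z z)) (≈-refl {y * y})) e))) ,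
  (λ z → square-not-2 x (≈-trans (≈-reflexive (sym (ℤₚ.+-identityʳ (x * x)))) (≈-trans (+-cong (≈-refl {x * x}) (≈-sym (*-cong z z))) e)))

both-zero : ∀ {x y} → x * x + y * y ≈ 0ℤ [ + 3 ] → (x ≈ 0ℤ [ + 3 ]) × (y ≈ 0ℤ [ + 3 ])
both-zero {x} {y} e = go (mod3-square x) (mod3-square y)
  where
  sum : ∀ {a b} → x * x ≈ a [ + 3 ] → y * y ≈ b [ + 3 ] → a + b ≈ 0ℤ [ + 3 ]
  sum p q = ≈-trans (≈-sym (+-cong p q)) e
  go : (x * x ≈ 0ℤ [ + 3 ] × x ≈ 0ℤ [ + 3 ]) ⊎ x * x ≈ 1ℤ [ + 3 ] → (y * y ≈ 0ℤ [ + 3 ] × y ≈ 0ℤ [ + 3 ]) ⊎ y * y ≈ 1ℤ [ + 3 ] → (x ≈ 0ℤ [ + 3 ]) × (y ≈ 0ℤ [ + 3 ])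
  go (inj₁ (_ , p)) (inj₁ (_ , q)) = p , q
  go (inj₁ (p , _)) (inj₂ q) = ⊥-elim (clash {0ℤ + 1ℤ} {0ℤ} 3 (λ ()) (sum p q))
  go (inj₂ p) (inj₁ (q , _)) = ⊥-elim (clash {1ℤ + 0ℤ} {0ℤ} 3 (λ ()) (sum p q))
  go (inj₂ p) (inj₂ q) = ⊥-elim (clash {1ℤ + 1ℤ} {0ℤ} 3 (λ ()) (sum p q))

one-zero : ∀ {x y} → x * x + y * y ≈ 1ℤ [ + 3 ] → (x ≈ 0ℤ [ + 3 ] × ¬ (y ≈ 0ℤ [ + 3 ])) ⊎ (y ≈ 0ℤ [ + 3 ] × ¬ (x ≈ 0ℤ [ + 3 ]))
one-zero {x} {y} e = go (mod3-square x) (mod3-square y)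
  where
  sum : ∀ {a b} → x * x ≈ a [ + 3 ] → y * y ≈ b [ + 3 ] → a + b ≈ 1ℤ [ + 3 ]
  sum p q = ≈-trans (≈-sym (+-cong p q)) e
  nonzero : ∀ {z} → z * z ≈ 1ℤ [ + 3 ] → ¬ (z ≈ 0ℤ [ + 3 ])
  nonzero p q = clash {1ℤ} {0ℤ} 3 (λ ()) (≈-trans (≈-sym p) (*-cong q q))
  go : (x * x ≈ 0ℤ [ + 3 ] × x ≈ 0ℤ [ + 3 ]) ⊎ x * x ≈ 1ℤ [ + 3 ] → (y * y ≈ 0ℤ [ + 3 ] × y ≈ 0ℤ [ + 3 ]) ⊎ y * y ≈ 1ℤ [ + 3 ] →
    (x ≈ 0ℤ [ + 3 ] × ¬ (y ≈ 0ℤ [ + 3 ])) ⊎ (y ≈ 0ℤ [ + 3 ] × ¬ (x ≈ 0ℤ [ + 3 ]))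
  go (inj₁ (_ , p)) (inj₂ q) = inj₁ (p , nonzero q)
  go (inj₂ p) (inj₁ (_ , q)) = inj₂ (q , nonzero p)
  go (inj₁ (p , _)) (inj₁ (q , _)) = ⊥-elim (clash {0ℤ + 0ℤ} {1ℤ} 3 (λ ()) (sum p q))
  go (inj₂ p) (inj₂ q) = ⊥-elim (clash {1ℤ + 1ℤ} {1ℤ} 3 (λ ()) (sum p q))

Form-9-1-12 : ℤ → Set
Form-9-1-12 m = Σ[ u ∈ ℤ ] Σ[ v ∈ ℤ ] Σ[ w ∈ ℤ ] m ≡ + 9 * ((1ℤ + + 4 * u) * (1ℤ + + 4 * u)) + (1ℤ + + 6 * v) * (1ℤ + + 6 * v) + + 12 * (w * w)

-- The sum of the two odd squares is 1 modulo 3, so exactly one of them is divisible by 3 and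
-- supplies the coefficient 9.
form-9-1-12 : ∀ {m} → m ≈ 1ℤ [ + 3 ] → TwoOddSquares m → Form-9-1-12 m
form-9-1-12 {m} m≈1 (i , j , e , eq) = go (one-zero (≈-trans (by (- (+ 4 * (e * e))) (lemma X Y (e * e))) (≈-trans (≈-reflexive (sym eq)) m≈1)))
  where
  X Y : ℤ
  X = 1ℤ + i * + 2
  Y = 1ℤ + j * + 2
  lemma : ∀ x y e → x * x + y * y ≡ x * x + y * y + + 12 * e + - (+ 4 * e) * + 3
  lemma = solve-∀
  nine : ∀ q → (0ℤ + q * + 3) * (0ℤ + q * + 3) ≡ + 9 * (q * q)
  nine = solve-∀
  assemble : ∀ i j → m ≡ (1ℤ + i * + 2) * (1ℤ + i * + 2) + (1ℤ + j * + 2) * (1ℤ + j * + 2) + + 12 * (e * e) → 1ℤ + i * + 2 ≈ 0ℤ [ + 3 ] → Normal 6 1ℤ (1ℤ + j * + 2) → Form-9-1-12 m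
  assemble i j eq (by q x≡) (normal v y²) = third (parity q) x≡
    where
    third : ∀ {q} → Parity q → 1ℤ + i * + 2 ≡ 0ℤ + q * + 3 → Form-9-1-12 m
    third (even l) x≡ = ⊥-elim (clash {1ℤ} {0ℤ} 2 (λ ()) (≈-trans (≈-sym (odd≈1 i)) (≈-trans (≈-reflexive x≡) (by (l * + 3) (swap l)))))
      where
      swap : ∀ l → 0ℤ + l * + 2 * + 3 ≡ 0ℤ + l * + 3 * + 2
      swap = solve-∀
    third (odd l) x≡ = combine (normal-4 l)
      where
      combine : Normal 4 1ℤ (1ℤ + l * + 2) → Form-9-1-12 m
      combine (normal u x²) = u , v , e , trans eq (cong (_+ + 12 * (e * e)) (cong₂ _+_ (trans (cong (λ x → x * x) x≡) (trans (nine (1ℤ + l * + 2)) (cong (+ 9 *_) x²))) y²))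
  go : (X ≈ 0ℤ [ + 3 ] × ¬ (Y ≈ 0ℤ [ + 3 ])) ⊎ (Y ≈ 0ℤ [ + 3 ] × ¬ (X ≈ 0ℤ [ + 3 ])) → Form-9-1-12 m
  go (inj₁ (x≈0 , y≉0)) = assemble i j eq x≈0 (normal-6 j y≉0)
  go (inj₂ (y≈0 , x≉0)) = assemble j i (trans eq (cong (_+ + 12 * (e * e)) (ℤₚ.+-comm (X * X) (Y * Y)))) y≈0 (normal-6 i x≉0)

Form-6-4-1 : ℤ → Set
Form-6-4-1 m = Σ[ u ∈ ℤ ] Σ[ v ∈ ℤ ] Σ[ w ∈ ℤ ] m ≡ + 6 * ((1ℤ + + 4 * u) * (1ℤ + + 4 * u)) + + 4 * ((1ℤ + + 3 * v) * (1ℤ + + 3 * v)) + (1ℤ + + 6 * w) * (1ℤ + + 6 * w)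

-- With 2m = X² + Y² + 12e² and X, Y odd, m is the sum of the squares of (X + Y)/2 and (X - Y)/2 and
-- of 6e². As m ≡ 3 modulo 4, e and exactly one of the two are odd; as m ≡ 2 modulo 3, neither of
-- the two is divisible by 3.
form-6-4-1 : ∀ {m} → m ≈ + 3 [ + 4 ] → m ≈ + 2 [ + 3 ] → TwoOddSquares (+ 2 * m) → Form-6-4-1 m
form-6-4-1 {m} m≈3 m≈2 (i , j , e , eq) = go (parity (1ℤ + i + j)) (parity (i - j)) (parity e) (ℤₚ.*-cancelˡ-≡ (+ 2) m _ (trans eq (lemma i j e)))
  where
  lemma : ∀ i j e → (1ℤ + i * + 2) * (1ℤ + i * + 2) + (1ℤ + j * + 2) * (1ℤ + j * + 2) + + 12 * (e * e) ≡ + 2 * ((1ℤ + i + j) * (1ℤ + i + j) + (i - j) * (i - j) + + 6 * (e * e))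
  lemma = solve-∀
  sum : ∀ {x y z} (p : Parity x) (q : Parity y) (r : Parity z) → m ≡ x * x + y * y + + 6 * (z * z) → residue² p + residue² q + + 6 * residue² r ≈ + 3 [ + 4 ]
  sum p q r e = ≈-trans (≈-sym (+-cong (+-cong (residue²-≈ p) (residue²-≈ q)) (*-congˡ (+ 6) (residue²-≈ r)))) (≈-trans (≈-reflexive (sym e)) m≈3)
  finish : ∀ k l h → m ≡ k * + 2 * (k * + 2) + (1ℤ + l * + 2) * (1ℤ + l * + 2) + + 6 * ((1ℤ + h * + 2) * (1ℤ + h * + 2)) → Form-6-4-1 m
  finish k l h e = combine (normal-4 h) (normal-3 (proj₁ nonzero)) (normal-6 l (proj₂ nonzero))
    where
    nonzero : ¬ (k ≈ 0ℤ [ + 3 ]) × ¬ (1ℤ + l * + 2 ≈ 0ℤ [ + 3 ])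
    nonzero = both-nonzero (≈-trans (by (- (k * k + + 2 * ((1ℤ + h * + 2) * (1ℤ + h * + 2)))) (shift k ((1ℤ + l * + 2) * (1ℤ + l * + 2)) ((1ℤ + h * + 2) * (1ℤ + h * + 2)))) (≈-trans (≈-reflexive (sym e)) m≈2))
      where
      shift : ∀ k l h → k * k + l ≡ k * + 2 * (k * + 2) + l + + 6 * h + - (k * k + + 2 * h) * + 3
      shift = solve-∀
    combine : Normal 4 1ℤ (1ℤ + h * + 2) → Normal 3 1ℤ k → Normal 6 1ℤ (1ℤ + l * + 2) → Form-6-4-1 m
    combine (normal u h²) (normal v k²) (normal w l²) = u , v , w , trans e (trans (reorder k ((1ℤ + l * + 2) * (1ℤ + l * + 2)) ((1ℤ + h * + 2) * (1ℤ + h * + 2))) (cong₂ _+_ (cong₂ _+_ (cong (+ 6 *_) h²) (cong (+ 4 *_) k²)) l²))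
      where
      reorder : ∀ k l h → k * + 2 * (k * + 2) + l + + 6 * h ≡ + 6 * h + + 4 * (k * k) + l
      reorder = solve-∀
  go : ∀ {p q e} → Parity p → Parity q → Parity e → m ≡ p * p + q * q + + 6 * (e * e) → Form-6-4-1 m
  go (even k) (odd l) (odd h) e = finish k l h e
  go (odd l) (even k) (odd h) e = finish k l h (trans e (cong (_+ + 6 * ((1ℤ + h * + 2) * (1ℤ + h * + 2))) (ℤₚ.+-comm ((1ℤ + l * + 2) * (1ℤ + l * + 2)) (k * + 2 * (k * + 2)))))
  go (even k) (even l) (even h) e = ⊥-elim (clash 4 (λ ()) (sum (even k) (even l) (even h) e))
  go (even k) (even l) (odd h) e = ⊥-elim (clash 4 (λ ()) (sum (even k) (even l) (odd h) e))
  go (even k) (odd l) (even h) e = ⊥-elim (clash 4 (λ ()) (sum (even k) (odd l) (even h) e))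
  go (odd k) (even l) (even h) e = ⊥-elim (clash 4 (λ ()) (sum (odd k) (even l) (even h) e))
  go (odd k) (odd l) (even h) e = ⊥-elim (clash 4 (λ ()) (sum (odd k) (odd l) (even h) e))
  go (odd k) (odd l) (odd h) e = ⊥-elim (clash 4 (λ ()) (sum (odd k) (odd l) (odd h) e))

Form-3-2-12 : ℤ → Set
Form-3-2-12 m = Σ[ u ∈ ℤ ] Σ[ v ∈ ℤ ] Σ[ w ∈ ℤ ] m ≡ + 3 * ((1ℤ + + 4 * u) * (1ℤ + + 4 * u)) + + 2 * ((1ℤ + + 3 * v) * (1ℤ + + 3 * v)) + + 12 * (w * w)

-- Modulo 3, x² + xy + y² + z² is (x - y)² + z², so 3 divides x - y and z. Division by 3 gives 2m =
-- 3v² + c² + 3d², where v, d are odd and c is even by a look modulo 4. Passing to (v + d)/2 and (v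
-- - d)/2 then gives m = 3(p² + q²) + 2V² with exactly one of p, q odd.
form-3-2-12 : ∀ {m} → m ≈ 1ℤ [ + 2 ] → m ≈ + 2 [ + 3 ] → SumForm (+ 3 * (+ 2 * m)) → Form-3-2-12 m
form-3-2-12 {m} m≈1 m≈2 (x , y , z , e) = divide (both-zero (≈-trans (by (- (x * y)) (shift x y z)) (≈-trans (≈-reflexive (sym e)) (by (+ 2 * m) (swap m)))))
  where
  shift : ∀ x y z → (x - y) * (x - y) + z * z ≡ x * x + x * y + y * y + z * z + - (x * y) * + 3
  shift = solve-∀
  swap : ∀ m → + 3 * (+ 2 * m) ≡ 0ℤ + + 2 * m * + 3
  swap = solve-∀
  2m≈2 : + 2 * m ≈ + 2 [ + 4 ]
  2m≈2 = double m≈1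
    where
    double : ∀ {m} → m ≈ 1ℤ [ + 2 ] → + 2 * m ≈ + 2 [ + 4 ]
    double (by q refl) = by q (lemma q)
      where
      lemma : ∀ q → + 2 * (1ℤ + q * + 2) ≡ + 2 + q * + 4
      lemma = solve-∀
  finish : ∀ i V l → m ≡ + 3 * ((1ℤ + i * + 2) * (1ℤ + i * + 2) + l * + 2 * (l * + 2)) + + 2 * (V * V) → Form-3-2-12 m
  finish i V l e = combine (normal-4 i) (normal-3 V≉0)
    where
    V≉0 : ¬ (V ≈ 0ℤ [ + 3 ])
    V≉0 z = clash {0ℤ} {+ 2} 3 (λ ()) (≈-trans (≈-sym (≈-trans (by (i² + l * + 2 * (l * + 2)) (multiple i² (l * + 2 * (l * + 2)) (V * V))) (*-congˡ (+ 2) (*-cong z z)))) (≈-trans (≈-reflexive (sym e)) m≈2))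
      where
      i² = (1ℤ + i * + 2) * (1ℤ + i * + 2)
      multiple : ∀ a b v → + 3 * (a + b) + + 2 * v ≡ + 2 * v + (a + b) * + 3
      multiple = solve-∀
    combine : Normal 4 1ℤ (1ℤ + i * + 2) → Normal 3 1ℤ V → Form-3-2-12 m
    combine (normal u i²) (normal v V²) = u , v , l , trans e (trans (cong₂ (λ a b → + 3 * (a + l * + 2 * (l * + 2)) + + 2 * b) i² V²) (reorder ((1ℤ + + 4 * u) * (1ℤ + + 4 * u)) l ((1ℤ + + 3 * v) * (1ℤ + + 3 * v))))
      where
      reorder : ∀ a l b → + 3 * (a + l * + 2 * (l * + 2)) + + 2 * b ≡ + 3 * a + + 2 * b + + 12 * (l * l)
      reorder = solve-∀
  oneOdd : ∀ {p q V} → Parity p → Parity q → m ≡ + 3 * (p * p + q * q) + + 2 * (V * V) → Form-3-2-12 m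
  oneOdd {V = V} (odd i) (even l) e = finish i V l e
  oneOdd {V = V} (even l) (odd i) e = finish i V l (trans e (cong (λ s → + 3 * s + + 2 * (V * V)) (ℤₚ.+-comm (l * + 2 * (l * + 2)) ((1ℤ + i * + 2) * (1ℤ + i * + 2)))))
  oneOdd {V = V} (even k) (even l) e = ⊥-elim (clash {1ℤ} {0ℤ} 2 (λ ()) (≈-trans (≈-sym m≈1) (≈-trans (≈-reflexive e) (by (+ 6 * (k * k + l * l) + V * V) (lemma k l V)))))
    where
    lemma : ∀ k l V → + 3 * (k * + 2 * (k * + 2) + l * + 2 * (l * + 2)) + + 2 * (V * V) ≡ 0ℤ + (+ 6 * (k * k + l * l) + V * V) * + 2
    lemma = solve-∀
  oneOdd {V = V} (odd k) (odd l) e = ⊥-elim (clash {1ℤ} {0ℤ} 2 (λ ()) (≈-trans (≈-sym m≈1) (≈-trans (≈-reflexive e) (by (+ 3 + + 6 * (k + k * k + l + l * l) + V * V) (lemma k l V)))))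
    where
    lemma : ∀ k l V → + 3 * ((1ℤ + k * + 2) * (1ℤ + k * + 2) + (1ℤ + l * + 2) * (1ℤ + l * + 2)) + + 2 * (V * V) ≡ 0ℤ + (+ 3 + + 6 * (k + k * k + l + l * l) + V * V) * + 2
    lemma = solve-∀
  sum : ∀ {v c d} (p : Parity v) (q : Parity c) (r : Parity d) → + 2 * m ≡ + 3 * (v * v) + c * c + + 3 * (d * d) → + 3 * residue² p + residue² q + + 3 * residue² r ≈ + 2 [ + 4 ]
  sum p q r e = ≈-trans (≈-sym (+-cong (+-cong (*-congˡ (+ 3) (residue²-≈ p)) (residue²-≈ q)) (*-congˡ (+ 3) (residue²-≈ r)))) (≈-trans (≈-reflexive (sym e)) 2m≈2)
  go : ∀ {v c d} → Parity v → Parity c → Parity d → + 2 * m ≡ + 3 * (v * v) + c * c + + 3 * (d * d) → Form-3-2-12 m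
  go (odd i) (even V) (odd j) e = oneOdd {V = V} (parity (1ℤ + i + j)) (parity (i - j)) (ℤₚ.*-cancelˡ-≡ (+ 2) m _ (trans e (lemma i V j)))
    where
    lemma : ∀ i V j → + 3 * ((1ℤ + i * + 2) * (1ℤ + i * + 2)) + V * + 2 * (V * + 2) + + 3 * ((1ℤ + j * + 2) * (1ℤ + j * + 2)) ≡ + 2 * (+ 3 * ((1ℤ + i + j) * (1ℤ + i + j) + (i - j) * (i - j)) + + 2 * (V * V))
    lemma = solve-∀
  go (even i) (even V) (even j) e = ⊥-elim (clash 4 (λ ()) (sum (even i) (even V) (even j) e))
  go (even i) (even V) (odd j) e = ⊥-elim (clash 4 (λ ()) (sum (even i) (even V) (odd j) e))
  go (even i) (odd V) (even j) e = ⊥-elim (clash 4 (λ ()) (sum (even i) (odd V) (even j) e))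
  go (even i) (odd V) (odd j) e = ⊥-elim (clash 4 (λ ()) (sum (even i) (odd V) (odd j) e))
  go (odd i) (even V) (even j) e = ⊥-elim (clash 4 (λ ()) (sum (odd i) (even V) (even j) e))
  go (odd i) (odd V) (even j) e = ⊥-elim (clash 4 (λ ()) (sum (odd i) (odd V) (even j) e))
  go (odd i) (odd V) (odd j) e = ⊥-elim (clash 4 (λ ()) (sum (odd i) (odd V) (odd j) e))
  divide : (x - y ≈ 0ℤ [ + 3 ]) × (z ≈ 0ℤ [ + 3 ]) → Form-3-2-12 m
  divide (by k x-y≡ , by v z≡) = withNorm (norm-1-3 (y + k) k)
    where
    x≡ : x ≡ y + k * + 3
    x≡ = trans (split x y) (cong (_+_ y) (trans x-y≡ (ℤₚ.+-identityˡ (k * + 3))))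
      where
      split : ∀ x y → x ≡ y + (x - y)
      split = solve-∀
    expand : ∀ y k v → (y + k * + 3) * (y + k * + 3) + (y + k * + 3) * y + y * y + v * + 3 * (v * + 3) ≡ + 3 * (+ 3 * (v * v) + ((y + k) * (y + k) + (y + k) * k + k * k))
    expand = solve-∀
    third : + 2 * m ≡ + 3 * (v * v) + ((y + k) * (y + k) + (y + k) * k + k * k)
    third = ℤₚ.*-cancelˡ-≡ (+ 3) (+ 2 * m) _ (trans e (trans (cong₂ (λ x z → x * x + x * y + y * y + z * z) x≡ (trans z≡ (ℤₚ.+-identityˡ (v * + 3)))) (expand y k v)))
    withNorm : Σ[ c ∈ ℤ ] Σ[ d ∈ ℤ ] (y + k) * (y + k) + (y + k) * k + k * k ≡ c * c + + 3 * (d * d) → Form-3-2-12 m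
    withNorm (c , d , f) = go (parity v) (parity c) (parity d) (trans third (trans (cong (_+_ (+ 3 * (v * v))) f) (sym (ℤₚ.+-assoc (+ 3 * (v * v)) (c * c) (+ 3 * (d * d))))))

-- The binary part x² + xy + y² takes an odd value.
Good : ℤ → Set
Good m = Σ[ i ∈ ℤ ] Σ[ y ∈ ℤ ] Σ[ z ∈ ℤ ] m ≡ (1ℤ + i * + 2) * (1ℤ + i * + 2) + (1ℤ + i * + 2) * y + y * y + z * z

-- Reflections in vectors of norm 2 of the lattice x² + xy + y² + z² move every representation to a good one.
reflect : ∀ {m} → Good m → Good (+ 4 * m)
reflect {m} (i , y , z , e) = - 1ℤ - i - z , + 2 * (1ℤ + i * + 2) , 1ℤ + i * + 2 + + 2 * y , trans (cong (+ 4 *_) e) (lemma i y z)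
  where
  lemma : ∀ i y z → + 4 * ((1ℤ + i * + 2) * (1ℤ + i * + 2) + (1ℤ + i * + 2) * y + y * y + z * z)
    ≡ (1ℤ + (- 1ℤ - i - z) * + 2) * (1ℤ + (- 1ℤ - i - z) * + 2) + (1ℤ + (- 1ℤ - i - z) * + 2) * (+ 2 * (1ℤ + i * + 2)) + + 2 * (1ℤ + i * + 2) * (+ 2 * (1ℤ + i * + 2)) + (1ℤ + i * + 2 + + 2 * y) * (1ℤ + i * + 2 + + 2 * y)
  lemma = solve-∀

good : ∀ m → Acc ℕ._<_ ∣ m ∣ → 0ℤ ℤ.< m → SumForm m → Good m
good m (acc rec) 0<m (x , y , z , e) = go (parity x) (parity y) (parity z) e
  where
  -- Here x = 2a, y = 2b and z is odd. The vector of the reflection is (1, 0, 1) for b even, (0, 1,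
  -- 1) for a even and (1, -1, 1) for both odd; the result is stated up to the order of x, y and the
  -- sign of z.
  oddZ : ∀ {a b} c → Parity a → Parity b → m ≡ + 4 * (a * a + a * b + b * b) + (1ℤ + c * + 2) * (1ℤ + c * + 2) → Good m
  oddZ {a} c _ (even b) e = - 1ℤ - c - b , + 4 * b , + 2 * a + + 2 * b , trans e (lemma a b c)
    where
    lemma : ∀ a b c → + 4 * (a * a + a * (b * + 2) + b * + 2 * (b * + 2)) + (1ℤ + c * + 2) * (1ℤ + c * + 2)
      ≡ (1ℤ + (- 1ℤ - c - b) * + 2) * (1ℤ + (- 1ℤ - c - b) * + 2) + (1ℤ + (- 1ℤ - c - b) * + 2) * (+ 4 * b) + + 4 * b * (+ 4 * b) + (+ 2 * a + + 2 * b) * (+ 2 * a + + 2 * b)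
    lemma = solve-∀
  oddZ {b = b} c (even a) (odd _) e = - 1ℤ - c - a , + 4 * a , + 2 * b + + 2 * a , trans e (lemma a b c)
    where
    lemma : ∀ a b c → + 4 * (a * + 2 * (a * + 2) + a * + 2 * b + b * b) + (1ℤ + c * + 2) * (1ℤ + c * + 2)
      ≡ (1ℤ + (- 1ℤ - c - a) * + 2) * (1ℤ + (- 1ℤ - c - a) * + 2) + (1ℤ + (- 1ℤ - c - a) * + 2) * (+ 4 * a) + + 4 * a * (+ 4 * a) + (+ 2 * b + + 2 * a) * (+ 2 * b + + 2 * a)
    lemma = solve-∀
  oddZ c (odd i) (odd j) e = i + j - c , + 3 + (i + j + c) * + 2 , (j - i) * + 2 , trans e (lemma i j c)
    where
    lemma : ∀ i j c → + 4 * ((1ℤ + i * + 2) * (1ℤ + i * + 2) + (1ℤ + i * + 2) * (1ℤ + j * + 2) + (1ℤ + j * + 2) * (1ℤ + j * + 2)) + (1ℤ + c * + 2) * (1ℤ + c * + 2)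
      ≡ (1ℤ + (i + j - c) * + 2) * (1ℤ + (i + j - c) * + 2) + (1ℤ + (i + j - c) * + 2) * (+ 3 + (i + j + c) * + 2) + (+ 3 + (i + j + c) * + 2) * (+ 3 + (i + j + c) * + 2) + (j - i) * + 2 * ((j - i) * + 2)
    lemma = solve-∀
  allEven : ∀ m' → m ≡ + 4 * m' → SumForm m' → Good m
  allEven m' m≡ rep = subst Good (sym m≡) (reflect (good m' (rec (abs-< (ℤₚ.<⇒≤ 0<m') (subst (m' ℤ.<_) (sym m≡) m'<4m'))) 0<m' rep))
    where
    0<m' : 0ℤ ℤ.< m'
    0<m' = 0<*⇒0< {+ 4} (+<+ (s≤s z≤n)) (subst (0ℤ ℤ.<_) m≡ 0<m)
    split : ∀ m → m + + 3 * m ≡ + 4 * m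
    split = solve-∀
    m'<4m' : m' ℤ.< + 4 * m'
    m'<4m' = subst₂ ℤ._<_ (ℤₚ.+-identityʳ m') (split m') (ℤₚ.+-monoʳ-< m' (0<* {+ 3} (+<+ (s≤s z≤n)) 0<m'))
  go : ∀ {x y z} → Parity x → Parity y → Parity z → m ≡ x * x + x * y + y * y + z * z → Good m
  go {y = y} {z} (odd i) _ _ e = i , y , z , e
  go {x} {z = z} (even _) (odd j) _ e = j , x , z , trans e (lemma x (1ℤ + j * + 2) z)
    where
    lemma : ∀ x y z → x * x + x * y + y * y + z * z ≡ y * y + y * x + x * x + z * z
    lemma = solve-∀
  go (even a) (even b) (odd c) e = oddZ c (parity a) (parity b) (trans e (lemma a b (1ℤ + c * + 2)))
    where
    lemma : ∀ a b z → a * + 2 * (a * + 2) + a * + 2 * (b * + 2) + b * + 2 * (b * + 2) + z * z ≡ + 4 * (a * a + a * b + b * b) + z * z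
    lemma = solve-∀
  go (even a) (even b) (even c) e = allEven (a * a + a * b + b * b + c * c) (trans e (lemma a b c)) (a , b , c , refl)
    where
    lemma : ∀ a b c → a * + 2 * (a * + 2) + a * + 2 * (b * + 2) + b * + 2 * (b * + 2) + c * + 2 * (c * + 2) ≡ + 4 * (a * a + a * b + b * b + c * c)
    lemma = solve-∀

Form-3-4-1 : ℤ → Set
Form-3-4-1 m = Σ[ u ∈ ℤ ] Σ[ v ∈ ℤ ] Σ[ w ∈ ℤ ] m ≡ + 3 * ((1ℤ + + 6 * u) * (1ℤ + + 6 * u)) + + 4 * ((1ℤ + + 3 * v) * (1ℤ + + 3 * v)) + (1ℤ + + 6 * w) * (1ℤ + + 6 * w)

-- 4(x² + xy + y²) is 3x² + (x + 2y)², and likewise with y or x + y in place of x. The variable that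
-- receives the coefficient 3 has to be odd and prime to 3. If 3 divides x, it does not divide y,
-- since otherwise z² ≡ 2 modulo 3; then y serves if it is odd, and x + y if y is even.
form-3-4-1 : ∀ {m} → m ≈ + 2 [ + 3 ] → Good m → Form-3-4-1 (+ 4 * m)
form-3-4-1 {m} m≈2 (i , y , z , e) = choose (mod3-square X) (parity y) refl
  where
  X : ℤ
  X = 1ℤ + i * + 2
  finish : ∀ a b → + 4 * m ≡ + 3 * ((1ℤ + a * + 2) * (1ℤ + a * + 2)) + + 4 * (z * z) + (1ℤ + b * + 2) * (1ℤ + b * + 2) → ¬ (1ℤ + a * + 2 ≈ 0ℤ [ + 3 ]) → Form-3-4-1 (+ 4 * m)
  finish a b e a≉0 = combine (normal-6 a a≉0) (normal-3 (proj₁ nonzero)) (normal-6 b (proj₂ nonzero))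
    where
    A B : ℤ
    A = (1ℤ + a * + 2) * (1ℤ + a * + 2)
    B = (1ℤ + b * + 2) * (1ℤ + b * + 2)
    shift : ∀ a z b → z + b ≡ + 3 * a + + 4 * z + b + - (a + z) * + 3
    shift = solve-∀
    4m≈2 : + 4 * m ≈ + 2 [ + 3 ]
    4m≈2 = ≈-trans (*-congˡ (+ 4) m≈2) (by (+ 2) refl)
    nonzero : ¬ (z ≈ 0ℤ [ + 3 ]) × ¬ (1ℤ + b * + 2 ≈ 0ℤ [ + 3 ])
    nonzero = both-nonzero (≈-trans (by (- (A + z * z)) (shift A (z * z) B)) (≈-trans (≈-reflexive (sym e)) 4m≈2))
    combine : Normal 6 1ℤ (1ℤ + a * + 2) → Normal 3 1ℤ z → Normal 6 1ℤ (1ℤ + b * + 2) → Form-3-4-1 (+ 4 * m)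
    combine (normal u a²) (normal v z²) (normal w b²) = u , v , w , trans e (cong₂ _+_ (cong₂ _+_ (cong (+ 3 *_) a²) (cong (+ 4 *_) z²)) b²)
  y≉0 : X ≈ 0ℤ [ + 3 ] → ¬ (y ≈ 0ℤ [ + 3 ])
  y≉0 x≈0 y≈0 = square-not-2 z (≈-trans (≈-trans (≈-reflexive (sym (ℤₚ.+-identityˡ (z * z)))) (+-cong (≈-sym vanishes) (≈-refl {z * z}))) (≈-trans (≈-reflexive (sym e)) m≈2))
    where
    vanishes : X * X + X * y + y * y ≈ 0ℤ [ + 3 ]
    vanishes = +-cong (+-cong (*-cong x≈0 x≈0) (*-cong x≈0 y≈0)) (*-cong y≈0 y≈0)
  choose : (X * X ≈ 0ℤ [ + 3 ] × X ≈ 0ℤ [ + 3 ]) ⊎ X * X ≈ 1ℤ [ + 3 ] → ∀ {y'} → Parity y' → y' ≡ y → Form-3-4-1 (+ 4 * m)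
  choose (inj₂ x²≈1) _ _ = finish i (i + y) (trans (cong (+ 4 *_) e) (lemma i y z)) (λ x≈0 → clash {1ℤ} {0ℤ} 3 (λ ()) (≈-trans (≈-sym x²≈1) (*-cong x≈0 x≈0)))
    where
    lemma : ∀ i y z → + 4 * ((1ℤ + i * + 2) * (1ℤ + i * + 2) + (1ℤ + i * + 2) * y + y * y + z * z) ≡ + 3 * ((1ℤ + i * + 2) * (1ℤ + i * + 2)) + + 4 * (z * z) + (1ℤ + (i + y) * + 2) * (1ℤ + (i + y) * + 2)
    lemma = solve-∀
  choose (inj₁ (_ , x≈0)) (odd j) refl = finish j (1ℤ + i + i + j) (trans (cong (+ 4 *_) e) (lemma i j z)) (y≉0 x≈0)
    where
    lemma : ∀ i j z → + 4 * ((1ℤ + i * + 2) * (1ℤ + i * + 2) + (1ℤ + i * + 2) * (1ℤ + j * + 2) + (1ℤ + j * + 2) * (1ℤ + j * + 2) + z * z)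
      ≡ + 3 * ((1ℤ + j * + 2) * (1ℤ + j * + 2)) + + 4 * (z * z) + (1ℤ + (1ℤ + i + i + j) * + 2) * (1ℤ + (1ℤ + i + i + j) * + 2)
    lemma = solve-∀
  choose (inj₁ (_ , x≈0)) (even j) refl = finish (i + j) (i - j) (trans (cong (+ 4 *_) e) (lemma i j z))
      (λ s≈0 → y≉0 x≈0 (≈-trans (≈-reflexive (difference i j)) (+-cong s≈0 (neg-cong x≈0))))
    where
    difference : ∀ i j → j * + 2 ≡ 1ℤ + (i + j) * + 2 + - (1ℤ + i * + 2)
    difference = solve-∀
    lemma : ∀ i j z → + 4 * ((1ℤ + i * + 2) * (1ℤ + i * + 2) + (1ℤ + i * + 2) * (j * + 2) + j * + 2 * (j * + 2) + z * z)
      ≡ + 3 * ((1ℤ + (i + j) * + 2) * (1ℤ + (i + j) * + 2)) + + 4 * (z * z) + (1ℤ + (i - j) * + 2) * (1ℤ + (i - j) * + 2)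
    lemma = solve-∀

-- The arithmetic progressions, and completing the squares

linear-≡ : ∀ c d n → + (c ℕ.* n ℕ.+ d) ≡ + c * + n + + d
linear-≡ c d n = cong (_+ + d) (ℤₚ.pos-* c n)

linear-≈ : ∀ {k c} d n → k ℕ∣.∣ c → + (c ℕ.* n ℕ.+ d) ≈ + d [ + k ]
linear-≈ {k} {c} d n k∣c = ≈-trans (≈-reflexive (linear-≡ c d n)) (≈-trans (+-cong (∣⇒≈0 (ℤ∣.∣m⇒∣m*n {+ k} {+ c} (+ n) (ℤ∣.∣ᵤ⇒∣ k∣c))) (≈-refl {+ d})) (≈-reflexive (ℤₚ.+-identityˡ (+ d))))

linear-odd : ∀ c d n → Odd (2 ℕ.* c ℕ.* n ℕ.+ od d)
linear-odd c d n = odd-od (c ℕ.* n ℕ.+ d) (lemma c d n)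
  where
  lemma : ∀ c d n → 2 ℕ.* c ℕ.* n ℕ.+ (1 ℕ.+ (d ℕ.+ d)) ≡ 1 ℕ.+ (c ℕ.* n ℕ.+ d ℕ.+ (c ℕ.* n ℕ.+ d))
  lemma = ℕSolver.solve-∀

≈⇒∤ : ∀ {a b} k .{{_ : NonZero k}} → (b ℤ/.%ℕ k ≡ 0ℤ ℤ/.%ℕ k → ⊥) → + a ≈ b [ + k ] → ¬ (k ℕ∣.∣ a)
≈⇒∤ k ne e d = clash k ne (≈-trans (≈-sym e) (∣⇒≈0 (ℤ∣.∣ᵤ⇒∣ d)))

from-difference : ∀ k .{{_ : ℤ.NonZero k}} {x y d} → k * x + d ≡ k * y + d → x ≡ y
from-difference k {x} {y} {d} e = ℤₚ.*-cancelˡ-≡ k x y (trans (cancel (k * x) d) (trans (cong (_- d) e) (sym (cancel (k * y) d))))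
  where
  cancel : ∀ x d → x ≡ x + d - d
  cancel = solve-∀

twoOddSquares-12 : ∀ n → TwoOddSquares (+ (12 ℕ.* n ℕ.+ 10))
twoOddSquares-12 n = twoOddSquares (≈-trans (linear-≈ 10 n (ℕ∣.divides 3 refl)) (by (+ 2) refl))
  (sumForm (eisenstein-represents-all (ℕₚ.≤-trans (s≤s z≤n) (ℕₚ.m≤n+m 10 (12 ℕ.* n))) (≈⇒∤ 3 (λ ()) (linear-≈ 10 n (ℕ∣.divides 4 refl)))))

form-3-2-12-represents : ∀ n → Form-3-2-12 (+ (6 ℕ.* n ℕ.+ 5))
form-3-2-12-represents n = form-3-2-12 (≈-trans (linear-≈ 5 n (ℕ∣.divides 3 refl)) (by (+ 2) refl)) m≈2
    (sumForm (subst (λ x → Represented eisenstein₁ (+ 3 * x)) (ℤₚ.pos-* 2 (6 ℕ.* n ℕ.+ 5)) (eisenstein-represents-all-6 (linear-odd 3 2 n) m≈2)))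
  where
  m≈2 : + (6 ℕ.* n ℕ.+ 5) ≈ + 2 [ + 3 ]
  m≈2 = ≈-trans (linear-≈ 5 n (ℕ∣.divides 2 refl)) (by 1ℤ refl)

form-6-4-1-represents : ∀ n → Form-6-4-1 (+ (12 ℕ.* n ℕ.+ 11))
form-6-4-1-represents n = form-6-4-1 (≈-trans (linear-≈ 11 n (ℕ∣.divides 3 refl)) (by (+ 2) refl)) (≈-trans (linear-≈ 11 n (ℕ∣.divides 4 refl)) (by (+ 3) refl))
  (subst TwoOddSquares (trans (cong +_ (lemma n)) (ℤₚ.pos-* 2 (12 ℕ.* n ℕ.+ 11))) (twoOddSquares-12 (2 ℕ.* n ℕ.+ 1)))
  where
  lemma : ∀ n → 12 ℕ.* (2 ℕ.* n ℕ.+ 1) ℕ.+ 10 ≡ 2 ℕ.* (12 ℕ.* n ℕ.+ 11)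
  lemma = ℕSolver.solve-∀

form-3-4-1-represents : ∀ n → Form-3-4-1 (+ 4 * + (3 ℕ.* n ℕ.+ 2))
form-3-4-1-represents n = form-3-4-1 m≈2 (good (+ m) (<-wellFounded m) (+<+ 0<m) (sumForm (eisenstein-represents-all 0<m (≈⇒∤ 3 (λ ()) m≈2))))
  where
  m = 3 ℕ.* n ℕ.+ 2
  m≈2 : + m ≈ + 2 [ + 3 ]
  m≈2 = linear-≈ 2 n (ℕ∣.divides 1 refl)
  0<m : 0 ℕ.< m
  0<m = ℕₚ.≤-trans (s≤s z≤n) (ℕₚ.m≤n+m 2 (3 ℕ.* n))

form-25-1-5-represents-31 : ∀ n → Form-25-1-5 1ℤ (+ (40 ℕ.* n ℕ.+ 31))
form-25-1-5-represents-31 n = form-25-1-5 1ℤ (by 0ℤ refl) (residue-from 7 seven refl (≈-trans (linear-≈ 31 n (ℕ∣.divides 5 refl)) (by (+ 3) refl)))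
    (≈⇒∤ 5 (λ ()) m≈31) (λ x y e → oneDivisible-1 x y (≈-trans e (≈-trans m≈31 (by (+ 6) refl))))
  where
  m≈31 : + (40 ℕ.* n ℕ.+ 31) ≈ + 31 [ + 5 ]
  m≈31 = linear-≈ 31 n (ℕ∣.divides 8 refl)

form-25-1-5-represents-39 : ∀ n → Form-25-1-5 (+ 3) (+ (40 ℕ.* n ℕ.+ 39))
form-25-1-5-represents-39 n = form-25-1-5 (+ 3) (by 1ℤ refl) (residue-from 7 seven refl (≈-trans (linear-≈ 39 n (ℕ∣.divides 5 refl)) (by (+ 4) refl)))
    (≈⇒∤ 5 (λ ()) m≈39) (λ x y e → oneDivisible-4 x y (≈-trans e (≈-trans m≈39 (by (+ 7) refl))))
  where
  m≈39 : + (40 ℕ.* n ℕ.+ 39) ≈ + 39 [ + 5 ]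
  m≈39 = linear-≈ 39 n (ℕ∣.divides 8 refl)

-- The multiplier 3 turns the summands into 3(4u + 1)² - 3, 2(3v + 1)² - 2 and 12w², whence the
-- constant 5. The other tuples use the multipliers 6, 6, 20, 20, 6 in the same way.
represents-16-8-6-4-4-0 : ∀ n → Represents (+ 16) (+ 8) (+ 6) (+ 4) (+ 4) (+ 0) n
represents-16-8-6-4-4-0 n = go (form-3-2-12-represents n)
  where
  double : ∀ n → + 3 * (+ 2 * n) + + 5 ≡ + 6 * n + + 5
  double = solve-∀
  lemma : ∀ u v w → + 3 * ((1ℤ + + 4 * u) * (1ℤ + + 4 * u)) + + 2 * ((1ℤ + + 3 * v) * (1ℤ + + 3 * v)) + + 12 * (w * w)
    ≡ + 3 * (u * (+ 16 * u + + 8) + v * (+ 6 * v + + 4) + w * (+ 4 * w + + 0)) + + 5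
  lemma = solve-∀
  go : Form-3-2-12 (+ (6 ℕ.* n ℕ.+ 5)) → Represents (+ 16) (+ 8) (+ 6) (+ 4) (+ 4) (+ 0) n
  go (u , v , w , e) = u , v , w , from-difference (+ 3) (trans (double (+ n)) (trans (sym (linear-≡ 6 5 n)) (trans e (lemma u v w))))

represents-16-8-6-4-6-2 : ∀ n → Represents (+ 16) (+ 8) (+ 6) (+ 4) (+ 6) (+ 2) n
represents-16-8-6-4-6-2 n = go (form-6-4-1-represents n)
  where
  double : ∀ n → + 6 * (+ 2 * n) + + 11 ≡ + 12 * n + + 11
  double = solve-∀
  lemma : ∀ u v w → + 6 * ((1ℤ + + 4 * u) * (1ℤ + + 4 * u)) + + 4 * ((1ℤ + + 3 * v) * (1ℤ + + 3 * v)) + (1ℤ + + 6 * w) * (1ℤ + + 6 * w)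
    ≡ + 6 * (u * (+ 16 * u + + 8) + v * (+ 6 * v + + 4) + w * (+ 6 * w + + 2)) + + 11
  lemma = solve-∀
  go : Form-6-4-1 (+ (12 ℕ.* n ℕ.+ 11)) → Represents (+ 16) (+ 8) (+ 6) (+ 4) (+ 6) (+ 2) n
  go (u , v , w , e) = u , v , w , from-difference (+ 6) (trans (double (+ n)) (trans (sym (linear-≡ 12 11 n)) (trans e (lemma u v w))))

represents-18-6-6-4-6-2 : ∀ n → Represents (+ 18) (+ 6) (+ 6) (+ 4) (+ 6) (+ 2) n
represents-18-6-6-4-6-2 n = go (form-3-4-1-represents n)
  where
  double : ∀ n → + 6 * (+ 2 * n) + + 8 ≡ + 4 * (+ 3 * n + + 2)
  double = solve-∀
  lemma : ∀ u v w → + 3 * ((1ℤ + + 6 * u) * (1ℤ + + 6 * u)) + + 4 * ((1ℤ + + 3 * v) * (1ℤ + + 3 * v)) + (1ℤ + + 6 * w) * (1ℤ + + 6 * w)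
    ≡ + 6 * (u * (+ 18 * u + + 6) + v * (+ 6 * v + + 4) + w * (+ 6 * w + + 2)) + + 8
  lemma = solve-∀
  go : Form-3-4-1 (+ 4 * + (3 ℕ.* n ℕ.+ 2)) → Represents (+ 18) (+ 6) (+ 6) (+ 4) (+ 6) (+ 2) n
  go (u , v , w , e) = u , v , w , from-difference (+ 6) (trans (double (+ n)) (trans (cong (+ 4 *_) (sym (linear-≡ 3 2 n))) (trans e (lemma u v w))))

represents-20-10-5-1-4-2 : ∀ n → Represents (+ 20) (+ 10) (+ 5) (+ 1) (+ 4) (+ 2) n
represents-20-10-5-1-4-2 n = go (form-25-1-5-represents-31 n)
  where
  double : ∀ n → + 20 * (+ 2 * n) + + 31 ≡ + 40 * n + + 31
  double = solve-∀
  lemma : ∀ u v w → + 25 * ((1ℤ + + 4 * u) * (1ℤ + + 4 * u)) + (1ℤ + + 10 * v) * (1ℤ + + 10 * v) + + 5 * ((1ℤ + + 4 * w) * (1ℤ + + 4 * w))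
    ≡ + 20 * (u * (+ 20 * u + + 10) + v * (+ 5 * v + + 1) + w * (+ 4 * w + + 2)) + + 31
  lemma = solve-∀
  go : Form-25-1-5 1ℤ (+ (40 ℕ.* n ℕ.+ 31)) → Represents (+ 20) (+ 10) (+ 5) (+ 1) (+ 4) (+ 2) n
  go (u , v , w , e) = u , v , w , from-difference (+ 20) (trans (double (+ n)) (trans (sym (linear-≡ 40 31 n)) (trans e (lemma u v w))))

represents-20-10-5-3-4-2 : ∀ n → Represents (+ 20) (+ 10) (+ 5) (+ 3) (+ 4) (+ 2) n
represents-20-10-5-3-4-2 n = go (form-25-1-5-represents-39 n)
  where
  double : ∀ n → + 20 * (+ 2 * n) + + 39 ≡ + 40 * n + + 39
  double = solve-∀
  lemma : ∀ u v w → + 25 * ((1ℤ + + 4 * u) * (1ℤ + + 4 * u)) + (+ 3 + + 10 * v) * (+ 3 + + 10 * v) + + 5 * ((1ℤ + + 4 * w) * (1ℤ + + 4 * w))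
    ≡ + 20 * (u * (+ 20 * u + + 10) + v * (+ 5 * v + + 3) + w * (+ 4 * w + + 2)) + + 39
  lemma = solve-∀
  go : Form-25-1-5 (+ 3) (+ (40 ℕ.* n ℕ.+ 39)) → Represents (+ 20) (+ 10) (+ 5) (+ 3) (+ 4) (+ 2) n
  go (u , v , w , e) = u , v , w , from-difference (+ 20) (trans (double (+ n)) (trans (sym (linear-≡ 40 39 n)) (trans e (lemma u v w))))

represents-24-12-6-2-2-0 : ∀ n → Represents (+ 24) (+ 12) (+ 6) (+ 2) (+ 2) (+ 0) n
represents-24-12-6-2-2-0 n = go (form-9-1-12 (≈-trans (linear-≈ 10 n (ℕ∣.divides 4 refl)) (by (+ 3) refl)) (twoOddSquares-12 n))
  where
  double : ∀ n → + 6 * (+ 2 * n) + + 10 ≡ + 12 * n + + 10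
  double = solve-∀
  lemma : ∀ u v w → + 9 * ((1ℤ + + 4 * u) * (1ℤ + + 4 * u)) + (1ℤ + + 6 * v) * (1ℤ + + 6 * v) + + 12 * (w * w)
    ≡ + 6 * (u * (+ 24 * u + + 12) + v * (+ 6 * v + + 2) + w * (+ 2 * w + + 0)) + + 10
  lemma = solve-∀
  go : Form-9-1-12 (+ (12 ℕ.* n ℕ.+ 10)) → Represents (+ 24) (+ 12) (+ 6) (+ 2) (+ 2) (+ 0) n
  go (u , v , w , e) = u , v , w , from-difference (+ 6) (trans (double (+ n)) (trans (sym (linear-≡ 12 10 n)) (trans e (lemma u v w))))

0<+suc : ∀ {n} → + 0 ℤ.< + suc n
0<+suc = +<+ (s≤s z≤n)

theorem2p4 : Universal (+ 16) (+ 8) (+ 6) (+ 4) (+ 4) (+ 0)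
    × Universal (+ 16) (+ 8) (+ 6) (+ 4) (+ 6) (+ 2)
    × Universal (+ 18) (+ 6) (+ 6) (+ 4) (+ 6) (+ 2)
    × Universal (+ 20) (+ 10) (+ 5) (+ 1) (+ 4) (+ 2)
    × Universal (+ 20) (+ 10) (+ 5) (+ 3) (+ 4) (+ 2)
    × Universal (+ 24) (+ 12) (+ 6) (+ 2) (+ 2) (+ 0)
theorem2p4 =
    ((0<+suc , 0<+suc , 0<+suc , ℕ∣.divides 4 refl , ℕ∣.divides 1 refl , ℕ∣.divides 2 refl) , represents-16-8-6-4-4-0)
  , ((0<+suc , 0<+suc , 0<+suc , ℕ∣.divides 4 refl , ℕ∣.divides 1 refl , ℕ∣.divides 2 refl) , represents-16-8-6-4-6-2)
  , ((0<+suc , 0<+suc , 0<+suc , ℕ∣.divides 6 refl , ℕ∣.divides 1 refl , ℕ∣.divides 2 refl) , represents-18-6-6-4-6-2)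
  , ((0<+suc , 0<+suc , 0<+suc , ℕ∣.divides 5 refl , ℕ∣.divides 2 refl , ℕ∣.divides 1 refl) , represents-20-10-5-1-4-2)
  , ((0<+suc , 0<+suc , 0<+suc , ℕ∣.divides 5 refl , ℕ∣.divides 1 refl , ℕ∣.divides 1 refl) , represents-20-10-5-3-4-2)
  , ((0<+suc , 0<+suc , 0<+suc , ℕ∣.divides 6 refl , ℕ∣.divides 2 refl , ℕ∣.divides 1 refl) , represents-24-12-6-2-2-0)
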